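{- For integer partitions $\lambda\vdash n$, the functions $S_\lambda\in\Pi(\mathbf x)$ satisfy: (i) $S_\lambda=\sum_{\mu\unlhd\lambda}\mu!\,K_{\lambda,\mu}\sum_{\lambda(\sigma)=\mu}m_\sigma$ (inner sum over set partitions $\sigma$ of $[n]$ of type $\mu$); (ii) the $S_\lambda$ (over all partitions $\lambda$) are linearly independent; (iii) $\rho(S_\lambda)=n!\,s_\lambda$; (iv) $\tilde\rho(n!\,s_\lambda)=S_\lambda$; (v) $\langle S_\lambda,S_\mu\rangle=n!^2\delta_{\lambda,\mu}$ for $\lambda,\mu\vdash n$.
   Context: $\Pi(\mathbf{x})$ is the algebra of bounded-degree elements of $\mathbb{Q}\langle\langle x_1,x_2,\ldots\rangle\rangle$ (noncommuting variables) invariant under all permutations of the variables; $\rho$ lets the variables commute; $s_\lambda$ is the ordinary Schur function, $K_{\lambda,\mu}$ Kostka numbers, $\unlhd$ dominance order, $\mu!=\prod\mu_j!$. For $\lambda\vdash n$, define $S_\lambda$ as follows: consider fillings of the Young diagram of $\lambda$ in which each cell gets a positive integer and also a label from $[n]$, each label used exactly once, such that the integers weakly increase along rows and strictly increase down columns; such a filling contributes the monomial $x_{i_1}x_{i_2}\cdots x_{i_n}$ where $i_k$ is the integer in the cell labeled $k$; $S_\lambda$ is the sum of these monomials over all such fillings. For a set partition $\sigma$ of $[n]$, $m_\sigma=\sum x_{i_1}\cdots x_{i_n}$ over $n$-tuples with $i_j=i_k$ iff $j,k$ are in the same block; $\lambda(\sigma)$ is its type (block-size partition). The lifting map is the linear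 map $\tilde\rho:\Lambda(\mathbf x)\to\Pi(\mathbf x)$, $\tilde\rho(m_\lambda)=\frac{\lambda!}{n!}\sum_{\lambda(\pi)=\lambda}m_\pi$. The bilinear form on $\Pi(\mathbf x)$ is defined by $\langle m_\pi,h_\sigma\rangle=n!\delta_{\pi,\sigma}$ for $\pi\vdash[n]$, where $h_\sigma=\sum_{(f,L)}f(1)\cdots f(n)$ over functions $f:[n]\to\{x_1,x_2,\dots\}$ together with a linear ordering $L$ of each block of $(\ker f)\wedge\sigma$, $\ker f$ being the set partition into nonempty fibers of $f$ and $\wedge$ the meet in the refinement order. -}

module Defs where

open import Data.Bool using (Bool; true; false; _∧_; if_then_else_; T)
open import Data.Nat as ℕ using (ℕ; zero; suc; _≤_; _<_; _≤ᵇ_; _<ᵇ_; _!; z≤n; s≤s)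
open import Data.Nat.Properties using (_!≢0; ≤-total; ≤-trans)
import Data.Nat.Properties as ℕₚ
open import Data.Integer using (+_)
open import Data.Rational using (ℚ; _/_; 0ℚ; 1ℚ; _+_; _*_)
open import Data.Sum using (_⊎_; inj₁; inj₂)
open import Data.Maybe using (Maybe; just; nothing)
open import Data.Product using (_×_; _,_; proj₁; proj₂)
open import Data.Product.Properties using () renaming (≡-dec to ×-≡-dec)
open import Data.List using (List; []; _∷_; _++_; map; concatMap; filter; length;
  take; drop; upTo; deduplicate; zip; foldr)
open import Data.Nat.ListAction using (sum; product)
open import Data.List.Properties using (≡-dec; take-all)
open import Data.List.Relation.Unary.All using (All; all?)
open import Data.List.Relation.Unary.Linked using (Linked; linked?)
open import Relation.Nullary using (Dec; yes; no; does; ¬_; _×-dec_)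
open import Relation.Binary.Definitions using (DecidableEquality)
open import Relation.Binary.PropositionalEquality using (_≡_; refl; sym; subst)

-- Basic conventions.
-- The variable x_{i+1} is encoded by the natural number i.
-- A (noncommutative) monomial x_{i_1} ... x_{i_n} is the word [i_1 , ... , i_n].
-- An element of Q<<x>> (in particular of Π(x)) is its coefficient function.
-- A commutative monomial x_1^{a_1} x_2^{a_2} ... is its exponent list [a_1 , a_2 , ...];
-- an element of Λ(x) (or of Q[[x]]) is its coefficient function on exponent lists.

Word : Set
Word = List ℕ

NCSeries : Set
NCSeries = Word → ℚ

CSeries : Set
CSeries = List ℕ → ℚ

ℕ→ℚ : ℕ → ℚ
ℕ→ℚ n = (+ n) / 1

Σℚ : {A : Set} → List A → (A → ℚ) → ℚ
Σℚ xs f = foldr (λ x acc → f x + acc) 0ℚ xs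

countTrue : {A : Set} → (A → Bool) → List A → ℕ
countTrue p xs = length (filter (λ x → Data.Bool.T? (p x)) xs)
  where import Data.Bool

occ : {A : Set} → DecidableEquality A → A → List A → ℕ
occ _≟_ a xs = length (filter (a ≟_) xs)

at : List ℕ → ℕ → ℕ
at [] _ = 0
at (x ∷ _) zero = x
at (_ ∷ xs) (suc k) = at xs k

allWords : ℕ → ℕ → List Word
allWords zero k = [] ∷ []
allWords (suc m) k = concatMap (λ a → map (a ∷_) (allWords m k)) (upTo k)

insertions : {A : Set} → A → List A → List (List A)
insertions x [] = (x ∷ []) ∷ []
insertions x (y ∷ ys) = (x ∷ y ∷ ys) ∷ map (y ∷_) (insertions x ys)

perms : {A : Set} → List A → List (List A)
perms [] = [] ∷ []
perms (x ∷ xs) = concatMap (insertions x) (perms xs)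

IsPartition : List ℕ → Set
IsPartition μ = Linked (λ a b → b ≤ a) μ × All (0 <_) μ

isPartition? : (μ : List ℕ) → Dec (IsPartition μ)
isPartition? μ = linked? (λ a b → b ℕₚ.≤? a) μ ×-dec all? (λ p → 0 ℕₚ.<? p) μ

_⊢_ : List ℕ → ℕ → Set
μ ⊢ n = IsPartition μ × sum μ ≡ n

partitionsOf : ℕ → List (List ℕ)
partitionsOf n =
  filter (λ μ → isPartition? μ ×-dec (sum μ ℕₚ.≟ n))
         (concatMap (λ ℓ → allWords ℓ (suc n)) (upTo (suc n)))

_!ₚ : List ℕ → ℕ
μ !ₚ = product (map _! μ)

_⊴_ : List ℕ → List ℕ → Set
μ ⊴ ν = ∀ k → sum (take k μ) ≤ sum (take k ν)

private
  decBelow : (P : ℕ → Set) → (∀ k → Dec (P k)) → (B : ℕ) → Dec (∀ k → k ≤ B → P k)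
  decBelow P P? zero with P? zero
  ... | yes p = yes λ { zero _ → p }
  ... | no ¬p = no λ f → ¬p (f zero z≤n)
  decBelow P P? (suc B) with decBelow P P? B | P? (suc B)
  ... | no ¬f | _ = no λ f → ¬f (λ k k≤B → f k (ℕₚ.m≤n⇒m≤1+n k≤B))
  ... | yes f | no ¬p = no λ g → ¬p (g (suc B) ℕₚ.≤-refl)
  ... | yes f | yes p = yes λ k k≤sB → case k (ℕₚ.m≤n⇒m<n∨m≡n k≤sB)
    where
      case : ∀ k' → (k' < suc B) ⊎ (k' ≡ suc B) → P k'
      case k' (inj₁ lt) = f k' (ℕₚ.≤-pred lt)
      case k' (inj₂ refl) = p

_⊴?_ : (μ ν : List ℕ) → Dec (μ ⊴ ν)
μ ⊴? ν with decBelow (λ k → sum (take k μ) ≤ sum (take k ν))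
                     (λ k → sum (take k μ) ℕₚ.≤? sum (take k ν)) (length μ ℕ.+ length ν)
... | no ¬f = no λ f → ¬f (λ k _ → f k)
... | yes f = yes g
  where
    B = length μ ℕ.+ length ν
    g : μ ⊴ ν
    g k with ℕₚ.≤-total k B
    ... | inj₁ k≤B = f k k≤B
    ... | inj₂ B≤k =
      subst (λ z → sum z ≤ sum (take k ν)) (sym eμ)
        (subst (λ z → sum μ ≤ sum z) (sym eλ)
          (subst (λ z → sum z ≤ sum ν) (take-all B μ (ℕₚ.m≤m+n (length μ) (length ν)))
            (subst (λ z → sum (take B μ) ≤ sum z) (take-all B ν (ℕₚ.m≤n+m (length ν) (length μ)))
              (f B ℕₚ.≤-refl))))
      where
        eμ : take k μ ≡ μ
        eμ = take-all k μ (≤-trans (ℕₚ.m≤m+n (length μ) (length ν)) B≤k)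
        eλ : take k ν ≡ ν
        eλ = take-all k ν (≤-trans (ℕₚ.m≤n+m (length ν) (length μ)) B≤k)

-- Tableaux.  A filling of the shape λ is given by its entries read row by
-- row (top row first, left to right).

rowsOf : List ℕ → List ℕ → List (List ℕ)
rowsOf [] _ = []
rowsOf (r ∷ rs) w = take r w ∷ rowsOf rs (drop r w)

weakInc : List ℕ → Bool
weakInc (a ∷ b ∷ t) = (a ≤ᵇ b) ∧ weakInc (b ∷ t)
weakInc _ = true

colStrict : List ℕ → List ℕ → Bool
colStrict (a ∷ as) (b ∷ bs) = (a <ᵇ b) ∧ colStrict as bs
colStrict _ _ = true

isSSYTRows : List (List ℕ) → Bool
isSSYTRows [] = true
isSSYTRows (r ∷ []) = weakInc r
isSSYTRows (r ∷ r' ∷ rs) = weakInc r ∧ colStrict r r' ∧ isSSYTRows (r' ∷ rs)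

isSSYT : (ν : List ℕ) → List ℕ → Bool
isSSYT ν w = isSSYTRows (rowsOf ν w)

hasContent : List ℕ → Word → Bool
hasContent α w = does (≡-dec ℕₚ._≟_ (map (λ i → occ ℕₚ._≟_ i w) (upTo (length α))) α)
               ∧ does (all? (λ a → a ℕₚ.<? length α) w)

kostka : List ℕ → List ℕ → ℕ
kostka ν α = countTrue (λ w → isSSYT ν w ∧ hasContent α w) (allWords (sum ν) (length α))

schur : List ℕ → CSeries
schur ν α = ℕ→ℚ (kostka ν α)

-- The functions S_λ.
-- A labelled filling of λ ⊢ n: a bijection of cells with the labels {0,…,n-1}
-- (a permutation p of [0..n-1] read along the cells in row-reading order) plus
-- integers in the cells; it contributes x_{i_1}…x_{i_n}, i_k the integer in the
-- cell labelled k.  So the coefficient of a word w of length n is the number of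
-- labellings p such that the cell labelled k carries w_k and the result is semistandard.

Scount : List ℕ → Word → ℕ
Scount ν w with length w ℕₚ.≟ sum ν
... | yes _ = countTrue (λ p → isSSYT ν (map (at w) p)) (perms (upTo (sum ν)))
... | no _ = 0

S : List ℕ → NCSeries
S ν w = ℕ→ℚ (Scount ν w)

-- Set partitions of [n] are encoded canonically by restricted growth words:
-- blocks numbered 0,1,2,… in order of their smallest element; position j holds
-- the number of the block containing j.

private
  indexOf : {A : Set} → DecidableEquality A → A → List A → Maybe ℕ
  indexOf _≟_ a [] = nothing
  indexOf _≟_ a (x ∷ xs) with a ≟ x
  ... | yes _ = just 0
  ... | no _ with indexOf _≟_ a xs
  ...   | just i = just (suc i)
  ...   | nothing = nothing

  kerAux : {A : Set} → DecidableEquality A → List A → List A → List ℕ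
  kerAux _≟_ seen [] = []
  kerAux _≟_ seen (x ∷ xs) with indexOf _≟_ x seen
  ... | just i = i ∷ kerAux _≟_ seen xs
  ... | nothing = length seen ∷ kerAux _≟_ (seen ++ (x ∷ [])) xs

-- ker f : the set partition of positions into the nonempty fibres of f
kerBy : {A : Set} → DecidableEquality A → List A → List ℕ
kerBy _≟_ = kerAux _≟_ []

ker : Word → List ℕ
ker = kerBy ℕₚ._≟_

setPartitions : ℕ → List (List ℕ)
setPartitions n = filter (λ σ → ≡-dec ℕₚ._≟_ (ker σ) σ) (allWords n n)

_∧ₛ_ : List ℕ → List ℕ → List ℕ
π ∧ₛ σ = kerBy (×-≡-dec ℕₚ._≟_ ℕₚ._≟_) (zip π σ)

private
  insertDesc : ℕ → List ℕ → List ℕ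
  insertDesc a [] = a ∷ []
  insertDesc a (b ∷ bs) = if b ≤ᵇ a then a ∷ b ∷ bs else b ∷ insertDesc a bs

sortDesc : List ℕ → List ℕ
sortDesc = foldr insertDesc []

blockSizes : List ℕ → List ℕ
blockSizes σ = map (λ b → occ ℕₚ._≟_ b σ) (deduplicate ℕₚ._≟_ σ)

typeOf : List ℕ → List ℕ
typeOf σ = sortDesc (blockSizes σ)

mSP : List ℕ → NCSeries
mSP σ w = if does (≡-dec ℕₚ._≟_ (ker w) σ) then 1ℚ else 0ℚ

-- h_σ : coefficient of the word f(1)…f(n) is the number of choices of a linear
-- ordering of each block of (ker f) ∧ σ, i.e. ∏_B |B|!
hSP : List ℕ → NCSeries
hSP σ w with length w ℕₚ.≟ length σ
... | yes _ = ℕ→ℚ (product (map _! (blockSizes (ker w ∧ₛ σ))))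
... | no _ = 0ℚ

-- ρ : Π(x) → Λ(x), letting the variables commute:
-- coefficient of x^α in ρ(f) is the sum of coefficients of f over words of content α.
ρ : NCSeries → CSeries
ρ f α = Σℚ (filter (λ w → Data.Bool.T? (hasContent α w)) (allWords (sum α) (length α))) f
  where import Data.Bool

-- the lifting map ρ̃ : Λ(x) → Π(x), linear with ρ̃(m_μ) = μ!/n! Σ_{λ(π)=μ} m_π.
-- For f = Σ_μ c_μ m_μ ∈ Λ, c_μ is the coefficient of x^μ = x_1^{μ_1}x_2^{μ_2}…, so the
-- coefficient of a word w of length n in ρ̃(f) is μ!/n! · c_μ with μ = λ(ker w).
ρ̃ : CSeries → NCSeries
ρ̃ f w = (_/_ (+ (μ !ₚ)) (length w !) {{length w !≢0}}) * f μ
  where μ = typeOf (ker w)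

scaleC : ℚ → CSeries → CSeries
scaleC c f α = c * f α

δ : List ℕ → List ℕ → ℚ
δ a b = if does (≡-dec ℕₚ._≟_ a b) then 1ℚ else 0ℚ

-- Bilinear forms on the degree-n part Π_n, which has basis {m_π : π ⊢ [n]}.
-- A bilinear form is given by its Gram matrix G(π,τ) = ⟨m_π, m_τ⟩; for homogeneous
-- symmetric f, g of degree n, f = Σ_π f(π) m_π (the coefficient of m_π is the
-- coefficient of the word π itself).

pairing : ℕ → (List ℕ → List ℕ → ℚ) → NCSeries → NCSeries → ℚ
pairing n G f g =
  Σℚ (setPartitions n) λ π → Σℚ (setPartitions n) λ τ → f π * g τ * G π τ

IsStdForm : ℕ → (List ℕ → List ℕ → ℚ) → Set
IsStdForm n G = ∀ π σ → π Data.List.Membership.Propositional.∈ setPartitions n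
                      → σ Data.List.Membership.Propositional.∈ setPartitions n
                      → pairing n G (mSP π) (hSP σ) ≡ ℕ→ℚ (n !) * δ π σ
  where import Data.List.Membership.Propositional

_≟L_ : DecidableEquality (List ℕ)
_≟L_ = ≡-dec ℕₚ._≟_

{-# OPTIONS --safe #-}
-- Everything rests on the Cauchy identity  Σ_v h_{ker v}(w) = Σ_{λ ⊢ n} S_λ(u) S_λ(w),  where v runs over the
-- n! rearrangements of the word u.  The coefficient S_λ(w) is the product of the factorials of the
-- multiplicities of w times a Kostka number, and h_{ker v}(w) depends only on the multiplicities of the pairs
-- (w_i , v_i), so both sides reduce to counting matrices by their row and column sums as
-- Σ_λ K_{λα} K_{λβ}.  This follows from the commutation of adding and removing horizontal strips, which is
-- proved by reflecting each part of a partition in the interval allowed by interlacing.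
--
-- Kostka numbers are triangular for dominance, which gives (ii).  Since the left side of the Cauchy identity
-- is unchanged when the letters of w are renamed or permuted, (ii) shows that S_λ(w) depends only on the type
-- of ker w; this is (i) and (iv).  For (v), pair the Cauchy identity with S_ν: it becomes
-- Σ_λ ⟨S_ν , S_λ⟩ S_λ(u) = n!² S_ν(u) for every u, and (ii) applies once more.
module Submission where

open import Defs
open import Data.Bool using (Bool; true; false; _∧_; T; T?; if_then_else_)
open import Data.Bool.Properties using (∧-identityʳ)
open import Data.Empty using (⊥)
import Data.Integer as ℤ
import Data.Integer.Properties as ℤₚ
open import Data.List using (List; []; _∷_; _++_; map; concat; concatMap; filter; length; upTo; applyUpTo; replicate; take; drop; reverse; zip; zipWith; foldr; deduplicate; cartesianProductWith)
import Data.List.Membership.DecPropositional as DecMembership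
open import Data.List.Membership.Propositional using (_∈_; _∉_; find; lose)
open import Data.List.Membership.Propositional.Properties
open import Data.List.Properties using (≡-dec; ∷-injective; ++-assoc; ++-identityʳ; map-++; map-∘; map-cong; map-id; map-upTo; upTo-∷ʳ; length-++; length-map; length-take; length-drop; length-filter; length-replicate; length-reverse; take++drop≡id; filter-++; filter-all; filter-none; filter-accept; filter-reject; reverse-++; reverse-injective)
open import Data.List.Relation.Binary.Disjoint.Propositional using (Disjoint)
import Data.List.Relation.Binary.Permutation.Propositional as Perm
open import Data.List.Relation.Binary.Permutation.Propositional using (_↭_; ↭-refl; ↭-trans; ↭-sym; ↭⇒↭ₛ; prep; swap; module PermutationReasoning)
import Data.List.Relation.Binary.Permutation.Propositional.Properties as ↭ₚ
import Data.List.Relation.Binary.Permutation.Setoid.Properties as ↭ₛₚ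
open import Data.List.Relation.Binary.Pointwise as Pointwise using (Pointwise; []; _∷_)
open import Data.List.Relation.Unary.All as All using (All; []; _∷_; all?)
import Data.List.Relation.Unary.All.Properties as Allₚ
open import Data.List.Relation.Unary.AllPairs using ([]; _∷_)
open import Data.List.Relation.Unary.Any using (Any; here; there)
open import Data.List.Relation.Unary.Linked as Linked using (Linked; []; [-]; _∷_; linked?)
import Data.List.Relation.Unary.Unique.DecPropositional.Properties as DecUniqueₚ
open import Data.List.Relation.Unary.Unique.Propositional using (Unique)
import Data.List.Relation.Unary.Unique.Propositional.Properties as Uniqueₚ
open import Data.Maybe using (Maybe; just; nothing)
open import Data.Nat as ℕ using (ℕ; zero; suc; _+_; _*_; _!; _≤_; _<_; _≤ᵇ_; _<ᵇ_; _⊔_; _⊓_; z≤n; s≤s; NonZero)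
open import Data.Nat.ListAction using (sum; product)
open import Data.Nat.ListAction.Properties using (sum-++; sum-↭; product-↭)
import Data.Nat.Properties as ℕₚ
open import Data.Nat.Tactic.RingSolver using (solve-∀)
open import Data.Product using (_×_; _,_; proj₁; proj₂; ∃)
open import Data.Product.Properties using () renaming (≡-dec to ×-≡-dec)
open import Data.Rational using (ℚ; 0ℚ; 1ℚ; toℚᵘ; _/_) renaming (_+_ to _+ℚ_; _*_ to _*ℚ_; _-_ to _-ℚ_; -_ to -ℚ_)
import Data.Rational as ℚ
import Data.Rational.Properties as ℚₚ
import Data.Rational.Unnormalised as ℚᵘ
import Data.Rational.Unnormalised.Properties as ℚᵘₚ
open import Data.Sum using (_⊎_; inj₁; inj₂; [_,_]′)
open import Data.Unit using (⊤; tt)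
open import Function using (_∘_; id)
open import Relation.Binary.Definitions using (DecidableEquality)
open import Relation.Binary.PropositionalEquality
open import Relation.Nullary using (Dec; yes; no; does; ¬_; _×-dec_; contradiction)
open import Relation.Nullary.Decidable using (dec-true; dec-false; toSum)
open import Tactic.Cong using (cong!)

open DecMembership ℕₚ._≟_ using () renaming (_∈?_ to _∈ᴺ?_)

-- All counting is done with sums of 0/1 indicators in ℚ over explicit finite lists, so that
-- bijections become exchanges of summation and equivalences of guards. The price is that every
-- index set is a box: a partition is a list of exactly j + 1 entries below B, padded with zeros.
-- Adding a horizontal strip may open a new row, which a box of fixed height cannot hold. One spare
-- row cures this: in degree n the box has n + 1 rows, a shape of size at most n leaves the last one
-- empty, and `Last0` carries this fact through the commutation.
--
-- No insertion algorithm and no Bender-Knuth involution occurs; the symmetry of Kostka numbers in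
-- the content is a consequence of the Cauchy identity rather than an ingredient of it.
--
-- For (v) the form is known only through the numbers ⟨m_π , h_σ⟩, and the expansion of a single S_λ
-- in the h_σ is never computed: the Cauchy identity writes the combination Σ_λ S_λ(u) S_λ as a sum
-- of h_σ, which suffices because u is arbitrary. One factor n! of the norm comes from the form, the
-- other from the n! rearrangements of u.

private
  variable
    A B : Set
    P Q R P₁ P₂ Q₁ Q₂ Q₃ : Set

-- Sums and indicators

ℕ→ℚ-toℚᵘ : ∀ n → toℚᵘ (ℕ→ℚ n) ℚᵘ.≃ ℚᵘ.mkℚᵘ (ℤ.+ n) 0
ℕ→ℚ-toℚᵘ n = ℚₚ.toℚᵘ-fromℚᵘ (ℚᵘ.mkℚᵘ (ℤ.+ n) 0)

ℕ→ℚ-+ : ∀ m n → ℕ→ℚ (m + n) ≡ ℕ→ℚ m +ℚ ℕ→ℚ n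
ℕ→ℚ-+ m n = ℚₚ.toℚᵘ-injective (begin
  toℚᵘ (ℕ→ℚ (m + n))                                ≈⟨ ℕ→ℚ-toℚᵘ (m + n) ⟩
  ℚᵘ.mkℚᵘ (ℤ.+ (m + n)) 0                           ≡⟨ cong (λ z → ℚᵘ.mkℚᵘ z 0) (trans (ℤₚ.pos-+ m n) (cong₂ ℤ._+_ (sym (ℤₚ.*-identityʳ (ℤ.+ m))) (sym (ℤₚ.*-identityʳ (ℤ.+ n))))) ⟩
  ℚᵘ.mkℚᵘ (ℤ.+ m) 0 ℚᵘ.+ ℚᵘ.mkℚᵘ (ℤ.+ n) 0          ≈⟨ ℚᵘₚ.+-cong (ℕ→ℚ-toℚᵘ m) (ℕ→ℚ-toℚᵘ n) ⟨
  toℚᵘ (ℕ→ℚ m) ℚᵘ.+ toℚᵘ (ℕ→ℚ n)                    ≈⟨ ℚₚ.toℚᵘ-homo-+ (ℕ→ℚ m) (ℕ→ℚ n) ⟨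
  toℚᵘ (ℕ→ℚ m +ℚ ℕ→ℚ n) ∎)
  where open ℚᵘₚ.≃-Reasoning

ℕ→ℚ-* : ∀ m n → ℕ→ℚ (m * n) ≡ ℕ→ℚ m *ℚ ℕ→ℚ n
ℕ→ℚ-* m n = ℚₚ.toℚᵘ-injective (begin
  toℚᵘ (ℕ→ℚ (m * n))                                ≈⟨ ℕ→ℚ-toℚᵘ (m * n) ⟩
  ℚᵘ.mkℚᵘ (ℤ.+ (m * n)) 0                           ≡⟨ cong (λ z → ℚᵘ.mkℚᵘ z 0) (ℤₚ.pos-* m n) ⟩
  ℚᵘ.mkℚᵘ (ℤ.+ m) 0 ℚᵘ.* ℚᵘ.mkℚᵘ (ℤ.+ n) 0          ≈⟨ ℚᵘₚ.*-cong (ℕ→ℚ-toℚᵘ m) (ℕ→ℚ-toℚᵘ n) ⟨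
  toℚᵘ (ℕ→ℚ m) ℚᵘ.* toℚᵘ (ℕ→ℚ n)                    ≈⟨ ℚₚ.toℚᵘ-homo-* (ℕ→ℚ m) (ℕ→ℚ n) ⟨
  toℚᵘ (ℕ→ℚ m *ℚ ℕ→ℚ n) ∎)
  where open ℚᵘₚ.≃-Reasoning

ℕ→ℚ-injective : ∀ {m n} → ℕ→ℚ m ≡ ℕ→ℚ n → m ≡ n
ℕ→ℚ-injective {m} {n} eq with ℚᵘₚ.≃-trans (ℚᵘₚ.≃-sym (ℕ→ℚ-toℚᵘ m)) (ℚᵘₚ.≃-trans (ℚᵘₚ.≃-reflexive (cong toℚᵘ eq)) (ℕ→ℚ-toℚᵘ n))
... | ℚᵘ.*≡* e = ℤₚ.+-injective (trans (sym (ℤₚ.*-identityʳ _)) (trans e (ℤₚ.*-identityʳ _)))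

*ℚ-cancelˡ : ∀ {r p q} → r ≢ 0ℚ → r *ℚ p ≡ r *ℚ q → p ≡ q
*ℚ-cancelˡ {r} {p} {q} r≢0 eq = trans (sym (cancel p)) (trans (cong (1/r *ℚ_) eq) (cancel q))
  where
    instance _ = ℚ.≢-nonZero r≢0
    1/r : ℚ
    1/r = ℚ.1/ r
    cancel : ∀ x → 1/r *ℚ (r *ℚ x) ≡ x
    cancel x = trans (sym (ℚₚ.*-assoc 1/r r x)) (trans (cong (_*ℚ x) (ℚₚ.*-inverseˡ r)) (ℚₚ.*-identityˡ x))

*ℚ-zero-factor : ∀ {r p} → r ≢ 0ℚ → p *ℚ r ≡ 0ℚ → p ≡ 0ℚ
*ℚ-zero-factor {r} {p} r≢0 eq = *ℚ-cancelˡ r≢0 (trans (ℚₚ.*-comm r p) (trans eq (sym (ℚₚ.*-zeroʳ r))))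

+-interchange : ∀ a b c d → (a + b) + (c + d) ≡ (a + c) + (b + d)
+-interchange = solve-∀

*-swapˡ : ∀ a b c → a * (b * c) ≡ b * (a * c)
*-swapˡ = solve-∀

𝟙 : Dec P → ℚ
𝟙 d = if does d then 1ℚ else 0ℚ

𝟙-yes : (d : Dec P) → P → 𝟙 d ≡ 1ℚ
𝟙-yes d p = cong (if_then 1ℚ else 0ℚ) (dec-true d p)

𝟙-no : (d : Dec P) → ¬ P → 𝟙 d ≡ 0ℚ
𝟙-no d ¬p = cong (if_then 1ℚ else 0ℚ) (dec-false d ¬p)

𝟙-cong : (d : Dec P) (e : Dec Q) → (P → Q) → (Q → P) → 𝟙 d ≡ 𝟙 e
𝟙-cong d (yes q) f g = 𝟙-yes d (g q)
𝟙-cong d (no ¬q) f g = 𝟙-no d (¬q ∘ f)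

𝟙-× : (d : Dec P) (e : Dec Q) → 𝟙 (d ×-dec e) ≡ 𝟙 d *ℚ 𝟙 e
𝟙-× (yes _) (yes _) = refl
𝟙-× (yes _) (no _)  = refl
𝟙-× (no _)  (yes _) = refl
𝟙-× (no _)  (no _)  = refl

𝟙*-cong : (d : Dec P) {x y : ℚ} → (P → x ≡ y) → 𝟙 d *ℚ x ≡ 𝟙 d *ℚ y
𝟙*-cong (yes p) f = cong (1ℚ *ℚ_) (f p)
𝟙*-cong (no _) {x} {y} f = trans (ℚₚ.*-zeroˡ x) (sym (ℚₚ.*-zeroˡ y))

𝟙*-no : (d : Dec P) {x : ℚ} → ¬ P → 𝟙 d *ℚ x ≡ 0ℚ
𝟙*-no d {x} ¬p = trans (cong (_*ℚ x) (𝟙-no d ¬p)) (ℚₚ.*-zeroˡ x)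

𝟙*-yes : (d : Dec P) {x : ℚ} → P → 𝟙 d *ℚ x ≡ x
𝟙*-yes d {x} p = trans (cong (_*ℚ x) (𝟙-yes d p)) (ℚₚ.*-identityˡ x)

*𝟙-no : (d : Dec P) (x : ℚ) → ¬ P → x *ℚ 𝟙 d ≡ 0ℚ
*𝟙-no d x ¬p = trans (cong (x *ℚ_) (𝟙-no d ¬p)) (ℚₚ.*-zeroʳ x)

*𝟙-yes : (d : Dec P) (x : ℚ) → P → x *ℚ 𝟙 d ≡ x
*𝟙-yes d x p = trans (cong (x *ℚ_) (𝟙-yes d p)) (ℚₚ.*-identityʳ x)

-- Unlike Σℚ, this sum is stuck on a variable list, so its summand can be inferred by unification.
Σ : List A → (A → ℚ) → ℚ
Σ []       f = 0ℚ
Σ (x ∷ xs) f = f x +ℚ Σ xs f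

Σℚ≡Σ : (xs : List A) (f : A → ℚ) → Σℚ xs f ≡ Σ xs f
Σℚ≡Σ []       f = refl
Σℚ≡Σ (x ∷ xs) f = cong (f x +ℚ_) (Σℚ≡Σ xs f)

Σ-cong-∈ : (xs : List A) {f g : A → ℚ} → (∀ x → x ∈ xs → f x ≡ g x) → Σ xs f ≡ Σ xs g
Σ-cong-∈ []       h = refl
Σ-cong-∈ (x ∷ xs) h = cong₂ _+ℚ_ (h x (here refl)) (Σ-cong-∈ xs (λ y y∈ → h y (there y∈)))

Σ-cong : (xs : List A) {f g : A → ℚ} → (∀ x → f x ≡ g x) → Σ xs f ≡ Σ xs g
Σ-cong xs h = Σ-cong-∈ xs (λ x _ → h x)

Σ-0 : (xs : List A) → Σ xs (λ _ → 0ℚ) ≡ 0ℚ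
Σ-0 []       = refl
Σ-0 (x ∷ xs) = trans (ℚₚ.+-identityˡ _) (Σ-0 xs)

Σ-zero : (xs : List A) {f : A → ℚ} → (∀ x → x ∈ xs → f x ≡ 0ℚ) → Σ xs f ≡ 0ℚ
Σ-zero xs h = trans (Σ-cong-∈ xs h) (Σ-0 xs)

Σ-++ : (xs ys : List A) {f : A → ℚ} → Σ (xs ++ ys) f ≡ Σ xs f +ℚ Σ ys f
Σ-++ []       ys {f} = sym (ℚₚ.+-identityˡ _)
Σ-++ (x ∷ xs) ys {f} = trans (cong (f x +ℚ_) (Σ-++ xs ys)) (sym (ℚₚ.+-assoc (f x) _ _))

Σ-map : (h : A → B) (xs : List A) {f : B → ℚ} → Σ (map h xs) f ≡ Σ xs (f ∘ h)
Σ-map h []       = refl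
Σ-map h (x ∷ xs) {f} = cong (f (h x) +ℚ_) (Σ-map h xs)

Σ-concatMap : (h : A → List B) (xs : List A) {f : B → ℚ} → Σ (concatMap h xs) f ≡ Σ xs (λ x → Σ (h x) f)
Σ-concatMap h []       = refl
Σ-concatMap h (x ∷ xs) {f} = trans (Σ-++ (h x) (concatMap h xs)) (cong (Σ (h x) f +ℚ_) (Σ-concatMap h xs))

Σ-distribˡ : (c : ℚ) (xs : List A) {f : A → ℚ} → Σ xs (λ x → c *ℚ f x) ≡ c *ℚ Σ xs f
Σ-distribˡ c []       = sym (ℚₚ.*-zeroʳ c)
Σ-distribˡ c (x ∷ xs) {f} = trans (cong (c *ℚ f x +ℚ_) (Σ-distribˡ c xs)) (sym (ℚₚ.*-distribˡ-+ c (f x) _))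

Σ-distribʳ : (c : ℚ) (xs : List A) {f : A → ℚ} → Σ xs (λ x → f x *ℚ c) ≡ Σ xs f *ℚ c
Σ-distribʳ c []       = sym (ℚₚ.*-zeroˡ c)
Σ-distribʳ c (x ∷ xs) {f} = trans (cong (f x *ℚ c +ℚ_) (Σ-distribʳ c xs)) (sym (ℚₚ.*-distribʳ-+ c (f x) _))

+ℚ-interchange : ∀ a b c d → (a +ℚ b) +ℚ (c +ℚ d) ≡ (a +ℚ c) +ℚ (b +ℚ d)
+ℚ-interchange a b c d = begin
  (a +ℚ b) +ℚ (c +ℚ d)  ≡⟨ ℚₚ.+-assoc a b _ ⟩
  a +ℚ (b +ℚ (c +ℚ d))  ≡⟨ cong (a +ℚ_) (ℚₚ.+-assoc b c d) ⟨
  a +ℚ ((b +ℚ c) +ℚ d)  ≡⟨ cong (λ z → a +ℚ (z +ℚ d)) (ℚₚ.+-comm b c) ⟩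
  a +ℚ ((c +ℚ b) +ℚ d)  ≡⟨ cong (a +ℚ_) (ℚₚ.+-assoc c b d) ⟩
  a +ℚ (c +ℚ (b +ℚ d))  ≡⟨ ℚₚ.+-assoc a c _ ⟨
  (a +ℚ c) +ℚ (b +ℚ d)  ∎
  where open ≡-Reasoning

Σ-+ : (xs : List A) {f g : A → ℚ} → Σ xs (λ x → f x +ℚ g x) ≡ Σ xs f +ℚ Σ xs g
Σ-+ []       = refl
Σ-+ (x ∷ xs) {f} {g} = trans (cong (f x +ℚ g x +ℚ_) (Σ-+ xs)) (+ℚ-interchange (f x) (g x) _ _)

Σ-swap : (xs : List A) (ys : List B) {f : A → B → ℚ} →
         Σ xs (λ x → Σ ys (f x)) ≡ Σ ys (λ y → Σ xs (λ x → f x y))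
Σ-swap []       ys = sym (Σ-0 ys)
Σ-swap (x ∷ xs) ys {f} = trans (cong (Σ ys (f x) +ℚ_) (Σ-swap xs ys)) (sym (Σ-+ ys))

Σ-filter : {P : A → Set} (P? : ∀ x → Dec (P x)) (xs : List A) {f : A → ℚ} →
           Σ (filter P? xs) f ≡ Σ xs (λ x → 𝟙 (P? x) *ℚ f x)
Σ-filter P? [] = refl
Σ-filter P? (x ∷ xs) {f} with P? x
... | yes _ = cong₂ _+ℚ_ (sym (ℚₚ.*-identityˡ (f x))) (Σ-filter P? xs)
... | no _  = trans (Σ-filter P? xs) (trans (sym (ℚₚ.+-identityˡ _)) (cong (_+ℚ _) (sym (ℚₚ.*-zeroˡ (f x)))))

Σ-unique : {xs : List A} {f : A → ℚ} {x : A} → Unique xs → x ∈ xs →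
           (∀ y → y ∈ xs → y ≢ x → f y ≡ 0ℚ) → Σ xs f ≡ f x
Σ-unique {f = f} {x} (x∉ ∷ u) (here refl) h =
  trans (cong (f x +ℚ_) (Σ-zero _ λ y y∈ → h y (there y∈) (≢-sym (All.lookup x∉ y∈)))) (ℚₚ.+-identityʳ (f x))
Σ-unique {xs = y ∷ xs} {f} {x} (y∉ ∷ u) (there x∈) h =
  trans (cong₂ _+ℚ_ (h y (here refl) (All.lookup y∉ x∈)) (Σ-unique u x∈ λ z z∈ → h z (there z∈))) (ℚₚ.+-identityˡ (f x))

Σ-pick : {P : A → Set} (P? : ∀ x → Dec (P x)) {xs : List A} {f : A → ℚ} {x : A} → Unique xs → x ∈ xs → P x →
         (∀ y → y ∈ xs → P y → y ≡ x) → Σ xs (λ y → 𝟙 (P? y) *ℚ f y) ≡ f x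
Σ-pick P? {x = x} u x∈ px h =
  trans (Σ-unique u x∈ (λ y y∈ y≢x → 𝟙*-no (P? y) (y≢x ∘ h y y∈))) (𝟙*-yes (P? x) px)

Σ-none : {P : A → Set} (P? : ∀ x → Dec (P x)) {xs : List A} {f : A → ℚ} →
         (∀ y → y ∈ xs → ¬ P y) → Σ xs (λ y → 𝟙 (P? y) *ℚ f y) ≡ 0ℚ
Σ-none P? h = Σ-zero _ (λ y y∈ → 𝟙*-no (P? y) (h y y∈))

-- Both sides equal the sum over the pairs (x , y) with `φ x ≡ y`: injectivity leaves at most one x
-- for each y, and a y without a preimage contributes zero. This is how a sum moves from one index
-- set to another.
Σ-image : DecidableEquality B → {xs : List A} {ys : List B} (φ : A → B) {f : B → ℚ} → Unique xs → Unique ys →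
          (∀ x → x ∈ xs → φ x ∈ ys) → (∀ x x′ → x ∈ xs → x′ ∈ xs → φ x ≡ φ x′ → x ≡ x′) →
          (∀ y → y ∈ ys → ¬ (∃ λ x → x ∈ xs × φ x ≡ y) → f y ≡ 0ℚ) →
          Σ ys f ≡ Σ xs (f ∘ φ)
Σ-image {B} {A} _≟_ {xs} {ys} φ {f} uxs uys φ∈ φ-inj f-supp = begin
  Σ ys f                                                   ≡⟨ Σ-cong-∈ ys (λ y y∈ → expand y y∈ (Any-φ y)) ⟩
  Σ ys (λ y → Σ xs (λ x → 𝟙 (φ x ≟ y) *ℚ f y))            ≡⟨ Σ-swap ys xs ⟩
  Σ xs (λ x → Σ ys (λ y → 𝟙 (φ x ≟ y) *ℚ f y))            ≡⟨ Σ-cong-∈ xs (λ x x∈ → Σ-pick (φ x ≟_) uys (φ∈ x x∈) refl (λ _ _ → sym)) ⟩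
  Σ xs (f ∘ φ)                                             ∎
  where
    open ≡-Reasoning
    Any-φ : ∀ y → Dec (∃ λ x → x ∈ xs × φ x ≡ y)
    Any-φ y = search xs
      where
        search : ∀ zs → Dec (∃ λ x → x ∈ zs × φ x ≡ y)
        search [] = no λ ()
        search (z ∷ zs) with φ z ≟ y | search zs
        ... | yes e | _ = yes (z , here refl , e)
        ... | no _  | yes (x , x∈ , e) = yes (x , there x∈ , e)
        ... | no ¬e | no ¬s = no λ { (_ , here refl , e) → ¬e e ; (x , there x∈ , e) → ¬s (x , x∈ , e) }
    expand : ∀ y → y ∈ ys → Dec (∃ λ x → x ∈ xs × φ x ≡ y) → f y ≡ Σ xs (λ x → 𝟙 (φ x ≟ y) *ℚ f y)
    expand y y∈ (yes (x , x∈ , e)) =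
      sym (Σ-pick (λ x → φ x ≟ y) uxs x∈ e (λ x′ x′∈ e′ → φ-inj x′ x x′∈ x∈ (trans e′ (sym e))))
    expand y y∈ (no ¬x) = trans (f-supp y y∈ ¬x) (sym (Σ-none (λ x → φ x ≟ y) (λ x x∈ e → ¬x (x , x∈ , e))))

countTrue-Σ : (p : A → Bool) (xs : List A) → ℕ→ℚ (countTrue p xs) ≡ Σ xs (λ x → 𝟙 (T? (p x)))
countTrue-Σ p [] = refl
countTrue-Σ p (x ∷ xs) with p x
... | true  = trans (ℕ→ℚ-+ 1 (countTrue p xs)) (cong (1ℚ +ℚ_) (countTrue-Σ p xs))
... | false = trans (countTrue-Σ p xs) (sym (ℚₚ.+-identityˡ _))

Σ-const : (c : ℚ) (xs : List A) → Σ xs (λ _ → c) ≡ ℕ→ℚ (length xs) *ℚ c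
Σ-const c [] = sym (ℚₚ.*-zeroˡ c)
Σ-const c (x ∷ xs) = trans (cong₂ _+ℚ_ (sym (ℚₚ.*-identityˡ c)) (Σ-const c xs))
  (trans (sym (ℚₚ.*-distribʳ-+ c 1ℚ (ℕ→ℚ (length xs)))) (cong (_*ℚ c) (sym (ℕ→ℚ-+ 1 (length xs)))))

-- The local rule for horizontal strips

-- Guards matter only up to logical equivalence, so a conjunction can be reordered and cut in two
-- before one of the halves is pulled out of a sum.
𝟙-split : (d : Dec P) (e : Dec Q) (g : Dec R) {x : ℚ} → (P → Q × R) → (Q → R → P) →
          𝟙 d *ℚ x ≡ 𝟙 e *ℚ (𝟙 g *ℚ x)
𝟙-split d e g {x} f h = begin
  𝟙 d *ℚ x             ≡⟨ cong (_*ℚ x) (𝟙-cong d (e ×-dec g) f (λ { (q , r) → h q r })) ⟩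
  𝟙 (e ×-dec g) *ℚ x   ≡⟨ cong (_*ℚ x) (𝟙-× e g) ⟩
  (𝟙 e *ℚ 𝟙 g) *ℚ x    ≡⟨ ℚₚ.*-assoc (𝟙 e) (𝟙 g) x ⟩
  𝟙 e *ℚ (𝟙 g *ℚ x)    ∎
  where open ≡-Reasoning

allWords-Σ : ∀ m k {F : Word → ℚ} →
             Σ (allWords (suc m) k) F ≡ Σ (upTo k) (λ a → Σ (allWords m k) (λ v → F (a ∷ v)))
allWords-Σ m k = trans (Σ-concatMap (λ a → map (a ∷_) (allWords m k)) (upTo k)) (Σ-cong (upTo k) (λ a → Σ-map (a ∷_) (allWords m k)))

∈-allWords⁺ : ∀ {m k} v → length v ≡ m → All (_< k) v → v ∈ allWords m k
∈-allWords⁺ []      refl []       = here refl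
∈-allWords⁺ {k = k} (a ∷ v) refl (a< ∷ v<) =
  ∈-concatMap⁺ (λ a → map (a ∷_) (allWords (length v) k)) {xs = upTo k} (lose′ (∈-upTo⁺ a<) (∈-map⁺ (a ∷_) (∈-allWords⁺ v refl v<)))
  where
    lose′ : ∀ {xs : List ℕ} → a ∈ xs → (a ∷ v) ∈ map (a ∷_) (allWords (length v) k) → Any (λ b → (a ∷ v) ∈ map (b ∷_) (allWords (length v) k)) xs
    lose′ = lose

∈-allWords⁻ : ∀ m k {v} → v ∈ allWords m k → length v ≡ m × All (_< k) v
∈-allWords⁻ zero    k (here refl) = refl , []
∈-allWords⁻ (suc m) k v∈ with find (∈-concatMap⁻ (λ a → map (a ∷_) (allWords m k)) {xs = upTo k} v∈)
... | a , a∈ , v∈′ with ∈-map⁻ (a ∷_) v∈′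
... | u , u∈ , refl = let e , u< = ∈-allWords⁻ m k u∈ in cong suc e , ∈-upTo⁻ a∈ ∷ u<

Unique-allWords : ∀ m k → Unique (allWords m k)
Unique-allWords zero    k = [] ∷ []
Unique-allWords (suc m) k =
  subst Unique (sym (product-form (upTo k)))
    (Uniqueₚ.cartesianProductWith⁺ _∷_ ∷-injective (Uniqueₚ.upTo⁺ k) (Unique-allWords m k))
  where
    product-form : ∀ as → concatMap (λ a → map (a ∷_) (allWords m k)) as ≡ cartesianProductWith _∷_ as (allWords m k)
    product-form []       = refl
    product-form (a ∷ as) = cong (map (a ∷_) (allWords m k) ++_) (product-form as)

-- Interlacing of consecutive rows: Mid κ μ says κ₀ ≥ μ₀ ≥ κ₁ ≥ μ₁ ≥ … ≥ κⱼ for κ of length j + 1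
-- and μ of length j.  HS λ κ says that λ/κ is a horizontal strip, the two lists having equal length.

Mid : List ℕ → List ℕ → Set
Mid []          _       = ⊥
Mid (c ∷ [])    []      = ⊤
Mid (c ∷ [])    (_ ∷ _) = ⊥
Mid (c ∷ k ∷ κ) []      = ⊥
Mid (c ∷ k ∷ κ) (m ∷ μ) = (k ≤ m × m ≤ c) × Mid (k ∷ κ) μ

mid? : ∀ κ μ → Dec (Mid κ μ)
mid? []          _       = no λ ()
mid? (c ∷ [])    []      = yes tt
mid? (c ∷ [])    (_ ∷ _) = no λ ()
mid? (c ∷ k ∷ κ) []      = no λ ()
mid? (c ∷ k ∷ κ) (m ∷ μ) = (k ℕₚ.≤? m ×-dec m ℕₚ.≤? c) ×-dec mid? (k ∷ κ) μ

HS : List ℕ → List ℕ → Set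
HS []          _           = ⊥
HS (k ∷ [])    []          = ⊥
HS (k ∷ [])    (t ∷ [])    = t ≤ k
HS (k ∷ [])    (_ ∷ _ ∷ _) = ⊥
HS (k ∷ l ∷ κ) []          = ⊥
HS (k ∷ l ∷ κ) (t ∷ τ)     = (l ≤ t × t ≤ k) × HS (l ∷ κ) τ

hs? : ∀ κ τ → Dec (HS κ τ)
hs? []          _           = no λ ()
hs? (k ∷ [])    []          = no λ ()
hs? (k ∷ [])    (t ∷ [])    = t ℕₚ.≤? k
hs? (k ∷ [])    (_ ∷ _ ∷ _) = no λ ()
hs? (k ∷ l ∷ κ) []          = no λ ()
hs? (k ∷ l ∷ κ) (t ∷ τ)     = (l ℕₚ.≤? t ×-dec t ℕₚ.≤? k) ×-dec hs? (l ∷ κ) τ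

-- Room for one more row. A horizontal strip reaches at most one row below the last nonempty one, so
-- a partition whose list ends in 0 can receive any strip without a change of length.
Last0 : List ℕ → Set
Last0 []          = ⊤
Last0 (x ∷ [])    = x ≡ 0
Last0 (x ∷ y ∷ l) = Last0 (y ∷ l)

-- Apart from its first part, the larger of two interlacing partitions sits between consecutive
-- parts of the smaller one. That first part is bounded only from below, by the first part of the
-- smaller one.
HS⇒Mid : ∀ l μ k κ → HS (l ∷ μ) (k ∷ κ) → k ≤ l × Mid (k ∷ κ) μ
HS⇒Mid l []      k []      h = h , tt
HS⇒Mid l (m ∷ μ) k (k′ ∷ κ) ((m≤k , k≤l) , h) = let k′≤m , mid = HS⇒Mid m μ k′ κ h in k≤l , (k′≤m , m≤k) , mid
HS⇒Mid l (m ∷ []) k [] (_ , ())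
HS⇒Mid l (m ∷ _ ∷ μ) k [] (_ , ())

Mid⇒HS : ∀ l μ k κ → k ≤ l → Mid (k ∷ κ) μ → HS (l ∷ μ) (k ∷ κ)
Mid⇒HS l []      k []       k≤l _ = k≤l
Mid⇒HS l (m ∷ μ) k (k′ ∷ κ) k≤l ((k′≤m , m≤k) , h) = (m≤k , k≤l) , Mid⇒HS m μ k′ κ k′≤m h

HS-sum : ∀ κ τ → HS κ τ → sum τ ≤ sum κ
HS-sum (k ∷ [])    (t ∷ []) h = ℕₚ.+-mono-≤ h z≤n
HS-sum (k ∷ l ∷ κ) (t ∷ τ)  ((_ , t≤k) , h) = ℕₚ.+-mono-≤ t≤k (HS-sum (l ∷ κ) τ h)

HS-Last0 : ∀ κ τ → HS κ τ → Last0 κ → Last0 τ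
HS-Last0 (k ∷ [])    (t ∷ [])     h refl = ℕₚ.n≤0⇒n≡0 h
HS-Last0 (k ∷ l ∷ κ) (t ∷ t′ ∷ τ) (_ , h) z = HS-Last0 (l ∷ κ) (t′ ∷ τ) h z
HS-Last0 (k ∷ l ∷ []) (t ∷ []) (_ , ()) z
HS-Last0 (k ∷ l ∷ _ ∷ _) (t ∷ []) (_ , ()) z

HS-refl-0 : ∀ κ → 0 < length κ → sum κ ≡ 0 → HS κ κ
HS-refl-0 (k ∷ [])    _ e = ℕₚ.≤-refl
HS-refl-0 (k ∷ l ∷ κ) _ e =
  (ℕₚ.≤-trans (ℕₚ.≤-reflexive (ℕₚ.m+n≡0⇒m≡0 l e′)) z≤n , ℕₚ.≤-refl) , HS-refl-0 (l ∷ κ) (s≤s z≤n) e′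
  where e′ = ℕₚ.m+n≡0⇒n≡0 k {l + sum κ} e

-- Interlacing forces the larger partition to decrease weakly, so a positive last part makes every
-- part at least 1.
HS-positive : ∀ κ τ → HS κ τ → ¬ Last0 κ → length κ ≤ sum κ
HS-positive κ τ h ¬z = proj₂ (go κ τ h ¬z)
  where
    go : ∀ κ τ → HS κ τ → ¬ Last0 κ → (∃ λ k → ∃ λ κ′ → κ ≡ k ∷ κ′ × 0 < k) × length κ ≤ sum κ
    go (zero ∷ [])  (t ∷ []) h ¬z = contradiction refl ¬z
    go (suc k ∷ []) (t ∷ []) h ¬z = (suc k , [] , refl , s≤s z≤n) , s≤s z≤n
    go (k ∷ l ∷ κ)  (t ∷ τ) ((l≤t , t≤k) , h) ¬z with go (l ∷ κ) τ h ¬z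
    ... | (_ , _ , refl , 0<l) , len = (k , _ , refl , 0<k) , ℕₚ.+-mono-≤ 0<k len
      where 0<k = ℕₚ.<-≤-trans 0<l (ℕₚ.≤-trans l≤t t≤k)

-- The reflection m ↦ lo + hi - m preserves the interval. Summing over the pairs (m , m′) with m +
-- m′ = lo + hi turns it into an exchange of two summations, and an empty interval is no exception.
-- The bound `hi < B` keeps the partner of m inside `upTo B`.
interval-reflection : ∀ {B lo hi} {I : ℕ → Set} (I? : ∀ m → Dec (I m)) {φ ψ : ℕ → ℚ} → hi < B →
  (∀ m → I m → lo ≤ m × m ≤ hi) → (∀ m → lo ≤ m → m ≤ hi → I m) →
  (∀ m m′ → I m → m + m′ ≡ lo + hi → φ m ≡ ψ m′) →
  Σ (upTo B) (λ m → 𝟙 (I? m) *ℚ φ m) ≡ Σ (upTo B) (λ m → 𝟙 (I? m) *ℚ ψ m)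
interval-reflection {B} {lo} {hi} {I} I? {φ} {ψ} hi<B I⇒ ⇒I h = begin
  Σ U (λ m → 𝟙 (I? m) *ℚ φ m)                                       ≡⟨ Σ-cong U (λ m → 𝟙*-cong (I? m) (λ im → sym (pick m im))) ⟩
  Σ U (λ m → 𝟙 (I? m) *ℚ Σ U (λ m′ → 𝟙 (m + m′ ℕₚ.≟ lo + hi) *ℚ φ m))
    ≡⟨ Σ-cong U (λ m → sym (Σ-distribˡ (𝟙 (I? m)) U)) ⟩
  Σ U (λ m → Σ U (λ m′ → 𝟙 (I? m) *ℚ (𝟙 (m + m′ ℕₚ.≟ lo + hi) *ℚ φ m)))
    ≡⟨ Σ-swap U U ⟩
  Σ U (λ m′ → Σ U (λ m → 𝟙 (I? m) *ℚ (𝟙 (m + m′ ℕₚ.≟ lo + hi) *ℚ φ m)))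
    ≡⟨ Σ-cong U (λ m′ → Σ-cong U (λ m → exchange m m′)) ⟩
  Σ U (λ m′ → Σ U (λ m → 𝟙 (I? m′) *ℚ (𝟙 (m′ + m ℕₚ.≟ lo + hi) *ℚ ψ m′)))
    ≡⟨ Σ-cong U (λ m′ → Σ-distribˡ (𝟙 (I? m′)) U) ⟩
  Σ U (λ m′ → 𝟙 (I? m′) *ℚ Σ U (λ m → 𝟙 (m′ + m ℕₚ.≟ lo + hi) *ℚ ψ m′))
    ≡⟨ Σ-cong U (λ m → 𝟙*-cong (I? m) (λ im → pick m im)) ⟩
  Σ U (λ m′ → 𝟙 (I? m′) *ℚ ψ m′) ∎
  where
    open ≡-Reasoning
    U = upTo B
    pick : ∀ m → I m → ∀ {x} → Σ U (λ m′ → 𝟙 (m + m′ ℕₚ.≟ lo + hi) *ℚ x) ≡ x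
    pick m im = Σ-pick (λ m′ → m + m′ ℕₚ.≟ lo + hi) (Uniqueₚ.upTo⁺ B)
      (∈-upTo⁺ (ℕₚ.≤-<-trans (ℕₚ.≤-trans (ℕₚ.∸-monoʳ-≤ (lo + hi) (proj₁ (I⇒ m im))) (ℕₚ.≤-reflexive (ℕₚ.m+n∸m≡n lo hi))) hi<B))
      (ℕₚ.m+[n∸m]≡n (ℕₚ.≤-trans (proj₂ (I⇒ m im)) (ℕₚ.m≤n+m hi lo)))
      (λ y _ e → ℕₚ.+-cancelˡ-≡ m _ _ (trans e (sym (ℕₚ.m+[n∸m]≡n (ℕₚ.≤-trans (proj₂ (I⇒ m im)) (ℕₚ.m≤n+m hi lo))))))
    mirror : ∀ m m′ → I m → m + m′ ≡ lo + hi → I m′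
    mirror m m′ im e = ⇒I m′
      (ℕₚ.+-cancelʳ-≤ hi lo m′ (ℕₚ.≤-trans (ℕₚ.≤-reflexive (trans (sym e) (ℕₚ.+-comm m m′))) (ℕₚ.+-monoʳ-≤ m′ (proj₂ (I⇒ m im)))))
      (ℕₚ.+-cancelˡ-≤ lo m′ hi (ℕₚ.≤-trans (ℕₚ.+-monoˡ-≤ m′ (proj₁ (I⇒ m im))) (ℕₚ.≤-reflexive e)))
    exchange : ∀ m m′ → 𝟙 (I? m) *ℚ (𝟙 (m + m′ ℕₚ.≟ lo + hi) *ℚ φ m) ≡ 𝟙 (I? m′) *ℚ (𝟙 (m′ + m ℕₚ.≟ lo + hi) *ℚ ψ m′)
    exchange m m′ = begin
      𝟙 (I? m) *ℚ (𝟙 (m + m′ ℕₚ.≟ lo + hi) *ℚ φ m)    ≡⟨ 𝟙-split both (I? m) (m + m′ ℕₚ.≟ lo + hi) id _,_ ⟨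
      𝟙 both *ℚ φ m                                    ≡⟨ 𝟙*-cong both (λ { (im , e) → h m m′ im e }) ⟩
      𝟙 both *ℚ ψ m′                                   ≡⟨ 𝟙-split both (I? m′) (m′ + m ℕₚ.≟ lo + hi)
        (λ { (im , e) → mirror m m′ im e , trans (ℕₚ.+-comm m′ m) e })
        (λ im′ e → mirror m′ m im′ e , trans (ℕₚ.+-comm m m′) e) ⟩
      𝟙 (I? m′) *ℚ (𝟙 (m′ + m ℕₚ.≟ lo + hi) *ℚ ψ m′)   ∎
      where both = I? m ×-dec (m + m′ ℕₚ.≟ lo + hi)

module _ (B : ℕ) where

  -- The common form of both sides of the commutation: μ is either a partition above κ and ρ without
  -- its first part, or a partition below them without its last part, which is 0.
  mids : ℕ → List ℕ → List ℕ → (ℕ → ℚ) → ℚ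
  mids j κ ρ f = Σ (allWords j B) (λ μ → 𝟙 (mid? κ μ ×-dec mid? ρ μ) *ℚ f (sum μ))

  in? : ∀ c d k r m → Dec ((k ≤ m × m ≤ c) × (r ≤ m × m ≤ d))
  in? c d k r m = (k ℕₚ.≤? m ×-dec m ℕₚ.≤? c) ×-dec (r ℕₚ.≤? m ×-dec m ℕₚ.≤? d)

  mids-suc : ∀ j c k κ d r ρ f → mids (suc j) (c ∷ k ∷ κ) (d ∷ r ∷ ρ) f ≡
             Σ (upTo B) (λ m → 𝟙 (in? c d k r m) *ℚ mids j (k ∷ κ) (r ∷ ρ) (λ s → f (m + s)))
  mids-suc j c k κ d r ρ f = begin
    mids (suc j) (c ∷ k ∷ κ) (d ∷ r ∷ ρ) f
      ≡⟨ allWords-Σ j B ⟩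
    Σ (upTo B) (λ m → Σ (allWords j B) (λ μ → 𝟙 (mid? (c ∷ k ∷ κ) (m ∷ μ) ×-dec mid? (d ∷ r ∷ ρ) (m ∷ μ)) *ℚ f (m + sum μ)))
      ≡⟨ Σ-cong (upTo B) (λ m → Σ-cong (allWords j B) (λ μ →
           𝟙-split (mid? (c ∷ k ∷ κ) (m ∷ μ) ×-dec mid? (d ∷ r ∷ ρ) (m ∷ μ)) (in? c d k r m) (mid? (k ∷ κ) μ ×-dec mid? (r ∷ ρ) μ)
             (λ { ((x , u) , (y , v)) → (x , y) , (u , v) }) (λ { (x , y) (u , v) → (x , u) , (y , v) }))) ⟩
    Σ (upTo B) (λ m → Σ (allWords j B) (λ μ → 𝟙 (in? c d k r m) *ℚ (𝟙 (mid? (k ∷ κ) μ ×-dec mid? (r ∷ ρ) μ) *ℚ f (m + sum μ))))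
      ≡⟨ Σ-cong (upTo B) (λ m → Σ-distribˡ (𝟙 (in? c d k r m)) (allWords j B)) ⟩
    Σ (upTo B) (λ m → 𝟙 (in? c d k r m) *ℚ mids j (k ∷ κ) (r ∷ ρ) (λ s → f (m + s))) ∎
    where open ≡-Reasoning

  -- Reflecting every μᵢ in its interval [κᵢ₊₁ ⊔ ρᵢ₊₁ , κᵢ ⊓ ρᵢ] turns the sum of μ into its complement
  -- in a constant; this is the local rule behind the commutation of adding and removing strips.
  mids-reflect : ∀ j c κ d ρ {f g : ℕ → ℚ} → length κ ≡ j → length ρ ≡ j → All (_< B) (c ∷ κ) → Last0 (d ∷ ρ) →
    (∀ x y → x + y + (c ⊔ d) ≡ sum (c ∷ κ) + sum (d ∷ ρ) → f x ≡ g y) →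
    mids j (c ∷ κ) (d ∷ ρ) f ≡ mids j (c ∷ κ) (d ∷ ρ) g
  mids-reflect zero c [] .0 [] {f} {g} refl refl _ refl h = cong (λ z → 1ℚ *ℚ z +ℚ 0ℚ) (h 0 0 e)
    where e : c ⊔ 0 ≡ c + 0 + 0
          e = trans (ℕₚ.⊔-identityʳ c) (sym (trans (ℕₚ.+-identityʳ _) (ℕₚ.+-identityʳ c)))
  mids-reflect (suc j) c (k ∷ κ) d (r ∷ ρ) {f} {g} lκ lρ (c<B ∷ κ<B) z h = begin
    mids (suc j) (c ∷ k ∷ κ) (d ∷ r ∷ ρ) f   ≡⟨ mids-suc j c k κ d r ρ f ⟩
    Σ (upTo B) (λ m → 𝟙 (in? c d k r m) *ℚ mids j (k ∷ κ) (r ∷ ρ) (λ s → f (m + s)))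
      ≡⟨ interval-reflection (in? c d k r) (ℕₚ.≤-<-trans (ℕₚ.m⊓n≤m c d) c<B)
           (λ { m ((k≤m , m≤c) , (r≤m , m≤d)) → ℕₚ.⊔-lub k≤m r≤m , ℕₚ.⊓-glb m≤c m≤d })
           (λ m lo≤ ≤hi → (ℕₚ.≤-trans (ℕₚ.m≤m⊔n k r) lo≤ , ℕₚ.≤-trans ≤hi (ℕₚ.m⊓n≤m c d))
                         , (ℕₚ.≤-trans (ℕₚ.m≤n⊔m k r) lo≤ , ℕₚ.≤-trans ≤hi (ℕₚ.m⊓n≤n c d)))
           (λ m m′ _ e → mids-reflect j k κ r ρ (ℕₚ.suc-injective lκ) (ℕₚ.suc-injective lρ) κ<B z
             (λ x y e′ → h (m + x) (m′ + y) (total m m′ x y e e′))) ⟩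
    Σ (upTo B) (λ m → 𝟙 (in? c d k r m) *ℚ mids j (k ∷ κ) (r ∷ ρ) (λ s → g (m + s)))
      ≡⟨ mids-suc j c k κ d r ρ g ⟨
    mids (suc j) (c ∷ k ∷ κ) (d ∷ r ∷ ρ) g ∎
    where
      open ≡-Reasoning
      -- The first coordinate is reflected in the interval from k ⊔ r to c ⊓ d. The term k ⊔ r is
      -- absorbed by the constant of the tail, and c ⊓ d combines with c ⊔ d into c + d.
      total : ∀ m m′ x y → m + m′ ≡ (k ⊔ r) + (c ⊓ d) → x + y + (k ⊔ r) ≡ sum (k ∷ κ) + sum (r ∷ ρ) →
              m + x + (m′ + y) + (c ⊔ d) ≡ sum (c ∷ k ∷ κ) + sum (d ∷ r ∷ ρ)
      total m m′ x y e e′ = begin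
        m + x + (m′ + y) + (c ⊔ d)               ≡⟨ lemma₁ m x m′ y (c ⊔ d) ⟩
        (m + m′) + (x + y) + (c ⊔ d)             ≡⟨ cong (λ z → z + (x + y) + (c ⊔ d)) e ⟩
        (k ⊔ r) + (c ⊓ d) + (x + y) + (c ⊔ d)    ≡⟨ lemma₂ (k ⊔ r) (c ⊓ d) (x + y) (c ⊔ d) ⟩
        (c ⊓ d) + (c ⊔ d) + (x + y + (k ⊔ r))    ≡⟨ cong₂ _+_ (⊓+⊔ c d) e′ ⟩
        c + d + (sum (k ∷ κ) + sum (r ∷ ρ))      ≡⟨ lemma₃ c d (sum (k ∷ κ)) (sum (r ∷ ρ)) ⟩
        sum (c ∷ k ∷ κ) + sum (d ∷ r ∷ ρ)        ∎
        where
          lemma₁ : ∀ m x m′ y z → m + x + (m′ + y) + z ≡ (m + m′) + (x + y) + z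
          lemma₁ = solve-∀
          lemma₂ : ∀ p q s t → p + q + s + t ≡ q + t + (s + p)
          lemma₂ = solve-∀
          lemma₃ : ∀ c d s t → c + d + (s + t) ≡ c + s + (d + t)
          lemma₃ = solve-∀
          ⊓+⊔ : ∀ c d → (c ⊓ d) + (c ⊔ d) ≡ c + d
          ⊓+⊔ c d with ℕₚ.≤-total c d
          ... | inj₁ c≤d rewrite ℕₚ.m≤n⇒m⊓n≡m c≤d | ℕₚ.m≤n⇒m⊔n≡n c≤d = refl
          ... | inj₂ d≤c rewrite ℕₚ.m≥n⇒m⊓n≡n d≤c | ℕₚ.m≥n⇒m⊔n≡m d≤c = ℕₚ.+-comm d c

  -- The last part of τ is at most the last part of ρ, which is 0. Deleting it leaves exactly the
  -- condition `Mid` for both partitions.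
  removals : ∀ j κ ρ {f : ℕ → ℚ} → 0 < B → length κ ≡ suc j → length ρ ≡ suc j → Last0 ρ →
    Σ (allWords (suc j) B) (λ τ → 𝟙 (hs? κ τ ×-dec hs? ρ τ) *ℚ f (sum τ)) ≡ mids j κ ρ f
  removals zero (c ∷ []) (.0 ∷ []) {f} 0<B refl refl refl = begin
    Σ (allWords 1 B) (λ τ → 𝟙 (hs? (c ∷ []) τ ×-dec hs? (0 ∷ []) τ) *ℚ f (sum τ))
      ≡⟨ allWords-Σ 0 B ⟩
    Σ (upTo B) (λ t → 𝟙 (t ℕₚ.≤? c ×-dec t ℕₚ.≤? 0) *ℚ f (t + 0) +ℚ 0ℚ)
      ≡⟨ Σ-cong (upTo B) (λ t → ℚₚ.+-identityʳ _) ⟩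
    Σ (upTo B) (λ t → 𝟙 (t ℕₚ.≤? c ×-dec t ℕₚ.≤? 0) *ℚ f (t + 0))
      ≡⟨ Σ-pick (λ t → t ℕₚ.≤? c ×-dec t ℕₚ.≤? 0) (Uniqueₚ.upTo⁺ B) (∈-upTo⁺ 0<B) (z≤n , z≤n) (λ { t _ (_ , t≤0) → ℕₚ.n≤0⇒n≡0 t≤0 }) ⟩
    f 0
      ≡⟨ trans (ℚₚ.+-identityʳ _) (ℚₚ.*-identityˡ _) ⟨
    1ℚ *ℚ f 0 +ℚ 0ℚ ∎
    where open ≡-Reasoning
  removals (suc j) (c ∷ k ∷ κ) (d ∷ r ∷ ρ) {f} 0<B lκ lρ z = begin
    Σ (allWords (suc (suc j)) B) (λ τ → 𝟙 (hs? (c ∷ k ∷ κ) τ ×-dec hs? (d ∷ r ∷ ρ) τ) *ℚ f (sum τ))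
      ≡⟨ allWords-Σ (suc j) B ⟩
    Σ (upTo B) (λ m → Σ (allWords (suc j) B) (λ τ → 𝟙 (hs? (c ∷ k ∷ κ) (m ∷ τ) ×-dec hs? (d ∷ r ∷ ρ) (m ∷ τ)) *ℚ f (m + sum τ)))
      ≡⟨ Σ-cong (upTo B) (λ m → Σ-cong (allWords (suc j) B) (λ τ →
           𝟙-split (hs? (c ∷ k ∷ κ) (m ∷ τ) ×-dec hs? (d ∷ r ∷ ρ) (m ∷ τ)) (in? c d k r m) (hs? (k ∷ κ) τ ×-dec hs? (r ∷ ρ) τ)
             (λ { ((x , u) , (y , v)) → (x , y) , (u , v) }) (λ { (x , y) (u , v) → (x , u) , (y , v) }))) ⟩
    Σ (upTo B) (λ m → Σ (allWords (suc j) B) (λ τ → 𝟙 (in? c d k r m) *ℚ (𝟙 (hs? (k ∷ κ) τ ×-dec hs? (r ∷ ρ) τ) *ℚ f (m + sum τ))))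
      ≡⟨ Σ-cong (upTo B) (λ m → trans (Σ-distribˡ (𝟙 (in? c d k r m)) (allWords (suc j) B))
           (cong (𝟙 (in? c d k r m) *ℚ_) (removals j (k ∷ κ) (r ∷ ρ) {λ s → f (m + s)} 0<B (ℕₚ.suc-injective lκ) (ℕₚ.suc-injective lρ) z))) ⟩
    Σ (upTo B) (λ m → 𝟙 (in? c d k r m) *ℚ mids j (k ∷ κ) (r ∷ ρ) (λ s → f (m + s)))
      ≡⟨ mids-suc j c k κ d r ρ f ⟨
    mids (suc j) (c ∷ k ∷ κ) (d ∷ r ∷ ρ) f ∎
    where open ≡-Reasoning

  -- The size s determines the first part of l from the other parts, as s minus their sum, and this
  -- value is admissible exactly when it is at least c ⊔ d.
  additions : ∀ j c κ d ρ s → s < B →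
    Σ (allWords (suc j) B) (λ l → 𝟙 ((hs? l (c ∷ κ) ×-dec hs? l (d ∷ ρ)) ×-dec (s ℕₚ.≟ sum l)))
      ≡ mids j (c ∷ κ) (d ∷ ρ) (λ x → 𝟙 ((c ⊔ d) + x ℕₚ.≤? s))
  additions j c κ d ρ s s<B = begin
    Σ (allWords (suc j) B) (λ l → 𝟙 ((hs? l (c ∷ κ) ×-dec hs? l (d ∷ ρ)) ×-dec (s ℕₚ.≟ sum l)))
      ≡⟨ allWords-Σ j B ⟩
    Σ (upTo B) (λ l → Σ (allWords j B) (λ μ → 𝟙 ((hs? (l ∷ μ) (c ∷ κ) ×-dec hs? (l ∷ μ) (d ∷ ρ)) ×-dec (s ℕₚ.≟ l + sum μ))))
      ≡⟨ Σ-swap (upTo B) (allWords j B) ⟩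
    Σ (allWords j B) (λ μ → Σ (upTo B) (λ l → 𝟙 ((hs? (l ∷ μ) (c ∷ κ) ×-dec hs? (l ∷ μ) (d ∷ ρ)) ×-dec (s ℕₚ.≟ l + sum μ))))
      ≡⟨ Σ-cong (allWords j B) (λ μ → Σ-cong (upTo B) (λ l → trans
           (𝟙-cong ((hs? (l ∷ μ) (c ∷ κ) ×-dec hs? (l ∷ μ) (d ∷ ρ)) ×-dec (s ℕₚ.≟ l + sum μ)) (mm μ ×-dec end? μ l)
             (λ { ((h , h′) , e) → (proj₂ (HS⇒Mid l μ c κ h) , proj₂ (HS⇒Mid l μ d ρ h′)) , e , proj₁ (HS⇒Mid l μ c κ h) , proj₁ (HS⇒Mid l μ d ρ h′) })
             (λ { ((h , h′) , e , c≤l , d≤l) → (Mid⇒HS l μ c κ c≤l h , Mid⇒HS l μ d ρ d≤l h′) , e }))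
           (trans (𝟙-× (mm μ) (end? μ l)) (cong (𝟙 (mm μ) *ℚ_) (sym (ℚₚ.*-identityʳ _)))))) ⟩
    Σ (allWords j B) (λ μ → Σ (upTo B) (λ l → 𝟙 (mm μ) *ℚ (𝟙 (end? μ l) *ℚ 1ℚ)))
      ≡⟨ Σ-cong (allWords j B) (λ μ → trans (Σ-distribˡ (𝟙 (mm μ)) (upTo B)) (cong (𝟙 (mm μ) *ℚ_) (pick μ))) ⟩
    mids j (c ∷ κ) (d ∷ ρ) (λ x → 𝟙 ((c ⊔ d) + x ℕₚ.≤? s)) ∎
    where
      open ≡-Reasoning
      mm = λ μ → mid? (c ∷ κ) μ ×-dec mid? (d ∷ ρ) μ
      end? : ∀ μ l → Dec (s ≡ l + sum μ × c ≤ l × d ≤ l)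
      end? μ l = (s ℕₚ.≟ l + sum μ) ×-dec (c ℕₚ.≤? l ×-dec d ℕₚ.≤? l)
      pick : ∀ μ → Σ (upTo B) (λ l → 𝟙 (end? μ l) *ℚ 1ℚ) ≡ 𝟙 ((c ⊔ d) + sum μ ℕₚ.≤? s)
      pick μ with ℕₚ.≤-<-connex ((c ⊔ d) + sum μ) s
      ... | inj₂ s< = trans (Σ-none (end? μ) {xs = upTo B} {λ _ → 1ℚ} (λ { l _ (refl , c≤l , d≤l) → ℕₚ.<⇒≱ s< (ℕₚ.+-monoˡ-≤ (sum μ) (ℕₚ.⊔-lub c≤l d≤l)) }))
            (sym (𝟙-no ((c ⊔ d) + sum μ ℕₚ.≤? s) (ℕₚ.<⇒≱ s<)))
      ... | inj₁ le = trans (Σ-pick (end? μ) {f = λ _ → 1ℚ} {x = s ℕ.∸ sum μ} (Uniqueₚ.upTo⁺ B) (∈-upTo⁺ (ℕₚ.≤-<-trans (ℕₚ.m∸n≤m s (sum μ)) s<B))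
          (sym (ℕₚ.m∸n+n≡m (ℕₚ.≤-trans (ℕₚ.m≤n+m (sum μ) (c ⊔ d)) le)) , ℕₚ.≤-trans (ℕₚ.m≤m⊔n c d) c⊔d≤ , ℕₚ.≤-trans (ℕₚ.m≤n⊔m c d) c⊔d≤)
          (λ { l _ (refl , _) → sym (ℕₚ.m+n∸n≡m l (sum μ)) }))
          (sym (𝟙-yes ((c ⊔ d) + sum μ ℕₚ.≤? s) le))
        where c⊔d≤ : c ⊔ d ≤ s ℕ.∸ sum μ
              c⊔d≤ = ℕₚ.m+n≤o⇒m≤o∸n (c ⊔ d) le

  -- Both sides are sums over `mids`, exchanged by the reflection. In terms of operators: adding a
  -- strip of size a and then removing one of any size amounts to removing a strip of any size and
  -- then adding one of size at most a. The last guard is the bound on the size of ρ/τ.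
  strip-commutation : ∀ j κ ρ a → length κ ≡ suc j → length ρ ≡ suc j → All (_< B) κ → Last0 ρ → sum κ + a < B →
    Σ (allWords (suc j) B) (λ l → 𝟙 ((hs? l κ ×-dec hs? l ρ) ×-dec (sum κ + a ℕₚ.≟ sum l)))
      ≡ Σ (allWords (suc j) B) (λ τ → 𝟙 (hs? κ τ ×-dec hs? ρ τ) *ℚ 𝟙 (sum ρ ℕₚ.≤? sum τ + a))
  strip-commutation j (c ∷ κ) (d ∷ ρ) a lκ lρ κ<B z s<B = begin
    Σ (allWords (suc j) B) (λ l → 𝟙 ((hs? l (c ∷ κ) ×-dec hs? l (d ∷ ρ)) ×-dec (sum (c ∷ κ) + a ℕₚ.≟ sum l)))
      ≡⟨ additions j c κ d ρ (sum (c ∷ κ) + a) s<B ⟩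
    mids j (c ∷ κ) (d ∷ ρ) (λ x → 𝟙 ((c ⊔ d) + x ℕₚ.≤? sum (c ∷ κ) + a))
      ≡⟨ mids-reflect j c κ d ρ {λ x → 𝟙 ((c ⊔ d) + x ℕₚ.≤? sum (c ∷ κ) + a)} {λ y → 𝟙 (sum (d ∷ ρ) ℕₚ.≤? y + a)}
           (ℕₚ.suc-injective lκ) (ℕₚ.suc-injective lρ) κ<B z reflected ⟩
    mids j (c ∷ κ) (d ∷ ρ) (λ y → 𝟙 (sum (d ∷ ρ) ℕₚ.≤? y + a))
      ≡⟨ removals j (c ∷ κ) (d ∷ ρ) {λ y → 𝟙 (sum (d ∷ ρ) ℕₚ.≤? y + a)} (ℕₚ.≤-<-trans z≤n s<B) lκ lρ z ⟨
    Σ (allWords (suc j) B) (λ τ → 𝟙 (hs? (c ∷ κ) τ ×-dec hs? (d ∷ ρ) τ) *ℚ 𝟙 (sum (d ∷ ρ) ℕₚ.≤? sum τ + a)) ∎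
    where
      open ≡-Reasoning
      reflected : ∀ x y → x + y + (c ⊔ d) ≡ sum (c ∷ κ) + sum (d ∷ ρ) →
                  𝟙 ((c ⊔ d) + x ℕₚ.≤? sum (c ∷ κ) + a) ≡ 𝟙 (sum (d ∷ ρ) ℕₚ.≤? y + a)
      reflected x y e = 𝟙-cong ((c ⊔ d) + x ℕₚ.≤? sum (c ∷ κ) + a) (sum (d ∷ ρ) ℕₚ.≤? y + a)
        (λ le → ℕₚ.+-cancelˡ-≤ (sum (c ∷ κ)) _ _ (ℕₚ.≤-trans (ℕₚ.≤-reflexive (trans (sym e) (lemma₁ x y (c ⊔ d))))
                  (ℕₚ.≤-trans (ℕₚ.+-monoˡ-≤ y le) (ℕₚ.≤-reflexive (lemma₂ (sum (c ∷ κ)) a y)))))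
        (λ le → ℕₚ.+-cancelʳ-≤ y _ _ (ℕₚ.≤-trans (ℕₚ.≤-reflexive (trans (sym (lemma₁ x y (c ⊔ d))) e))
                  (ℕₚ.≤-trans (ℕₚ.+-monoʳ-≤ (sum (c ∷ κ)) le) (ℕₚ.≤-reflexive (sym (lemma₂ (sum (c ∷ κ)) a y))))))
        where
          lemma₁ : ∀ x y m → x + y + m ≡ m + x + y
          lemma₁ = solve-∀
          lemma₂ : ∀ s a y → s + a + y ≡ s + (y + a)
          lemma₂ = solve-∀

-- Pieri rule and Cauchy identity for Kostka numbers

𝟙-rearrange : (d₁ : Dec P₁) (d₂ : Dec P₂) (e₁ : Dec Q₁) (e₂ : Dec Q₂) (e₃ : Dec Q₃) {x : ℚ} →
  (P₁ → P₂ → Q₁ × Q₂ × Q₃) → (Q₁ → Q₂ → Q₃ → P₁ × P₂) →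
  𝟙 d₁ *ℚ (𝟙 d₂ *ℚ x) ≡ 𝟙 e₁ *ℚ (𝟙 e₂ *ℚ (𝟙 e₃ *ℚ x))
𝟙-rearrange d₁ d₂ e₁ e₂ e₃ {x} f g = begin
  𝟙 d₁ *ℚ (𝟙 d₂ *ℚ x)              ≡⟨ 𝟙-split (d₁ ×-dec d₂) d₁ d₂ id _,_ ⟨
  𝟙 (d₁ ×-dec d₂) *ℚ x             ≡⟨ 𝟙-split (d₁ ×-dec d₂) e₁ (e₂ ×-dec e₃) (λ { (p , q) → f p q }) (λ { p (q , r) → g p q r }) ⟩
  𝟙 e₁ *ℚ (𝟙 (e₂ ×-dec e₃) *ℚ x)   ≡⟨ cong (𝟙 e₁ *ℚ_) (𝟙-split (e₂ ×-dec e₃) e₂ e₃ id _,_) ⟩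
  𝟙 e₁ *ℚ (𝟙 e₂ *ℚ (𝟙 e₃ *ℚ x))    ∎
  where open ≡-Reasoning

*ℚ-rotate : ∀ x y z → x *ℚ (y *ℚ z) ≡ z *ℚ (x *ℚ y)
*ℚ-rotate x y z = trans (sym (ℚₚ.*-assoc x y z)) (ℚₚ.*-comm (x *ℚ y) z)

*ℚ-swapˡ : ∀ x y z → x *ℚ (y *ℚ z) ≡ y *ℚ (x *ℚ z)
*ℚ-swapˡ x y z = trans (sym (ℚₚ.*-assoc x y z)) (trans (cong (_*ℚ z) (ℚₚ.*-comm x y)) (ℚₚ.*-assoc y x z))

𝟙*-zero : (d : Dec P) {x : ℚ} → (P → x ≡ 0ℚ) → 𝟙 d *ℚ x ≡ 0ℚ
𝟙*-zero d {x} h = trans (𝟙*-cong d h) (ℚₚ.*-zeroʳ (𝟙 d))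

Sub : List ℕ → List ℕ → Set
Sub []       []       = ⊤
Sub []       (_ ∷ _)  = ⊥
Sub (_ ∷ _)  []       = ⊥
Sub (x ∷ xs) (y ∷ ys) = x ≤ y × Sub xs ys

sub? : ∀ xs ys → Dec (Sub xs ys)
sub? []       []       = yes tt
sub? []       (_ ∷ _)  = no λ ()
sub? (_ ∷ _)  []       = no λ ()
sub? (x ∷ xs) (y ∷ ys) = x ℕₚ.≤? y ×-dec sub? xs ys

Sub-sum : ∀ xs ys → Sub xs ys → sum xs ≤ sum ys
Sub-sum []       []       _       = z≤n
Sub-sum (x ∷ xs) (y ∷ ys) (h , t) = ℕₚ.+-mono-≤ h (Sub-sum xs ys t)

sum≡0-unique : ∀ xs ys → length xs ≡ length ys → sum xs ≡ 0 → sum ys ≡ 0 → xs ≡ ys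
sum≡0-unique []       []       _ _ _ = refl
sum≡0-unique (x ∷ xs) (y ∷ ys) l e f =
  cong₂ _∷_ (trans (ℕₚ.m+n≡0⇒m≡0 x e) (sym (ℕₚ.m+n≡0⇒m≡0 y f)))
            (sum≡0-unique xs ys (ℕₚ.suc-injective l) (ℕₚ.m+n≡0⇒n≡0 x e) (ℕₚ.m+n≡0⇒n≡0 y f))

sum≡0⇒Last0 : ∀ xs → sum xs ≡ 0 → Last0 xs
sum≡0⇒Last0 []           e = tt
sum≡0⇒Last0 (x ∷ [])     e = ℕₚ.m+n≡0⇒m≡0 x e
sum≡0⇒Last0 (x ∷ y ∷ xs) e = sum≡0⇒Last0 (y ∷ xs) (ℕₚ.m+n≡0⇒n≡0 x e)

last0? : ∀ xs → Dec (Last0 xs)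
last0? []           = yes tt
last0? (x ∷ [])     = x ℕₚ.≟ 0
last0? (x ∷ y ∷ xs) = last0? (y ∷ xs)

sum≡0⇒All< : ∀ {B} xs → 0 < B → sum xs ≡ 0 → All (_< B) xs
sum≡0⇒All< []       0<B e = []
sum≡0⇒All< (x ∷ xs) 0<B e = subst (_< _) (sym (ℕₚ.m+n≡0⇒m≡0 x e)) 0<B ∷ sum≡0⇒All< xs 0<B (ℕₚ.m+n≡0⇒n≡0 x e)

-- The number of nonnegative integer matrices with row sums α and column sums β.
matrices : ℕ → List ℕ → List ℕ → ℚ
matrices B α []      = 𝟙 (sum α ℕₚ.≟ 0)
matrices B α (b ∷ β) = Σ (allWords (length α) B) (λ α′ → 𝟙 (sub? α′ α ×-dec (sum α′ + b ℕₚ.≟ sum α)) *ℚ matrices B α′ β)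

module Strips (j B : ℕ) where

  Λ : List (List ℕ)
  Λ = allWords (suc j) B

  -- The number of chains of horizontal strips from the empty partition to l whose sizes, from the last
  -- one to the first one, are the entries of α: a Kostka number.
  K : List ℕ → List ℕ → ℚ
  K l []      = 𝟙 (sum l ℕₚ.≟ 0)
  K l (a ∷ α) = Σ Λ (λ κ → 𝟙 (hs? l κ ×-dec (sum κ + a ℕₚ.≟ sum l)) *ℚ K κ α)

  K-graded : ∀ l α → sum l ≢ sum α → K l α ≡ 0ℚ
  K-graded l []      ≢0 = 𝟙-no (sum l ℕₚ.≟ 0) ≢0
  K-graded l (a ∷ α) ≢  = Σ-zero Λ (λ κ _ → 𝟙*-zero (hs? l κ ×-dec (sum κ + a ℕₚ.≟ sum l))
    (λ { (_ , e) → K-graded κ α (λ e′ → ≢ (trans (sym e) (trans (ℕₚ.+-comm (sum κ) a) (cong (a +_) e′)))) }))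

  -- K vanishes unless the sizes agree, so their equality may be assumed when a factor next to it is
  -- rewritten.
  K-sum : ∀ l α {x y} → (sum l ≡ sum α → x ≡ y) → x *ℚ K l α ≡ y *ℚ K l α
  K-sum l α {x} {y} h with sum l ℕₚ.≟ sum α
  ... | yes e = cong (_*ℚ K l α) (h e)
  ... | no ≢  = trans (cong (x *ℚ_) (K-graded l α ≢)) (trans (ℚₚ.*-zeroʳ x) (sym (trans (cong (y *ℚ_) (K-graded l α ≢)) (ℚₚ.*-zeroʳ y))))

  -- With K l α read as the coefficient of s_l in h_α, this says that the adjoint of multiplication
  -- by Σ_b h_b sends h_α to the sum of the h_{α′} with α′ ≤ α entrywise. The induction moves the
  -- removal of a strip past one added strip of α at a time, by `strip-commutation`.
  pieri : ∀ α ρ → length ρ ≡ suc j → Last0 ρ → All (_< B) ρ → sum α < B →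
    Σ Λ (λ l → 𝟙 (hs? l ρ) *ℚ K l α) ≡ Σ (allWords (length α) B) (λ α′ → 𝟙 (sub? α′ α) *ℚ K ρ α′)
  pieri [] ρ lρ z ρ<B 0<B with sum ρ ℕₚ.≟ 0
  ... | no ≢0 = trans (Σ-zero Λ (λ l _ → 𝟙*-zero (hs? l ρ) (λ h → 𝟙-no (sum l ℕₚ.≟ 0)
                         (λ e → ≢0 (ℕₚ.n≤0⇒n≡0 (ℕₚ.≤-trans (HS-sum l ρ h) (ℕₚ.≤-reflexive e)))))))
                      (sym (trans (ℚₚ.+-identityʳ _) (trans (ℚₚ.*-identityˡ _) (𝟙-no (sum ρ ℕₚ.≟ 0) ≢0))))
  ... | yes e = trans (Σ-unique (Unique-allWords (suc j) B) (∈-allWords⁺ ρ lρ (sum≡0⇒All< ρ 0<B e))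
                        (λ l l∈ l≢ → trans (cong (𝟙 (hs? l ρ) *ℚ_) (𝟙-no (sum l ℕₚ.≟ 0)
                            (λ e′ → l≢ (sum≡0-unique l ρ (trans (proj₁ (∈-allWords⁻ (suc j) B l∈)) (sym lρ)) e′ e)))) (ℚₚ.*-zeroʳ (𝟙 (hs? l ρ)))))
                (trans (𝟙*-yes (hs? ρ ρ) (HS-refl-0 ρ (ℕₚ.≤-trans (s≤s z≤n) (ℕₚ.≤-reflexive (sym lρ))) e))
                       (sym (trans (ℚₚ.+-identityʳ _) (ℚₚ.*-identityˡ _))))
  pieri (a ∷ α) ρ lρ z ρ<B α<B = begin
    Σ Λ (λ l → 𝟙 (hs? l ρ) *ℚ Σ Λ (λ κ → 𝟙 (hs? l κ ×-dec (sum κ + a ℕₚ.≟ sum l)) *ℚ K κ α))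
      ≡⟨ Σ-cong Λ (λ l → trans (sym (Σ-distribˡ (𝟙 (hs? l ρ)) Λ)) (Σ-cong Λ (λ κ →
           sym (𝟙-split (up κ l) (hs? l ρ) (hs? l κ ×-dec (sum κ + a ℕₚ.≟ sum l))
                 (λ { ((h , h′) , e) → h′ , h , e }) (λ { h′ (h , e) → (h , h′) , e }))))) ⟩
    Σ Λ (λ l → Σ Λ (λ κ → 𝟙 (up κ l) *ℚ K κ α))
      ≡⟨ Σ-swap Λ Λ ⟩
    Σ Λ (λ κ → Σ Λ (λ l → 𝟙 (up κ l) *ℚ K κ α))
      -- `K-sum` lets the size of κ be the sum of α, which gives the bound below B that
      -- `strip-commutation` requires.
      ≡⟨ Σ-cong-∈ Λ (λ κ κ∈ → trans (Σ-distribʳ (K κ α) Λ) (K-sum κ α (λ e →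
           strip-commutation B j κ ρ a (proj₁ (∈-allWords⁻ (suc j) B κ∈)) lρ (proj₂ (∈-allWords⁻ (suc j) B κ∈)) z
             (ℕₚ.≤-<-trans (ℕₚ.≤-reflexive (trans (ℕₚ.+-comm (sum κ) a) (cong (a +_) e))) α<B)))) ⟩
    Σ Λ (λ κ → Σ Λ (λ τ → 𝟙 (hs? κ τ ×-dec hs? ρ τ) *ℚ 𝟙 (fits τ)) *ℚ K κ α)
      ≡⟨ Σ-cong Λ (λ κ → trans (sym (Σ-distribʳ (K κ α) Λ)) (Σ-cong Λ (λ τ → trans (ℚₚ.*-assoc (𝟙 (hs? κ τ ×-dec hs? ρ τ)) (𝟙 (fits τ)) (K κ α))
           (𝟙-rearrange (hs? κ τ ×-dec hs? ρ τ) (fits τ) (hs? ρ τ) (fits τ) (hs? κ τ) (λ { (h , h′) e → h′ , e , h }) (λ h′ e h → (h , h′) , e))))) ⟩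
    Σ Λ (λ κ → Σ Λ (λ τ → 𝟙 (hs? ρ τ) *ℚ (𝟙 (fits τ) *ℚ (𝟙 (hs? κ τ) *ℚ K κ α))))
      ≡⟨ Σ-swap Λ Λ ⟩
    Σ Λ (λ τ → Σ Λ (λ κ → 𝟙 (hs? ρ τ) *ℚ (𝟙 (fits τ) *ℚ (𝟙 (hs? κ τ) *ℚ K κ α))))
      ≡⟨ Σ-cong Λ (λ τ → trans (Σ-distribˡ (𝟙 (hs? ρ τ)) Λ) (cong (𝟙 (hs? ρ τ) *ℚ_) (Σ-distribˡ (𝟙 (fits τ)) Λ))) ⟩
    Σ Λ (λ τ → 𝟙 (hs? ρ τ) *ℚ (𝟙 (fits τ) *ℚ Σ Λ (λ κ → 𝟙 (hs? κ τ) *ℚ K κ α)))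
      ≡⟨ Σ-cong-∈ Λ (λ τ τ∈ → 𝟙*-cong (hs? ρ τ) (λ h → cong (𝟙 (fits τ) *ℚ_)
           (pieri α τ (proj₁ (∈-allWords⁻ (suc j) B τ∈)) (HS-Last0 ρ τ h z) (proj₂ (∈-allWords⁻ (suc j) B τ∈))
             (ℕₚ.≤-<-trans (ℕₚ.m≤n+m (sum α) a) α<B)))) ⟩
    Σ Λ (λ τ → 𝟙 (hs? ρ τ) *ℚ (𝟙 (fits τ) *ℚ X τ))
      ≡⟨ Σ-cong Λ (λ τ → 𝟙*-cong (hs? ρ τ) (λ h → trans (cong (_*ℚ X τ) (sym (choose τ (HS-sum ρ τ h)))) (sym (Σ-distribʳ (X τ) (upTo B))))) ⟩
    Σ Λ (λ τ → 𝟙 (hs? ρ τ) *ℚ Σ (upTo B) (λ i → (𝟙 (size τ i) *ℚ 1ℚ) *ℚ X τ))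
      ≡⟨ Σ-cong Λ (λ τ → trans (sym (Σ-distribˡ (𝟙 (hs? ρ τ)) (upTo B))) (Σ-cong (upTo B) (λ i →
           trans (cong (λ w → 𝟙 (hs? ρ τ) *ℚ (w *ℚ X τ)) (ℚₚ.*-identityʳ (𝟙 (size τ i))))
           (trans (cong (𝟙 (hs? ρ τ) *ℚ_) (sym (Σ-distribˡ (𝟙 (size τ i)) W))) (sym (Σ-distribˡ (𝟙 (hs? ρ τ)) W)))))) ⟩
    Σ Λ (λ τ → Σ (upTo B) (λ i → Σ W (λ α′ → 𝟙 (hs? ρ τ) *ℚ (𝟙 (size τ i) *ℚ (𝟙 (sub? α′ α) *ℚ K τ α′)))))
      ≡⟨ Σ-swap Λ (upTo B) ⟩
    Σ (upTo B) (λ i → Σ Λ (λ τ → Σ W (λ α′ → 𝟙 (hs? ρ τ) *ℚ (𝟙 (size τ i) *ℚ (𝟙 (sub? α′ α) *ℚ K τ α′)))))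
      ≡⟨ Σ-cong (upTo B) (λ i → Σ-swap Λ W) ⟩
    Σ (upTo B) (λ i → Σ W (λ α′ → Σ Λ (λ τ → 𝟙 (hs? ρ τ) *ℚ (𝟙 (size τ i) *ℚ (𝟙 (sub? α′ α) *ℚ K τ α′)))))
      ≡⟨ Σ-cong (upTo B) (λ i → Σ-cong W (λ α′ → trans (Σ-cong Λ (λ τ →
           sym (𝟙-rearrange (i ℕₚ.≤? a ×-dec sub? α′ α) (hs? ρ τ ×-dec (sum τ + i ℕₚ.≟ sum ρ)) (hs? ρ τ) (size τ i) (sub? α′ α)
             (λ { (le , s) (h , e) → h , (le , e) , s }) (λ { h (le , e) s → (le , s) , (h , e) }))))
           (Σ-distribˡ (𝟙 (i ℕₚ.≤? a ×-dec sub? α′ α)) Λ))) ⟩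
    Σ (upTo B) (λ i → Σ W (λ α′ → 𝟙 (sub? (i ∷ α′) (a ∷ α)) *ℚ K ρ (i ∷ α′)))
      ≡⟨ allWords-Σ (length α) B ⟨
    Σ (allWords (suc (length α)) B) (λ α′ → 𝟙 (sub? α′ (a ∷ α)) *ℚ K ρ α′) ∎
    where
      open ≡-Reasoning
      W = allWords (length α) B
      fits = λ τ → sum ρ ℕₚ.≤? sum τ + a
      up = λ κ l → (hs? l κ ×-dec hs? l ρ) ×-dec (sum κ + a ℕₚ.≟ sum l)
      size = λ τ i → i ℕₚ.≤? a ×-dec (sum τ + i ℕₚ.≟ sum ρ)
      X : List ℕ → ℚ
      X τ = Σ W (λ α′ → 𝟙 (sub? α′ α) *ℚ K τ α′)
      -- The inequality |ρ| ≤ |τ| + a is resolved by the size i of ρ/τ, with i ≤ a; this i becomes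
      -- the first entry of the smaller content.
      choose : ∀ τ → sum τ ≤ sum ρ → Σ (upTo B) (λ i → 𝟙 (size τ i) *ℚ 1ℚ) ≡ 𝟙 (fits τ)
      choose τ τ≤ρ with ℕₚ.≤-<-connex (sum ρ) (sum τ + a)
      ... | inj₁ le = trans (Σ-pick (size τ) {f = λ _ → 1ℚ} (Uniqueₚ.upTo⁺ B)
                              (∈-upTo⁺ (ℕₚ.≤-<-trans (ℕₚ.≤-trans i≤a (ℕₚ.m≤m+n a (sum α))) α<B)) (i≤a , ℕₚ.m+[n∸m]≡n τ≤ρ)
                              (λ { i _ (_ , e) → trans (sym (ℕₚ.m+n∸m≡n (sum τ) i)) (cong (ℕ._∸ sum τ) e) }))
                            (sym (𝟙-yes (fits τ) le))
        where i≤a : sum ρ ℕ.∸ sum τ ≤ a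
              i≤a = ℕₚ.m≤n+o⇒m∸n≤o (sum ρ) (sum τ) le
      ... | inj₂ gt = trans (Σ-none (size τ) {xs = upTo B} {f = λ _ → 1ℚ}
                              (λ { i _ (i≤a , e) → ℕₚ.<⇒≱ gt (ℕₚ.≤-trans (ℕₚ.≤-reflexive (sym e)) (ℕₚ.+-monoʳ-≤ (sum τ) i≤a)) }))
                            (sym (𝟙-no (fits τ) (ℕₚ.<⇒≱ gt)))

  K-zero : ∀ l α → length l ≡ suc j → sum l ≡ 0 → sum α ≡ 0 → 0 < B → K l α ≡ 1ℚ
  K-zero l []      ll e f 0<B = 𝟙-yes (sum l ℕₚ.≟ 0) e
  K-zero l (a ∷ α) ll e f 0<B =
    trans (Σ-pick (λ κ → hs? l κ ×-dec (sum κ + a ℕₚ.≟ sum l)) (Unique-allWords (suc j) B)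
            (∈-allWords⁺ l ll (sum≡0⇒All< l 0<B e))
            (HS-refl-0 l (ℕₚ.≤-trans (s≤s z≤n) (ℕₚ.≤-reflexive (sym ll))) e , trans (cong (sum l +_) (ℕₚ.m+n≡0⇒m≡0 a f)) (ℕₚ.+-identityʳ _))
            (λ { κ κ∈ (_ , e′) → sum≡0-unique κ l (trans (proj₁ (∈-allWords⁻ (suc j) B κ∈)) (sym ll)) (ℕₚ.m+n≡0⇒m≡0 (sum κ) (trans e′ e)) e }))
          (K-zero l α ll e (ℕₚ.m+n≡0⇒n≡0 a f) 0<B)

  -- A shape of size at most j cannot have all of its j + 1 rows nonempty. This supplies the empty
  -- last row required by `pieri`.
  K-Last0 : ∀ l α → length l ≡ suc j → sum α ≤ j → ¬ Last0 l → K l α ≡ 0ℚ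
  K-Last0 l []      ll _ ¬z = 𝟙-no (sum l ℕₚ.≟ 0) (¬z ∘ sum≡0⇒Last0 l)
  K-Last0 l (a ∷ α) ll α≤j ¬z with sum l ℕₚ.≟ a + sum α
  ... | no ≢  = K-graded l (a ∷ α) ≢
  ... | yes e = Σ-none (λ κ → hs? l κ ×-dec (sum κ + a ℕₚ.≟ sum l)) {xs = Λ} {λ κ → K κ α} (λ { κ _ (h , _) →
                  ℕₚ.<⇒≱ (s≤s α≤j) (ℕₚ.≤-trans (ℕₚ.≤-reflexive (sym ll)) (ℕₚ.≤-trans (HS-positive l κ h ¬z) (ℕₚ.≤-reflexive e))) })

  -- Removing the strip of size b counted by K l β leaves a sum over the shapes l above ρ. By
  -- `pieri` it becomes a sum over α′ ≤ α, and α - α′ is the column of sum b of the matrix.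
  cauchy-K : ∀ β α → sum β ≤ j → sum α < B → Σ Λ (λ l → K l α *ℚ K l β) ≡ matrices B α β
  cauchy-K [] α _ α<B with sum α ℕₚ.≟ 0
  ... | no ≢0 = trans (Σ-zero Λ (λ l _ → trans (ℚₚ.*-comm (K l α) (K l [])) (𝟙*-zero (sum l ℕₚ.≟ 0) (λ e → K-graded l α (λ e′ → ≢0 (trans (sym e′) e))))))
                      (sym (𝟙-no (sum α ℕₚ.≟ 0) ≢0))
  ... | yes e = trans (Σ-unique (Unique-allWords (suc j) B) (∈-allWords⁺ zs lz (sum≡0⇒All< zs 0<B sz))
                        (λ l l∈ l≢ → trans (cong (K l α *ℚ_) (𝟙-no (sum l ℕₚ.≟ 0)
                            (λ e′ → l≢ (sum≡0-unique l zs (trans (proj₁ (∈-allWords⁻ (suc j) B l∈)) (sym lz)) e′ sz)))) (ℚₚ.*-zeroʳ (K l α))))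
                (trans (cong₂ _*ℚ_ (K-zero zs α lz sz e 0<B) (𝟙-yes (sum zs ℕₚ.≟ 0) sz)) (sym (𝟙-yes (sum α ℕₚ.≟ 0) e)))
    where
      0<B = ℕₚ.≤-<-trans z≤n α<B
      zs = replicate (suc j) 0
      lz : length zs ≡ suc j
      lz = length-replicate (suc j)
      sum-zeros : ∀ n → sum (replicate n 0) ≡ 0
      sum-zeros zero    = refl
      sum-zeros (suc n) = sum-zeros n
      sz : sum zs ≡ 0
      sz = sum-zeros (suc j)
  cauchy-K (b ∷ β) α β≤j α<B = begin
    Σ Λ (λ l → K l α *ℚ Σ Λ (λ ρ → 𝟙 (step l ρ) *ℚ K ρ β))
      ≡⟨ Σ-cong Λ (λ l → trans (sym (Σ-distribˡ (K l α) Λ)) (Σ-cong Λ (λ ρ → regroup (K l α) (𝟙 (step l ρ)) (K ρ β)))) ⟩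
    Σ Λ (λ l → Σ Λ (λ ρ → (𝟙 (step l ρ) *ℚ K l α) *ℚ K ρ β))
      ≡⟨ Σ-swap Λ Λ ⟩
    Σ Λ (λ ρ → Σ Λ (λ l → (𝟙 (step l ρ) *ℚ K l α) *ℚ K ρ β))
      ≡⟨ Σ-cong-∈ Λ (λ ρ ρ∈ → trans (Σ-distribʳ (K ρ β) Λ) (inner ρ (∈-allWords⁻ (suc j) B ρ∈) (last0? ρ))) ⟩
    Σ Λ (λ ρ → Σ W (λ α′ → 𝟙 (sm α′) *ℚ K ρ α′) *ℚ K ρ β)
      ≡⟨ Σ-cong Λ (λ ρ → trans (sym (Σ-distribʳ (K ρ β) W)) (Σ-cong W (λ α′ → ℚₚ.*-assoc (𝟙 (sm α′)) (K ρ α′) (K ρ β)))) ⟩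
    Σ Λ (λ ρ → Σ W (λ α′ → 𝟙 (sm α′) *ℚ (K ρ α′ *ℚ K ρ β)))
      ≡⟨ Σ-swap Λ W ⟩
    Σ W (λ α′ → Σ Λ (λ ρ → 𝟙 (sm α′) *ℚ (K ρ α′ *ℚ K ρ β)))
      ≡⟨ Σ-cong W (λ α′ → trans (Σ-distribˡ (𝟙 (sm α′)) Λ) (𝟙*-cong (sm α′) (λ { (s , _) →
           cauchy-K β α′ (ℕₚ.≤-trans (ℕₚ.m≤n+m (sum β) b) β≤j) (ℕₚ.≤-<-trans (Sub-sum α′ α s) α<B) }))) ⟩
    matrices B α (b ∷ β) ∎
    where
      open ≡-Reasoning
      W = allWords (length α) B
      step = λ l ρ → hs? l ρ ×-dec (sum ρ + b ℕₚ.≟ sum l)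
      sm = λ α′ → sub? α′ α ×-dec (sum α′ + b ℕₚ.≟ sum α)
      regroup : ∀ x y z → x *ℚ (y *ℚ z) ≡ (y *ℚ x) *ℚ z
      regroup x y z = trans (sym (ℚₚ.*-assoc x y z)) (cong (_*ℚ z) (ℚₚ.*-comm x y))
      inner : ∀ ρ → length ρ ≡ suc j × All (_< B) ρ → Dec (Last0 ρ) →
              Σ Λ (λ l → 𝟙 (step l ρ) *ℚ K l α) *ℚ K ρ β ≡ Σ W (λ α′ → 𝟙 (sm α′) *ℚ K ρ α′) *ℚ K ρ β
      inner ρ (lρ , ρ<B) (no ¬z) = trans (cong (Σ Λ (λ l → 𝟙 (step l ρ) *ℚ K l α) *ℚ_) Kρβ≡0) (trans (ℚₚ.*-zeroʳ (Σ Λ (λ l → 𝟙 (step l ρ) *ℚ K l α)))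
        (sym (trans (cong (Σ W (λ α′ → 𝟙 (sm α′) *ℚ K ρ α′) *ℚ_) Kρβ≡0) (ℚₚ.*-zeroʳ (Σ W (λ α′ → 𝟙 (sm α′) *ℚ K ρ α′))))))
        where Kρβ≡0 = K-Last0 ρ β lρ (ℕₚ.≤-trans (ℕₚ.m≤n+m (sum β) b) β≤j) ¬z
      -- `pieri` admits strips of every size. The factors K l α and K ρ α′ fix the sizes of l and ρ,
      -- which turns the condition on the size of l into the one on the sum of α′.
      inner ρ (lρ , ρ<B) (yes z) = cong (_*ℚ K ρ β) (begin
        Σ Λ (λ l → 𝟙 (step l ρ) *ℚ K l α)
          ≡⟨ Σ-cong Λ (λ l → trans (K-sum l α (λ e → 𝟙-cong (step l ρ) (eq? ×-dec hs? l ρ) (λ { (h , e′) → trans e′ e , h }) (λ { (e′ , h) → h , trans e′ (sym e) })))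
               (𝟙-split (eq? ×-dec hs? l ρ) eq? (hs? l ρ) id _,_)) ⟩
        Σ Λ (λ l → 𝟙 eq? *ℚ (𝟙 (hs? l ρ) *ℚ K l α))
          ≡⟨ trans (Σ-distribˡ (𝟙 eq?) Λ) (cong (𝟙 eq? *ℚ_) (pieri α ρ lρ z ρ<B α<B)) ⟩
        𝟙 eq? *ℚ Σ W (λ α′ → 𝟙 (sub? α′ α) *ℚ K ρ α′)
          ≡⟨ Σ-distribˡ (𝟙 eq?) W ⟨
        Σ W (λ α′ → 𝟙 eq? *ℚ (𝟙 (sub? α′ α) *ℚ K ρ α′))
          ≡⟨ Σ-cong W (λ α′ → trans (sym (𝟙-split (eq? ×-dec sub? α′ α) eq? (sub? α′ α) id _,_))
               (K-sum ρ α′ (λ e → 𝟙-cong (eq? ×-dec sub? α′ α) (sm α′) (λ { (e′ , s) → s , trans (cong (_+ b) (sym e)) e′ })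
                 (λ { (s , e′) → trans (cong (_+ b) e) e′ , s })))) ⟩
        Σ W (λ α′ → 𝟙 (sm α′) *ℚ K ρ α′) ∎)
        where eq? = sum ρ + b ℕₚ.≟ sum α

-- Semistandard fillings, row by row

Σ-upTo-first : ∀ n {f : ℕ → ℚ} → Σ (upTo (suc n)) f ≡ f 0 +ℚ Σ (upTo n) (f ∘ suc)
Σ-upTo-first n {f} = cong (f 0 +ℚ_) (trans (cong (λ xs → Σ xs f) (sym (map-upTo suc n))) (Σ-map suc (upTo n)))

Σ-upTo-last : ∀ n {f : ℕ → ℚ} → Σ (upTo (suc n)) f ≡ Σ (upTo n) f +ℚ f n
Σ-upTo-last n {f} = trans (cong (λ xs → Σ xs f) (sym (upTo-∷ʳ n)))
  (trans (Σ-++ (upTo n) (n ∷ [])) (cong (Σ (upTo n) f +ℚ_) (ℚₚ.+-identityʳ (f n))))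

allWords-++-Σ : ∀ m n k {F : Word → ℚ} →
  Σ (allWords (m + n) k) F ≡ Σ (allWords m k) (λ u → Σ (allWords n k) (λ v → F (u ++ v)))
allWords-++-Σ zero    n k = sym (ℚₚ.+-identityʳ _)
allWords-++-Σ (suc m) n k {F} = begin
  Σ (allWords (suc (m + n)) k) F
    ≡⟨ allWords-Σ (m + n) k ⟩
  Σ (upTo k) (λ a → Σ (allWords (m + n) k) (λ v → F (a ∷ v)))
    ≡⟨ Σ-cong (upTo k) (λ a → allWords-++-Σ m n k) ⟩
  Σ (upTo k) (λ a → Σ (allWords m k) (λ u → Σ (allWords n k) (λ v → F (a ∷ u ++ v))))
    ≡⟨ allWords-Σ m k ⟨
  Σ (allWords (suc m) k) (λ u → Σ (allWords n k) (λ v → F (u ++ v))) ∎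
  where open ≡-Reasoning

module _ (_≟_ : DecidableEquality A) where

  occ-yes : ∀ {a x} xs → a ≡ x → occ _≟_ a (x ∷ xs) ≡ suc (occ _≟_ a xs)
  occ-yes {a} xs e = cong length (filter-accept (a ≟_) e)

  occ-no : ∀ {a x} xs → a ≢ x → occ _≟_ a (x ∷ xs) ≡ occ _≟_ a xs
  occ-no {a} xs e = cong length (filter-reject (a ≟_) e)

  occ-++ : ∀ a xs ys → occ _≟_ a (xs ++ ys) ≡ occ _≟_ a xs + occ _≟_ a ys
  occ-++ a xs ys = trans (cong length (filter-++ (a ≟_) xs ys)) (length-++ (filter (a ≟_) xs))

  occ-↭ : ∀ a {xs ys} → xs ↭ ys → occ _≟_ a xs ≡ occ _≟_ a ys
  occ-↭ a p = ↭ₚ.↭-length (↭ₚ.filter-↭ (a ≟_) p)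

  occ-replicate : ∀ a n → occ _≟_ a (replicate n a) ≡ n
  occ-replicate a zero    = refl
  occ-replicate a (suc n) = trans (occ-yes (replicate n a) refl) (cong suc (occ-replicate a n))

  occ-replicate-≢ : ∀ {a b} n → a ≢ b → occ _≟_ a (replicate n b) ≡ 0
  occ-replicate-≢ zero    ≢ = refl
  occ-replicate-≢ {b = b} (suc n) ≢ = trans (occ-no (replicate n b) ≢) (occ-replicate-≢ n ≢)

  occ-none : ∀ {a xs} → All (a ≢_) xs → occ _≟_ a xs ≡ 0
  occ-none []               = refl
  occ-none {xs = x ∷ xs} (≢ ∷ ≢s) = trans (occ-no xs ≢) (occ-none ≢s)

-- Multiplicities are listed from the largest letter down, because the recursion on tableaux deletes
-- the largest letter first. Exponent lists run the other way, whence the reversals below.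
contents : ℕ → Word → List ℕ
contents zero    w = []
contents (suc k) w = occ ℕₚ._≟_ k w ∷ contents k w

length-contents : ∀ k w → length (contents k w) ≡ k
length-contents zero    w = refl
length-contents (suc k) w = cong suc (length-contents k w)

contents-cong : ∀ k {v w} → (∀ i → i < k → occ ℕₚ._≟_ i v ≡ occ ℕₚ._≟_ i w) → contents k v ≡ contents k w
contents-cong zero    h = refl
contents-cong (suc k) h = cong₂ _∷_ (h k ℕₚ.≤-refl) (contents-cong k (λ i i<k → h i (ℕₚ.m≤n⇒m≤1+n i<k)))

contents-↭ : ∀ k {v w} → v ↭ w → contents k v ≡ contents k w
contents-↭ k p = contents-cong k (λ i _ → occ-↭ ℕₚ._≟_ i p)

inc? : (w : Word) → Dec (T (weakInc w))
inc? w = T? (weakInc w)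

col? : (v w : Word) → Dec (T (colStrict v w))
col? v w = T? (colStrict v w)

𝟙-∧ : ∀ a b → 𝟙 (T? (a ∧ b)) ≡ 𝟙 (T? a) *ℚ 𝟙 (T? b)
𝟙-∧ true  b = sym (ℚₚ.*-identityˡ (𝟙 (T? b)))
𝟙-∧ false b = sym (ℚₚ.*-zeroˡ (𝟙 (T? b)))

𝟙-weakInc-∷ : ∀ b a u → 𝟙 (inc? (b ∷ a ∷ u)) ≡ 𝟙 (b ℕₚ.≤? a) *ℚ 𝟙 (inc? (a ∷ u))
𝟙-weakInc-∷ b a u = trans (𝟙-∧ (b ≤ᵇ a) (weakInc (a ∷ u)))
  (cong (_*ℚ 𝟙 (inc? (a ∷ u))) (𝟙-cong (T? (b ≤ᵇ a)) (b ℕₚ.≤? a) (ℕₚ.≤ᵇ⇒≤ b a) ℕₚ.≤⇒≤ᵇ))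

Σ-weakInc-∷ : ∀ b r k {g : Word → ℚ} → Σ (allWords (suc r) k) (λ u → 𝟙 (inc? (b ∷ u)) *ℚ g u) ≡
  Σ (upTo k) (λ a → 𝟙 (b ℕₚ.≤? a) *ℚ Σ (allWords r k) (λ u → 𝟙 (inc? (a ∷ u)) *ℚ g (a ∷ u)))
Σ-weakInc-∷ b r k {g} = trans (allWords-Σ r k) (Σ-cong (upTo k) (λ a →
  trans (Σ-cong (allWords r k) (λ u → trans (cong (_*ℚ g (a ∷ u)) (𝟙-weakInc-∷ b a u)) (ℚₚ.*-assoc (𝟙 (b ℕₚ.≤? a)) (𝟙 (inc? (a ∷ u))) (g (a ∷ u)))))
        (Σ-distribˡ (𝟙 (b ℕₚ.≤? a)) (allWords r k))))

Σ-constant-row : ∀ r k {g : Word → ℚ} → Σ (allWords r (suc k)) (λ u → 𝟙 (inc? (k ∷ u)) *ℚ g u) ≡ g (replicate r k)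
Σ-constant-row zero    k = trans (ℚₚ.+-identityʳ _) (ℚₚ.*-identityˡ _)
Σ-constant-row (suc r) k {g} = begin
  Σ (allWords (suc r) (suc k)) (λ u → 𝟙 (inc? (k ∷ u)) *ℚ g u)
    ≡⟨ Σ-weakInc-∷ k r (suc k) ⟩
  Σ (upTo (suc k)) (λ a → 𝟙 (k ℕₚ.≤? a) *ℚ Σ (allWords r (suc k)) (λ u → 𝟙 (inc? (a ∷ u)) *ℚ g (a ∷ u)))
    ≡⟨ Σ-pick (k ℕₚ.≤?_) {f = λ a → Σ (allWords r (suc k)) (λ u → 𝟙 (inc? (a ∷ u)) *ℚ g (a ∷ u))}
         (Uniqueₚ.upTo⁺ (suc k)) (∈-upTo⁺ ℕₚ.≤-refl) ℕₚ.≤-refl (λ a a∈ k≤a → ℕₚ.≤-antisym (ℕₚ.≤-pred (∈-upTo⁻ a∈)) k≤a) ⟩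
  Σ (allWords r (suc k)) (λ u → 𝟙 (inc? (k ∷ u)) *ℚ g (k ∷ u))
    ≡⟨ Σ-constant-row r k ⟩
  g (replicate (suc r) k) ∎
  where open ≡-Reasoning

-- A weakly increasing row in the letters ≤ k consists of one in the letters < k followed by copies of k.
Σ-row-from : ∀ b r k {g : Word → ℚ} → b ≤ k → Σ (allWords r (suc k)) (λ u → 𝟙 (inc? (b ∷ u)) *ℚ g u) ≡
  Σ (upTo (suc r)) (λ t → Σ (allWords t k) (λ v → 𝟙 (inc? (b ∷ v)) *ℚ g (v ++ replicate (r ℕ.∸ t) k)))
Σ-row-from b zero    k b≤k = sym (ℚₚ.+-identityʳ _)
Σ-row-from b (suc r) k {g} b≤k = begin
  Σ (allWords (suc r) (suc k)) (λ u → 𝟙 (inc? (b ∷ u)) *ℚ g u)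
    ≡⟨ Σ-weakInc-∷ b r (suc k) ⟩
  Σ (upTo (suc k)) (λ a → 𝟙 (b ℕₚ.≤? a) *ℚ row a)
    ≡⟨ Σ-upTo-last k ⟩
  Σ (upTo k) (λ a → 𝟙 (b ℕₚ.≤? a) *ℚ row a) +ℚ 𝟙 (b ℕₚ.≤? k) *ℚ row k
    ≡⟨ ℚₚ.+-comm (Σ (upTo k) (λ a → 𝟙 (b ℕₚ.≤? a) *ℚ row a)) (𝟙 (b ℕₚ.≤? k) *ℚ row k) ⟩
  𝟙 (b ℕₚ.≤? k) *ℚ row k +ℚ Σ (upTo k) (λ a → 𝟙 (b ℕₚ.≤? a) *ℚ row a)
    ≡⟨ cong₂ _+ℚ_ (trans (𝟙*-yes (b ℕₚ.≤? k) b≤k) (Σ-constant-row r k))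
         (Σ-cong-∈ (upTo k) (λ a a∈ → cong (𝟙 (b ℕₚ.≤? a) *ℚ_) (Σ-row-from a r k (ℕₚ.<⇒≤ (∈-upTo⁻ a∈))))) ⟩
  g (replicate (suc r) k) +ℚ Σ (upTo k) (λ a → 𝟙 (b ℕₚ.≤? a) *ℚ Σ (upTo (suc r)) (λ t → rest a t))
    ≡⟨ cong₂ _+ℚ_ (sym (trans (ℚₚ.+-identityʳ (1ℚ *ℚ g (replicate (suc r) k))) (ℚₚ.*-identityˡ (g (replicate (suc r) k)))))
         (trans (Σ-cong (upTo k) (λ a → sym (Σ-distribˡ (𝟙 (b ℕₚ.≤? a)) (upTo (suc r)) {rest a})))
                (Σ-swap (upTo k) (upTo (suc r)) {λ a t → 𝟙 (b ℕₚ.≤? a) *ℚ rest a t})) ⟩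
  (1ℚ *ℚ g (replicate (suc r) k) +ℚ 0ℚ) +ℚ Σ (upTo (suc r)) (λ t → Σ (upTo k) (λ a → 𝟙 (b ℕₚ.≤? a) *ℚ rest a t))
    ≡⟨ cong ((1ℚ *ℚ g (replicate (suc r) k) +ℚ 0ℚ) +ℚ_) (Σ-cong (upTo (suc r)) (λ t → sym (Σ-weakInc-∷ b t k))) ⟩
  (1ℚ *ℚ g (replicate (suc r) k) +ℚ 0ℚ) +ℚ
    Σ (upTo (suc r)) (λ t → Σ (allWords (suc t) k) (λ v → 𝟙 (inc? (b ∷ v)) *ℚ g (v ++ replicate (r ℕ.∸ t) k)))
    ≡⟨ Σ-upTo-first (suc r) {λ t → Σ (allWords t k) (λ v → 𝟙 (inc? (b ∷ v)) *ℚ g (v ++ replicate (suc r ℕ.∸ t) k))} ⟨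
  Σ (upTo (suc (suc r))) (λ t → Σ (allWords t k) (λ v → 𝟙 (inc? (b ∷ v)) *ℚ g (v ++ replicate (suc r ℕ.∸ t) k))) ∎
  where
    open ≡-Reasoning
    row : ℕ → ℚ
    row a = Σ (allWords r (suc k)) (λ u → 𝟙 (inc? (a ∷ u)) *ℚ g (a ∷ u))
    rest : ℕ → ℕ → ℚ
    rest a t = Σ (allWords t k) (λ v → 𝟙 (inc? (a ∷ v)) *ℚ g (a ∷ v ++ replicate (r ℕ.∸ t) k))

Σ-upTo-≤ : ∀ {r B} {f : ℕ → ℚ} → r < B → Σ (upTo (suc r)) f ≡ Σ (upTo B) (λ t → 𝟙 (t ℕₚ.≤? r) *ℚ f t)
Σ-upTo-≤ {r} {B} {f} r<B = sym (trans
  (Σ-image ℕₚ._≟_ id {λ t → 𝟙 (t ℕₚ.≤? r) *ℚ f t} (Uniqueₚ.upTo⁺ (suc r)) (Uniqueₚ.upTo⁺ B)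
    (λ x x∈ → ∈-upTo⁺ (ℕₚ.≤-trans (∈-upTo⁻ x∈) r<B)) (λ _ _ _ _ → id)
    (λ t _ t∉ → 𝟙*-no (t ℕₚ.≤? r) (λ t≤r → t∉ (t , ∈-upTo⁺ (s≤s t≤r) , refl))))
  (Σ-cong-∈ (upTo (suc r)) {λ t → 𝟙 (t ℕₚ.≤? r) *ℚ f t} {f} (λ t t∈ → 𝟙*-yes (t ℕₚ.≤? r) (ℕₚ.≤-pred (∈-upTo⁻ t∈)))))

weakInc-0∷ : ∀ u → weakInc (0 ∷ u) ≡ weakInc u
weakInc-0∷ []      = refl
weakInc-0∷ (_ ∷ _) = refl

Σ-row : ∀ r k B {g : Word → ℚ} → r < B → Σ (allWords r (suc k)) (λ u → 𝟙 (inc? u) *ℚ g u) ≡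
  Σ (upTo B) (λ t → 𝟙 (t ℕₚ.≤? r) *ℚ Σ (allWords t k) (λ v → 𝟙 (inc? v) *ℚ g (v ++ replicate (r ℕ.∸ t) k)))
Σ-row r k B {g} r<B = begin
  Σ (allWords r (suc k)) (λ u → 𝟙 (inc? u) *ℚ g u)
    ≡⟨ Σ-cong (allWords r (suc k)) (λ u → cong (λ b → 𝟙 (T? b) *ℚ g u) (sym (weakInc-0∷ u))) ⟩
  Σ (allWords r (suc k)) (λ u → 𝟙 (inc? (0 ∷ u)) *ℚ g u)
    ≡⟨ Σ-row-from 0 r k z≤n ⟩
  Σ (upTo (suc r)) (λ t → Σ (allWords t k) (λ v → 𝟙 (inc? (0 ∷ v)) *ℚ g (v ++ replicate (r ℕ.∸ t) k)))
    ≡⟨ Σ-cong (upTo (suc r)) (λ t → Σ-cong (allWords t k) (λ v → cong (λ b → 𝟙 (T? b) *ℚ g (v ++ replicate (r ℕ.∸ t) k)) (weakInc-0∷ v))) ⟩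
  Σ (upTo (suc r)) (λ t → Σ (allWords t k) (λ v → 𝟙 (inc? v) *ℚ g (v ++ replicate (r ℕ.∸ t) k)))
    ≡⟨ Σ-upTo-≤ r<B ⟩
  Σ (upTo B) (λ t → 𝟙 (t ℕₚ.≤? r) *ℚ Σ (allWords t k) (λ v → 𝟙 (inc? v) *ℚ g (v ++ replicate (r ℕ.∸ t) k))) ∎
  where open ≡-Reasoning

-- Deleting the largest letter of a semistandard filling

T-∧⁺ : ∀ {a b} → T a → T b → T (a ∧ b)
T-∧⁺ {true} _ tb = tb

T-∧⁻ : ∀ {a b} → T (a ∧ b) → T a × T b
T-∧⁻ {true} tb = tt , tb

colStrict-[] : ∀ p → T (colStrict p [])
colStrict-[] []      = tt
colStrict-[] (_ ∷ _) = tt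

-- No letter can stand below a copy of the largest letter k, so the whole lower row lies below the
-- part of the upper row that is free of k: the condition for a horizontal strip. Since `colStrict`
-- compares only the overlap of two rows, the hypothesis on lengths is what makes them consecutive
-- rows of a shape.
colStrict-pad⁻ : ∀ k p v x y → All (_< k) p → All (_< k) v → length v + y ≤ length p + x →
  T (colStrict (p ++ replicate x k) (v ++ replicate y k)) → T (colStrict p v) × length v + y ≤ length p
colStrict-pad⁻ k []      []      x       zero    _ _ _ _ = tt , z≤n
colStrict-pad⁻ k []      []      (suc x) (suc y) _ _ _ h = contradiction (ℕₚ.<ᵇ⇒< k k (proj₁ (T-∧⁻ {k <ᵇ k} h))) (ℕₚ.<-irrefl refl)
colStrict-pad⁻ k []      (b ∷ v) (suc x) y       _ (b<k ∷ _) _ h = contradiction (ℕₚ.<ᵇ⇒< k b (proj₁ (T-∧⁻ {k <ᵇ b} h))) (ℕₚ.<-asym b<k)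
colStrict-pad⁻ k (a ∷ p) []      x       zero    _ _ _ _ = tt , z≤n
colStrict-pad⁻ k (a ∷ p) []      x       (suc y) (_ ∷ p<k) _ (s≤s le) h =
  tt , s≤s (proj₂ (colStrict-pad⁻ k p [] x y p<k [] le (proj₂ (T-∧⁻ {a <ᵇ k} h))))
colStrict-pad⁻ k (a ∷ p) (b ∷ v) x       y       (_ ∷ p<k) (_ ∷ v<k) (s≤s le) h =
  let ab , t = T-∧⁻ {a <ᵇ b} h ; c , l = colStrict-pad⁻ k p v x y p<k v<k le t in T-∧⁺ ab c , s≤s l

colStrict-pad⁺ : ∀ k p v x y → All (_< k) p → T (colStrict p v) → length v + y ≤ length p →
  T (colStrict (p ++ replicate x k) (v ++ replicate y k))
colStrict-pad⁺ k []      []      x zero    _ _ _ = colStrict-[] (replicate x k)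
colStrict-pad⁺ k (a ∷ p) []      x zero    _ _ _ = tt
colStrict-pad⁺ k (a ∷ p) []      x (suc y) (a<k ∷ p<k) _ (s≤s le) =
  T-∧⁺ (ℕₚ.<⇒<ᵇ a<k) (colStrict-pad⁺ k p [] x y p<k (colStrict-[] p) le)
colStrict-pad⁺ k (a ∷ p) (b ∷ v) x y       (_ ∷ p<k) h (s≤s le) =
  let ab , t = T-∧⁻ {a <ᵇ b} h in T-∧⁺ ab (colStrict-pad⁺ k p v x y p<k t le)

Decreasing : List ℕ → Set
Decreasing = Linked (λ a b → b ≤ a)

Decreasing-head : ∀ {r rs} → Decreasing (r ∷ rs) → ∀ r′ rs′ → rs ≡ r′ ∷ rs′ → r′ ≤ r
Decreasing-head (h ∷ _) _ _ refl = h

-- `HS` continued below a row of which p cells are left after the deletion: a row of length r is at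
-- most as long as what is left of the row above, and keeps t of its own cells.
Chain : ℕ → List ℕ → List ℕ → Set
Chain p []       []      = ⊤
Chain p []       (_ ∷ _) = ⊥
Chain p (_ ∷ _)  []      = ⊥
Chain p (r ∷ rs) (t ∷ κ) = (r ≤ p × t ≤ r) × Chain t rs κ

chain? : ∀ p rs κ → Dec (Chain p rs κ)
chain? p []       []      = yes tt
chain? p []       (_ ∷ _) = no λ ()
chain? p (_ ∷ _)  []      = no λ ()
chain? p (r ∷ rs) (t ∷ κ) = (r ℕₚ.≤? p ×-dec t ℕₚ.≤? r) ×-dec chain? t rs κ

HS⇒Chain : ∀ r rs t κ → HS (r ∷ rs) (t ∷ κ) → t ≤ r × Chain t rs κ
HS⇒Chain r []        t []       h = h , tt
HS⇒Chain r (r′ ∷ rs) t (t′ ∷ κ) ((r′≤t , t≤r) , h) = let t′≤r′ , c = HS⇒Chain r′ rs t′ κ h in t≤r , (r′≤t , t′≤r′) , c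
HS⇒Chain r (r′ ∷ []) t [] (_ , ())
HS⇒Chain r (r′ ∷ _ ∷ rs) t [] (_ , ())

Chain⇒HS : ∀ r rs t κ → t ≤ r → Chain t rs κ → HS (r ∷ rs) (t ∷ κ)
Chain⇒HS r []        t []       t≤r _ = t≤r
Chain⇒HS r (r′ ∷ rs) t (t′ ∷ κ) t≤r ((r′≤t , t′≤r′) , c) = (r′≤t , t≤r) , Chain⇒HS r′ rs t′ κ t′≤r′ c

HS-Decreasing : ∀ l κ → HS l κ → Decreasing κ
HS-Decreasing (k ∷ [])         (t ∷ [])     h = [-]
HS-Decreasing (k ∷ k′ ∷ [])    (t ∷ t′ ∷ []) ((k′≤t , _) , t′≤k′) = ℕₚ.≤-trans t′≤k′ k′≤t ∷ [-]
HS-Decreasing (k ∷ k′ ∷ k″ ∷ l) (t ∷ t′ ∷ κ) ((k′≤t , _) , h@((_ , t′≤k′) , _)) = ℕₚ.≤-trans t′≤k′ k′≤t ∷ HS-Decreasing (k′ ∷ k″ ∷ l) (t′ ∷ κ) h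
HS-Decreasing (k ∷ k′ ∷ [])    (t ∷ []) (_ , ())
HS-Decreasing (k ∷ k′ ∷ _ ∷ l) (t ∷ []) (_ , ())

HS-Sub : ∀ l κ → HS l κ → Sub κ l
HS-Sub (k ∷ [])     (t ∷ [])    h = h , tt
HS-Sub (k ∷ k′ ∷ l) (t ∷ κ) ((_ , t≤k) , h) = t≤k , HS-Sub (k′ ∷ l) κ h

-- Sum over the semistandard fillings, by letters < k, of rows of lengths rs placed below a row prev.
below : ℕ → List ℕ → Word → (List Word → ℚ) → ℚ
below k []       prev F = F []
below k (r ∷ rs) prev F = Σ (allWords r k) (λ u → 𝟙 (inc? u) *ℚ (𝟙 (col? prev u) *ℚ below k rs u (λ R → F (u ∷ R))))

extend : ℕ → List ℕ → List Word → List Word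
extend k (r ∷ rs) (v ∷ R) = (v ++ replicate (r ℕ.∸ length v) k) ∷ extend k rs R
extend k _        _       = []

extend-row : ∀ k rs {r t} v R → length v ≡ t → extend k (r ∷ rs) (v ∷ R) ≡ (v ++ replicate (r ℕ.∸ t) k) ∷ extend k rs R
extend-row k rs v R refl = refl

below-cong : ∀ k rs prev {F G : List Word → ℚ} → (∀ R → F R ≡ G R) → below k rs prev F ≡ below k rs prev G
below-cong k []       prev h = h []
below-cong k (r ∷ rs) prev h = Σ-cong (allWords r k) (λ u →
  cong (λ z → 𝟙 (inc? u) *ℚ (𝟙 (col? prev u) *ℚ z)) (below-cong k rs u (λ R → h (u ∷ R))))

module Peel (B : ℕ) where

  -- Deletion of the letter k from all rows, with κ the remaining row lengths. The row above is
  -- given as its letters less than k followed by x copies of k, since only the former can have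
  -- cells below them. F receives the refilled rows, so any statistic of the filling is carried
  -- along.
  Peeling : ℕ → List ℕ → Set
  Peeling k rs = ∀ prev x F → All (_< k) prev → (∀ r rs′ → rs ≡ r ∷ rs′ → r ≤ length prev + x) →
    below (suc k) rs (prev ++ replicate x k) F ≡
    Σ (allWords (length rs) B) (λ κ → 𝟙 (chain? (length prev) rs κ) *ℚ below k κ prev (λ R → F (extend k rs R)))

  -- The step shared by the top row and the rows below it. They differ only in what the row above
  -- imposes: `e` is trivial for the top row, and for the others it bounds r by the number of
  -- letters less than k in the row above.
  peel-row : ∀ k r rs → Peeling k rs → r < B → (∀ r′ rs′ → rs ≡ r′ ∷ rs′ → r′ ≤ r) →
    ∀ {E : Set} (e : Dec E) (prev prev′ : Word) F →
    (∀ v → All (_< k) v → length v ≤ r → 𝟙 (col? prev (v ++ replicate (r ℕ.∸ length v) k)) ≡ 𝟙 e *ℚ 𝟙 (col? prev′ v)) →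
    below (suc k) (r ∷ rs) prev F ≡
    Σ (upTo B) (λ t → Σ (allWords (length rs) B) (λ κ → 𝟙 ((e ×-dec t ℕₚ.≤? r) ×-dec chain? t rs κ) *ℚ
      below k (t ∷ κ) prev′ (λ R → F (extend k (r ∷ rs) R))))
  peel-row k r rs IH r<B dec e prev prev′ F hcol = begin
    below (suc k) (r ∷ rs) prev F
      ≡⟨ Σ-row r k B r<B ⟩
    Σ (upTo B) (λ t → 𝟙 (t ℕₚ.≤? r) *ℚ Σ (allWords t k) (λ v → 𝟙 (inc? v) *ℚ
        (𝟙 (col? prev (v ++ replicate (r ℕ.∸ t) k)) *ℚ below (suc k) rs (v ++ replicate (r ℕ.∸ t) k) (λ R → F ((v ++ replicate (r ℕ.∸ t) k) ∷ R)))))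
      ≡⟨ Σ-cong (upTo B) (λ t → 𝟙*-cong (t ℕₚ.≤? r) (λ t≤r → Σ-cong-∈ (allWords t k) (λ v v∈ →
           cong (𝟙 (inc? v) *ℚ_) (row t t≤r v (∈-allWords⁻ t k v∈))))) ⟩
    Σ (upTo B) (λ t → 𝟙 (t ℕₚ.≤? r) *ℚ Σ (allWords t k) (λ v → 𝟙 (inc? v) *ℚ Σ W (λ κ → 𝟙 (e ×-dec chain? t rs κ) *ℚ Z κ v)))
      ≡⟨ Σ-cong (upTo B) (λ t → cong (𝟙 (t ℕₚ.≤? r) *ℚ_) (trans
           (Σ-cong (allWords t k) (λ v → sym (Σ-distribˡ (𝟙 (inc? v)) W))) (Σ-swap (allWords t k) W))) ⟩
    Σ (upTo B) (λ t → 𝟙 (t ℕₚ.≤? r) *ℚ Σ W (λ κ → Σ (allWords t k) (λ v → 𝟙 (inc? v) *ℚ (𝟙 (e ×-dec chain? t rs κ) *ℚ Z κ v))))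
      ≡⟨ Σ-cong (upTo B) (λ t → trans (sym (Σ-distribˡ (𝟙 (t ℕₚ.≤? r)) W)) (Σ-cong W (λ κ → begin
           𝟙 (t ℕₚ.≤? r) *ℚ Σ (allWords t k) (λ v → 𝟙 (inc? v) *ℚ (𝟙 (e ×-dec chain? t rs κ) *ℚ Z κ v))
             ≡⟨ cong (𝟙 (t ℕₚ.≤? r) *ℚ_) (trans (Σ-cong (allWords t k) (λ v → *ℚ-swapˡ (𝟙 (inc? v)) (𝟙 (e ×-dec chain? t rs κ)) (Z κ v)))
                  (Σ-distribˡ (𝟙 (e ×-dec chain? t rs κ)) (allWords t k))) ⟩
           𝟙 (t ℕₚ.≤? r) *ℚ (𝟙 (e ×-dec chain? t rs κ) *ℚ Σ (allWords t k) (λ v → 𝟙 (inc? v) *ℚ Z κ v))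
             ≡⟨ 𝟙-split ((e ×-dec t ℕₚ.≤? r) ×-dec chain? t rs κ) (t ℕₚ.≤? r) (e ×-dec chain? t rs κ)
                  (λ { ((p , q) , c) → q , p , c }) (λ { q (p , c) → (p , q) , c }) ⟨
           𝟙 ((e ×-dec t ℕₚ.≤? r) ×-dec chain? t rs κ) *ℚ below k (t ∷ κ) prev′ (λ R → F (extend k (r ∷ rs) R)) ∎))) ⟩
    Σ (upTo B) (λ t → Σ W (λ κ → 𝟙 ((e ×-dec t ℕₚ.≤? r) ×-dec chain? t rs κ) *ℚ
      below k (t ∷ κ) prev′ (λ R → F (extend k (r ∷ rs) R)))) ∎
    where
      open ≡-Reasoning
      W = allWords (length rs) B
      Z : List ℕ → Word → ℚ
      Z κ v = 𝟙 (col? prev′ v) *ℚ below k κ v (λ R → F (extend k (r ∷ rs) (v ∷ R)))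
      row : ∀ t → t ≤ r → ∀ v → length v ≡ t × All (_< k) v →
        𝟙 (col? prev (v ++ replicate (r ℕ.∸ t) k)) *ℚ below (suc k) rs (v ++ replicate (r ℕ.∸ t) k) (λ R → F ((v ++ replicate (r ℕ.∸ t) k) ∷ R))
        ≡ Σ W (λ κ → 𝟙 (e ×-dec chain? t rs κ) *ℚ Z κ v)
      row t t≤r v (refl , v<k) = begin
        𝟙 (col? prev (v ++ replicate (r ℕ.∸ t) k)) *ℚ below (suc k) rs (v ++ replicate (r ℕ.∸ t) k) (λ R → F ((v ++ replicate (r ℕ.∸ t) k) ∷ R))
          ≡⟨ cong₂ _*ℚ_ (hcol v v<k t≤r) (IH v (r ℕ.∸ t) _ v<k (λ r′ rs′ eq → ℕₚ.≤-trans (dec r′ rs′ eq) (ℕₚ.≤-reflexive (sym (ℕₚ.m+[n∸m]≡n t≤r))))) ⟩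
        (𝟙 e *ℚ 𝟙 (col? prev′ v)) *ℚ Σ W (λ κ → 𝟙 (chain? t rs κ) *ℚ below k κ v (λ R → F (extend k (r ∷ rs) (v ∷ R))))
          ≡⟨ Σ-distribˡ (𝟙 e *ℚ 𝟙 (col? prev′ v)) W ⟨
        Σ W (λ κ → (𝟙 e *ℚ 𝟙 (col? prev′ v)) *ℚ (𝟙 (chain? t rs κ) *ℚ below k κ v (λ R → F (extend k (r ∷ rs) (v ∷ R)))))
          ≡⟨ Σ-cong W (λ κ → let y = below k κ v (λ R → F (extend k (r ∷ rs) (v ∷ R))) in
               trans (ℚₚ.*-assoc (𝟙 e) (𝟙 (col? prev′ v)) (𝟙 (chain? t rs κ) *ℚ y))
               (trans (cong (𝟙 e *ℚ_) (*ℚ-swapˡ (𝟙 (col? prev′ v)) (𝟙 (chain? t rs κ)) y))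
               (sym (𝟙-split (e ×-dec chain? t rs κ) e (chain? t rs κ) id _,_)))) ⟩
        Σ W (λ κ → 𝟙 (e ×-dec chain? t rs κ) *ℚ Z κ v) ∎

  peel : ∀ k rs → All (_< B) rs → Decreasing rs → Peeling k rs
  peel k []       _           _  prev x F prev<k _ = sym (trans (ℚₚ.+-identityʳ _) (ℚₚ.*-identityˡ (F [])))
  peel k (r ∷ rs) (r<B ∷ rs<B) ds prev x F prev<k r≤ = trans
    (peel-row k r rs (peel k rs rs<B (Linked.tail ds)) r<B (Decreasing-head ds) (r ℕₚ.≤? length prev) (prev ++ replicate x k) prev F col)
    (sym (allWords-Σ (length rs) B))
    where
      col : ∀ v → All (_< k) v → length v ≤ r →
        𝟙 (col? (prev ++ replicate x k) (v ++ replicate (r ℕ.∸ length v) k)) ≡ 𝟙 (r ℕₚ.≤? length prev) *ℚ 𝟙 (col? prev v)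
      col v v<k v≤r = trans (𝟙-cong (col? (prev ++ replicate x k) (v ++ replicate (r ℕ.∸ length v) k)) (r ℕₚ.≤? length prev ×-dec col? prev v)
          (λ h → let c , l = colStrict-pad⁻ k prev v x (r ℕ.∸ length v) prev<k v<k (ℕₚ.≤-trans (ℕₚ.≤-reflexive e) (r≤ r rs refl)) h
                 in ℕₚ.≤-trans (ℕₚ.≤-reflexive (sym e)) l , c)
          (λ { (l , c) → colStrict-pad⁺ k prev v x (r ℕ.∸ length v) prev<k c (ℕₚ.≤-trans (ℕₚ.≤-reflexive e) l) }))
        (𝟙-× (r ℕₚ.≤? length prev) (col? prev v))
        where e : length v + (r ℕ.∸ length v) ≡ r
              e = ℕₚ.m+[n∸m]≡n v≤r

  peel-top : ∀ k r rs F → All (_< B) (r ∷ rs) → Decreasing (r ∷ rs) → below (suc k) (r ∷ rs) [] F ≡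
    Σ (allWords (suc (length rs)) B) (λ κ → 𝟙 (hs? (r ∷ rs) κ) *ℚ below k κ [] (λ R → F (extend k (r ∷ rs) R)))
  peel-top k r rs F (r<B ∷ rs<B) ds = trans
    (peel-row k r rs (peel k rs rs<B (Linked.tail ds)) r<B (Decreasing-head ds) (yes tt) [] [] F (λ v _ _ → refl))
    (sym (trans (allWords-Σ (length rs) B) (Σ-cong (upTo B) (λ t → Σ-cong (allWords (length rs) B) (λ κ →
      cong (_*ℚ below k (t ∷ κ) [] (λ R → F (extend k (r ∷ rs) R)))
        (𝟙-cong (hs? (r ∷ rs) (t ∷ κ)) ((yes tt ×-dec t ℕₚ.≤? r) ×-dec chain? t rs κ)
          (λ h → let t≤r , c = HS⇒Chain r rs t κ h in (tt , t≤r) , c) (λ { ((_ , t≤r) , c) → Chain⇒HS r rs t κ t≤r c })))))))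

-- From reading words to fillings given by rows

take-length-++ : ∀ {A : Set} (u v : List A) → take (length u) (u ++ v) ≡ u
take-length-++ []      v = refl
take-length-++ (x ∷ u) v = cong (x ∷_) (take-length-++ u v)

drop-length-++ : ∀ {A : Set} (u v : List A) → drop (length u) (u ++ v) ≡ v
drop-length-++ []      v = refl
drop-length-++ (x ∷ u) v = drop-length-++ u v

rowsOf-++ : ∀ {r} rs u v → length u ≡ r → rowsOf (r ∷ rs) (u ++ v) ≡ u ∷ rowsOf rs v
rowsOf-++ rs u v refl = cong₂ _∷_ (take-length-++ u v) (cong (rowsOf rs) (drop-length-++ u v))

ssyt? : (R : List Word) → Dec (T (isSSYTRows R))
ssyt? R = T? (isSSYTRows R)

Σ-below : ∀ k rs prev F → Σ (allWords (sum rs) k) (λ w → 𝟙 (ssyt? (prev ∷ rowsOf rs w)) *ℚ F (rowsOf rs w)) ≡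
          𝟙 (inc? prev) *ℚ below k rs prev F
Σ-below k []       prev F = ℚₚ.+-identityʳ _
Σ-below k (r ∷ rs) prev F = begin
  Σ (allWords (r + sum rs) k) (λ w → 𝟙 (ssyt? (prev ∷ rowsOf (r ∷ rs) w)) *ℚ F (rowsOf (r ∷ rs) w))
    ≡⟨ allWords-++-Σ r (sum rs) k ⟩
  Σ (allWords r k) (λ u → Σ V (λ v → 𝟙 (ssyt? (prev ∷ rowsOf (r ∷ rs) (u ++ v))) *ℚ F (rowsOf (r ∷ rs) (u ++ v))))
    ≡⟨ Σ-cong-∈ (allWords r k) (λ u u∈ → Σ-cong V (λ v → trans
         (cong (λ R → 𝟙 (ssyt? (prev ∷ R)) *ℚ F R) (rowsOf-++ rs u v (proj₁ (∈-allWords⁻ r k u∈)))) (split u v))) ⟩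
  Σ (allWords r k) (λ u → Σ V (λ v → 𝟙 (inc? prev) *ℚ (𝟙 (col? prev u) *ℚ (𝟙 (ssyt? (u ∷ rowsOf rs v)) *ℚ F (u ∷ rowsOf rs v)))))
    ≡⟨ Σ-cong (allWords r k) (λ u → trans (Σ-distribˡ (𝟙 (inc? prev)) V) (cong (𝟙 (inc? prev) *ℚ_)
         (trans (Σ-distribˡ (𝟙 (col? prev u)) V) (trans (cong (𝟙 (col? prev u) *ℚ_) (Σ-below k rs u (λ R → F (u ∷ R))))
           (*ℚ-swapˡ (𝟙 (col? prev u)) (𝟙 (inc? u)) (below k rs u (λ R → F (u ∷ R)))))))) ⟩
  Σ (allWords r k) (λ u → 𝟙 (inc? prev) *ℚ (𝟙 (inc? u) *ℚ (𝟙 (col? prev u) *ℚ below k rs u (λ R → F (u ∷ R)))))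
    ≡⟨ Σ-distribˡ (𝟙 (inc? prev)) (allWords r k) ⟩
  𝟙 (inc? prev) *ℚ below k (r ∷ rs) prev F ∎
  where
    open ≡-Reasoning
    V = allWords (sum rs) k
    split : ∀ u v → 𝟙 (ssyt? (prev ∷ u ∷ rowsOf rs v)) *ℚ F (u ∷ rowsOf rs v) ≡
      𝟙 (inc? prev) *ℚ (𝟙 (col? prev u) *ℚ (𝟙 (ssyt? (u ∷ rowsOf rs v)) *ℚ F (u ∷ rowsOf rs v)))
    split u v = trans (cong (_*ℚ y) (𝟙-∧ (weakInc prev) (colStrict prev u ∧ isSSYTRows (u ∷ rowsOf rs v))))
      (trans (ℚₚ.*-assoc (𝟙 (inc? prev)) (𝟙 (T? (colStrict prev u ∧ isSSYTRows (u ∷ rowsOf rs v)))) y)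
      (cong (𝟙 (inc? prev) *ℚ_) (trans (cong (_*ℚ y) (𝟙-∧ (colStrict prev u) (isSSYTRows (u ∷ rowsOf rs v))))
        (ℚₚ.*-assoc (𝟙 (col? prev u)) (𝟙 (ssyt? (u ∷ rowsOf rs v))) y))))
      where y = F (u ∷ rowsOf rs v)

isSSYTRows-[]∷ : ∀ R → isSSYTRows ([] ∷ R) ≡ isSSYTRows R
isSSYTRows-[]∷ []      = refl
isSSYTRows-[]∷ (_ ∷ _) = refl

Σ-SSYT : ∀ k rs F → Σ (allWords (sum rs) k) (λ w → 𝟙 (T? (isSSYT rs w)) *ℚ F (rowsOf rs w)) ≡ below k rs [] F
Σ-SSYT k rs F = trans
  (Σ-cong (allWords (sum rs) k) (λ w → cong (λ b → 𝟙 (T? b) *ℚ F (rowsOf rs w)) (sym (isSSYTRows-[]∷ (rowsOf rs w)))))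
  (trans (Σ-below k rs [] F) (ℚₚ.*-identityˡ (below k rs [] F)))

concat-rowsOf : ∀ rs w → length w ≡ sum rs → concat (rowsOf rs w) ≡ w
concat-rowsOf []       []      _ = refl
concat-rowsOf (r ∷ rs) w       e = trans (cong (take r w ++_) (concat-rowsOf rs (drop r w)
    (trans (length-drop r w) (trans (cong (ℕ._∸ r) e) (ℕₚ.m+n∸m≡n r (sum rs))))))
  (take++drop≡id r w)

replicate-+ : ∀ {A : Set} a b {x : A} → replicate (a + b) x ≡ replicate a x ++ replicate b x
replicate-+ zero    b = refl
replicate-+ (suc a) b = cong (_ ∷_) (replicate-+ a b)

++-interchange-↭ : ∀ {A : Set} (a b c d : List A) → (a ++ b) ++ (c ++ d) ↭ (a ++ c) ++ (b ++ d)
++-interchange-↭ a b c d = begin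
  (a ++ b) ++ (c ++ d)  ≡⟨ ++-assoc a b (c ++ d) ⟩
  a ++ (b ++ (c ++ d))  ↭⟨ ↭ₚ.++⁺ˡ a (↭ₚ.shifts b c) ⟩
  a ++ (c ++ (b ++ d))  ≡⟨ ++-assoc a c (b ++ d) ⟨
  (a ++ c) ++ (b ++ d)  ∎
  where open PermutationReasoning

-- Contents do not see the order of letters, so the copies of k appended to the separate rows may be
-- gathered at the end.
concat-extend : ∀ k l κ w x → Sub κ l → length w ≡ sum κ → sum κ + x ≡ sum l →
                concat (extend k l (rowsOf κ w)) ↭ w ++ replicate x k
concat-extend k []       []      []  x _ _ e with refl ← e = ↭-refl
concat-extend k (r ∷ rs) (t ∷ κ) w x (t≤r , s) lw e = begin
  concat (extend k (r ∷ rs) (take t w ∷ rowsOf κ (drop t w)))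
    ≡⟨ cong concat (extend-row k rs (take t w) (rowsOf κ (drop t w)) lt) ⟩
  (take t w ++ replicate a k) ++ concat (extend k rs (rowsOf κ (drop t w)))
    ↭⟨ ↭ₚ.++⁺ˡ (take t w ++ replicate a k) (concat-extend k rs κ (drop t w) b s ld (ℕₚ.m+[n∸m]≡n (Sub-sum κ rs s))) ⟩
  (take t w ++ replicate a k) ++ (drop t w ++ replicate b k)
    ↭⟨ ++-interchange-↭ (take t w) (replicate a k) (drop t w) (replicate b k) ⟩
  (take t w ++ drop t w) ++ (replicate a k ++ replicate b k)
    ≡⟨ cong₂ _++_ (take++drop≡id t w) (trans (sym (replicate-+ a b)) (cong (λ z → replicate z k) (sym x≡))) ⟩
  w ++ replicate x k ∎
  where
    open PermutationReasoning
    a = r ℕ.∸ t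
    b = sum rs ℕ.∸ sum κ
    lt : length (take t w) ≡ t
    lt = trans (length-take t w) (ℕₚ.m≤n⇒m⊓n≡m (ℕₚ.≤-trans (ℕₚ.m≤m+n t (sum κ)) (ℕₚ.≤-reflexive (sym lw))))
    ld : length (drop t w) ≡ sum κ
    ld = trans (length-drop t w) (trans (cong (ℕ._∸ t) lw) (ℕₚ.m+n∸m≡n t (sum κ)))
    x≡ : x ≡ a + b
    x≡ = ℕₚ.+-cancelˡ-≡ (t + sum κ) x (a + b) (trans e (trans (sym (cong₂ _+_ (ℕₚ.m+[n∸m]≡n t≤r) (ℕₚ.m+[n∸m]≡n (Sub-sum κ rs s))))
           (+-interchange t a (sum κ) b)))

contents-pad : ∀ k w x → All (_< k) w → contents (suc k) (w ++ replicate x k) ≡ x ∷ contents k w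
contents-pad k w x w<k = cong₂ _∷_
  (trans (occ-++ ℕₚ._≟_ k w (replicate x k)) (cong₂ _+_ (occ-none ℕₚ._≟_ (All.map (λ a<k → ≢-sym (ℕₚ.<⇒≢ a<k)) w<k)) (occ-replicate ℕₚ._≟_ k x)))
  (contents-cong k (λ i i<k → trans (occ-++ ℕₚ._≟_ i w (replicate x k))
    (trans (cong (occ ℕₚ._≟_ i w +_) (occ-replicate-≢ ℕₚ._≟_ x (ℕₚ.<⇒≢ i<k))) (ℕₚ.+-identityʳ _))))

fillings : ℕ → List ℕ → List ℕ → ℚ
fillings k l α = Σ (allWords (sum l) k) (λ w → 𝟙 (T? (isSSYT l w)) *ℚ 𝟙 (contents k w ≟L α))

isSSYT-zeros : ∀ l → sum l ≡ 0 → T (isSSYT l [])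
isSSYT-zeros []                 e = tt
isSSYT-zeros (zero ∷ [])        e = tt
isSSYT-zeros (zero ∷ l@(_ ∷ _)) e = isSSYT-zeros l e

module _ (j B : ℕ) where
  open Strips j B
  open Peel B

  -- Both sides satisfy the same recursion: the cells with the largest letter form a horizontal
  -- strip of size a, and deleting them leaves a semistandard filling of κ with one letter fewer.
  fillings≡K : ∀ α l → length l ≡ suc j → All (_< B) l → Decreasing l → fillings (length α) l α ≡ K l α
  fillings≡K [] l ll l<B ds with sum l in eq
  ... | zero  = trans (ℚₚ.+-identityʳ _) (cong (_*ℚ 1ℚ) (𝟙-yes (T? (isSSYT l [])) (isSSYT-zeros l eq)))
  ... | suc _ = refl
  fillings≡K (a ∷ α) l@(r ∷ rs) ll l<B ds = begin
    Σ (allWords (sum l) (suc k)) (λ w → 𝟙 (T? (isSSYT l w)) *ℚ 𝟙 (contents (suc k) w ≟L (a ∷ α)))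
      ≡⟨ Σ-cong-∈ (allWords (sum l) (suc k)) (λ w w∈ → cong (λ z → 𝟙 (T? (isSSYT l w)) *ℚ 𝟙 (contents (suc k) z ≟L (a ∷ α)))
           (sym (concat-rowsOf l w (proj₁ (∈-allWords⁻ (sum l) (suc k) w∈))))) ⟩
    Σ (allWords (sum l) (suc k)) (λ w → 𝟙 (T? (isSSYT l w)) *ℚ F (rowsOf l w))
      ≡⟨ Σ-SSYT (suc k) l F ⟩
    below (suc k) l [] F
      ≡⟨ peel-top k r rs F l<B ds ⟩
    Σ (allWords (suc (length rs)) B) (λ κ → 𝟙 (hs? l κ) *ℚ below k κ [] (λ R → F (extend k l R)))
      ≡⟨ cong (λ n → Σ (allWords n B) (λ κ → 𝟙 (hs? l κ) *ℚ below k κ [] (λ R → F (extend k l R)))) ll ⟩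
    Σ Λ (λ κ → 𝟙 (hs? l κ) *ℚ below k κ [] (λ R → F (extend k l R)))
      ≡⟨ Σ-cong-∈ Λ (λ κ κ∈ → trans (𝟙*-cong (hs? l κ) (λ h → step κ h (∈-allWords⁻ (suc j) B κ∈)))
           (sym (𝟙-split (hs? l κ ×-dec (sum κ + a ℕₚ.≟ sum l)) (hs? l κ) (sum κ + a ℕₚ.≟ sum l) id _,_))) ⟩
    Σ Λ (λ κ → 𝟙 (hs? l κ ×-dec (sum κ + a ℕₚ.≟ sum l)) *ℚ K κ α) ∎
    where
      open ≡-Reasoning
      k = length α
      F : List Word → ℚ
      F R = 𝟙 (contents (suc k) (concat R) ≟L (a ∷ α))
      step : ∀ κ → HS l κ → length κ ≡ suc j × All (_< B) κ →
             below k κ [] (λ R → F (extend k l R)) ≡ 𝟙 (sum κ + a ℕₚ.≟ sum l) *ℚ K κ α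
      step κ h (lκ , κ<B) = begin
        below k κ [] (λ R → F (extend k l R))
          ≡⟨ Σ-SSYT k κ (λ R → F (extend k l R)) ⟨
        Σ (allWords (sum κ) k) (λ w → 𝟙 (T? (isSSYT κ w)) *ℚ F (extend k l (rowsOf κ w)))
          ≡⟨ Σ-cong-∈ (allWords (sum κ) k) (λ w w∈ → trans (cong (𝟙 (T? (isSSYT κ w)) *ℚ_) (test w (∈-allWords⁻ (sum κ) k w∈)))
               (*ℚ-swapˡ (𝟙 (T? (isSSYT κ w))) (𝟙 size) (𝟙 (contents k w ≟L α)))) ⟩
        Σ (allWords (sum κ) k) (λ w → 𝟙 size *ℚ (𝟙 (T? (isSSYT κ w)) *ℚ 𝟙 (contents k w ≟L α)))
          ≡⟨ Σ-distribˡ (𝟙 size) (allWords (sum κ) k) ⟩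
        𝟙 size *ℚ fillings k κ α
          ≡⟨ cong (𝟙 size *ℚ_) (fillings≡K α κ lκ κ<B (HS-Decreasing l κ h)) ⟩
        𝟙 size *ℚ K κ α ∎
        where
          size = sum κ + a ℕₚ.≟ sum l
          x = sum l ℕ.∸ sum κ
          κ+x≡l : sum κ + x ≡ sum l
          κ+x≡l = ℕₚ.m+[n∸m]≡n (HS-sum l κ h)
          test : ∀ w → length w ≡ sum κ × All (_< k) w → F (extend k l (rowsOf κ w)) ≡ 𝟙 size *ℚ 𝟙 (contents k w ≟L α)
          test w (lw , w<k) = trans
            (cong (λ z → 𝟙 (z ≟L (a ∷ α))) (trans (contents-↭ (suc k) (concat-extend k l κ w x (HS-Sub l κ h) lw κ+x≡l)) (contents-pad k w x w<k)))
            (trans (𝟙-cong ((x ∷ contents k w) ≟L (a ∷ α)) (size ×-dec (contents k w ≟L α))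
              (λ e → let e₁ , e₂ = ∷-injective e in trans (cong (sum κ +_) (sym e₁)) κ+x≡l , e₂)
              (λ { (e₁ , e₂) → cong₂ _∷_ (ℕₚ.+-cancelˡ-≡ (sum κ) x a (trans κ+x≡l (sym e₁))) e₂ }))
            (𝟙-× size (contents k w ≟L α)))

-- Empty rows, and Kostka numbers as numbers of fillings

pad : ℕ → List ℕ → List ℕ
pad ℓ ν = ν ++ replicate (ℓ ℕ.∸ length ν) 0

isSSYTRows-++[] : ∀ R z → isSSYTRows (R ++ replicate z []) ≡ isSSYTRows R
isSSYTRows-++[] []          zero    = refl
isSSYTRows-++[] []          (suc z) = trans (isSSYTRows-[]∷ (replicate z [])) (isSSYTRows-++[] [] z)
isSSYTRows-++[] (r ∷ [])    zero    = refl
isSSYTRows-++[] (r ∷ [])    (suc z) = trans (cong (λ b → weakInc r ∧ b) (trans (cong₂ _∧_ (colStrict-[]≡ r) (isSSYTRows-++[] [] (suc z))) refl)) (∧-identityʳ (weakInc r))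
  where
    colStrict-[]≡ : ∀ p → colStrict p [] ≡ true
    colStrict-[]≡ []      = refl
    colStrict-[]≡ (_ ∷ _) = refl
isSSYTRows-++[] (r ∷ r′ ∷ R) z = cong (λ b → weakInc r ∧ (colStrict r r′ ∧ b)) (isSSYTRows-++[] (r′ ∷ R) z)

rowsOf-pad : ∀ ν z w → length w ≡ sum ν → rowsOf (ν ++ replicate z 0) w ≡ rowsOf ν w ++ replicate z []
rowsOf-pad []       zero    []      _ = refl
rowsOf-pad []       (suc z) []      _ = cong ([] ∷_) (rowsOf-pad [] z [] refl)
rowsOf-pad (r ∷ ν)  z       w       e = cong (take r w ∷_) (rowsOf-pad ν z (drop r w)
  (trans (length-drop r w) (trans (cong (ℕ._∸ r) e) (ℕₚ.m+n∸m≡n r (sum ν)))))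

isSSYT-pad : ∀ ν z w → length w ≡ sum ν → isSSYT (ν ++ replicate z 0) w ≡ isSSYT ν w
isSSYT-pad ν z w e = trans (cong isSSYTRows (rowsOf-pad ν z w e)) (isSSYTRows-++[] (rowsOf ν w) z)

sum-pad : ∀ ν z → sum (ν ++ replicate z 0) ≡ sum ν
sum-pad []      zero    = refl
sum-pad []      (suc z) = sum-pad [] z
sum-pad (r ∷ ν) z       = cong (r +_) (sum-pad ν z)

fillings-pad : ∀ k ν z α → fillings k (ν ++ replicate z 0) α ≡ fillings k ν α
fillings-pad k ν z α = trans (cong (λ n → Σ (allWords n k) (λ w → 𝟙 (T? (isSSYT (ν ++ replicate z 0) w)) *ℚ 𝟙 (contents k w ≟L α))) (sum-pad ν z))
  (Σ-cong-∈ (allWords (sum ν) k) (λ w w∈ → cong (λ b → 𝟙 (T? b) *ℚ 𝟙 (contents k w ≟L α)) (isSSYT-pad ν z w (proj₁ (∈-allWords⁻ (sum ν) k w∈)))))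

contents-reverse : ∀ k w → reverse (map (λ i → occ ℕₚ._≟_ i w) (upTo k)) ≡ contents k w
contents-reverse zero    w = refl
contents-reverse (suc k) w = trans (cong (reverse ∘ map (λ i → occ ℕₚ._≟_ i w)) (sym (upTo-∷ʳ k)))
  (trans (cong reverse (map-++ (λ i → occ ℕₚ._≟_ i w) (upTo k) (k ∷ [])))
  (trans (reverse-++ (map (λ i → occ ℕₚ._≟_ i w) (upTo k)) (occ ℕₚ._≟_ k w ∷ []))
  (cong (occ ℕₚ._≟_ k w ∷_) (contents-reverse k w))))

hasContent⁺ : ∀ α w → contents (length α) w ≡ reverse α → All (_< length α) w → T (hasContent α w)
hasContent⁺ α w e w< = T-∧⁺ (fromDec (map (λ i → occ ℕₚ._≟_ i w) (upTo (length α)) ≟L α) (reverse-injective (trans (contents-reverse (length α) w) e)))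
                            (fromDec (all? (λ a → a ℕₚ.<? length α) w) w<)
  where
    fromDec : ∀ {P : Set} (d : Dec P) → P → T (does d)
    fromDec (yes _) _ = tt
    fromDec (no ¬p) p = contradiction p ¬p

hasContent⁻ : ∀ α w → T (hasContent α w) → contents (length α) w ≡ reverse α × All (_< length α) w
hasContent⁻ α w t =
  let t₁ , t₂ = T-∧⁻ {does (map (λ i → occ ℕₚ._≟_ i w) (upTo (length α)) ≟L α)} t
  in trans (sym (contents-reverse (length α) w)) (cong reverse (toDec (map (λ i → occ ℕₚ._≟_ i w) (upTo (length α)) ≟L α) t₁))
   , toDec (all? (λ a → a ℕₚ.<? length α) w) t₂
  where
    toDec : ∀ {P : Set} (d : Dec P) → T (does d) → P
    toDec (yes p) _ = p

kostka-fillings : ∀ ν α → ℕ→ℚ (kostka ν α) ≡ fillings (length α) ν (reverse α)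
kostka-fillings ν α = trans (countTrue-Σ (λ w → isSSYT ν w ∧ hasContent α w) (allWords (sum ν) (length α)))
  (Σ-cong-∈ (allWords (sum ν) (length α)) (λ w w∈ → trans (𝟙-∧ (isSSYT ν w) (hasContent α w))
    (cong (𝟙 (T? (isSSYT ν w)) *ℚ_) (𝟙-cong (T? (hasContent α w)) (contents (length α) w ≟L reverse α)
      (proj₁ ∘ hasContent⁻ α w) (λ e → hasContent⁺ α w e (proj₂ (∈-allWords⁻ (sum ν) (length α) w∈)))))))

-- Rearrangements of a word

insertions-map : (f : A → B) (x : A) (ys : List A) → map (map f) (insertions x ys) ≡ insertions (f x) (map f ys)
insertions-map f x []       = refl
insertions-map f x (y ∷ ys) = cong ((f x ∷ f y ∷ map f ys) ∷_)
  (trans (sym (map-∘ (insertions x ys)))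
  (trans (map-∘ {g = f y ∷_} {f = map f} (insertions x ys))
  (cong (map (f y ∷_)) (insertions-map f x ys))))

perms-map : (f : A → B) (xs : List A) → map (map f) (perms xs) ≡ perms (map f xs)
perms-map f []       = refl
perms-map f (x ∷ xs) = trans (go (perms xs)) (cong (concatMap (insertions (f x))) (perms-map f xs))
  where
    go : ∀ yss → map (map f) (concatMap (insertions x) yss) ≡ concatMap (insertions (f x)) (map (map f) yss)
    go []         = refl
    go (ys ∷ yss) = trans (map-++ (map f) (insertions x ys) (concatMap (insertions x) yss)) (cong₂ _++_ (insertions-map f x ys) (go yss))

∈-insertions⇒↭ : ∀ {x : A} ys {zs} → zs ∈ insertions x ys → zs ↭ x ∷ ys
∈-insertions⇒↭ []       (here refl) = ↭-refl
∈-insertions⇒↭ (y ∷ ys) (here refl) = ↭-refl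
∈-insertions⇒↭ {x = x} (y ∷ ys) (there z∈) with ∈-map⁻ (y ∷_) z∈
... | zs , zs∈ , refl = Perm.trans (prep y (∈-insertions⇒↭ ys zs∈)) (swap y x ↭-refl)

∈-perms⇒↭ : ∀ (xs : List A) {p} → p ∈ perms xs → p ↭ xs
∈-perms⇒↭ []       (here refl) = ↭-refl
∈-perms⇒↭ (x ∷ xs) p∈ with find (∈-concatMap⁻ (insertions x) {xs = perms xs} p∈)
... | ys , ys∈ , p∈′ = ↭-trans (∈-insertions⇒↭ ys p∈′) (prep x (∈-perms⇒↭ xs ys∈))

length-insertions : ∀ (x : A) ys → length (insertions x ys) ≡ suc (length ys)
length-insertions x []       = refl
length-insertions x (y ∷ ys) = cong suc (trans (length-map (y ∷_) (insertions x ys)) (length-insertions x ys))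

Σ-perms-1 : ∀ (xs : List A) → Σ (perms xs) (λ _ → 1ℚ) ≡ ℕ→ℚ (length xs !)
Σ-perms-1 []       = refl
Σ-perms-1 (x ∷ xs) = begin
  Σ (perms (x ∷ xs)) (λ _ → 1ℚ)
    ≡⟨ Σ-concatMap (insertions x) (perms xs) ⟩
  Σ (perms xs) (λ ys → Σ (insertions x ys) (λ _ → 1ℚ))
    ≡⟨ Σ-cong-∈ (perms xs) (λ ys ys∈ → trans (Σ-const 1ℚ (insertions x ys)) (cong (λ n → ℕ→ℚ n *ℚ 1ℚ)
         (trans (length-insertions x ys) (cong suc (↭ₚ.↭-length (∈-perms⇒↭ xs ys∈)))))) ⟩
  Σ (perms xs) (λ _ → ℕ→ℚ (suc (length xs)) *ℚ 1ℚ)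
    ≡⟨ Σ-distribˡ (ℕ→ℚ (suc (length xs))) (perms xs) ⟩
  ℕ→ℚ (suc (length xs)) *ℚ Σ (perms xs) (λ _ → 1ℚ)
    ≡⟨ cong (ℕ→ℚ (suc (length xs)) *ℚ_) (Σ-perms-1 xs) ⟩
  ℕ→ℚ (suc (length xs)) *ℚ ℕ→ℚ (length xs !)
    ≡⟨ ℕ→ℚ-* (suc (length xs)) (length xs !) ⟨
  ℕ→ℚ (length (x ∷ xs) !) ∎
  where open ≡-Reasoning

module _ (_≟_ : DecidableEquality A) where

  -- The product of the factorials of the multiplicities.
  fct : List A → ℕ
  fct []       = 1
  fct (x ∷ xs) = occ _≟_ x (x ∷ xs) * fct xs

  _≟ᴸ_ : DecidableEquality (List A)
  _≟ᴸ_ = ≡-dec _≟_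

  removals-of : A → List A → List (List A)
  removals-of x []       = []
  removals-of x (a ∷ v) with x ≟ a
  ... | yes _ = v ∷ map (a ∷_) (removals-of x v)
  ... | no _  = map (a ∷_) (removals-of x v)

  length-removals : ∀ x v → length (removals-of x v) ≡ occ _≟_ x v
  length-removals x []      = refl
  length-removals x (a ∷ v) with x ≟ a
  ... | yes _ = cong suc (trans (length-map (a ∷_) (removals-of x v)) (length-removals x v))
  ... | no _  = trans (length-map (a ∷_) (removals-of x v)) (length-removals x v)

  ∈-removals⇒↭ : ∀ x v {z} → z ∈ removals-of x v → x ∷ z ↭ v
  ∈-removals⇒↭ x (a ∷ v) z∈ with x ≟ a
  ∈-removals⇒↭ x (a ∷ v) (here refl) | yes refl = ↭-refl
  ∈-removals⇒↭ x (a ∷ v) (there z∈)  | yes _    = tail-case x a v z∈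
    where
      tail-case : ∀ x a v {z} → z ∈ map (a ∷_) (removals-of x v) → x ∷ z ↭ a ∷ v
      tail-case x a v z∈ with ∈-map⁻ (a ∷_) z∈
      ... | z , z∈′ , refl = Perm.trans (swap x a ↭-refl) (prep a (∈-removals⇒↭ x v z∈′))
  ∈-removals⇒↭ x (a ∷ v) z∈ | no _ with ∈-map⁻ (a ∷_) z∈
  ... | z , z∈′ , refl = Perm.trans (swap x a ↭-refl) (prep a (∈-removals⇒↭ x v z∈′))

  Σ-removals-∷ : ∀ x a v {F : List A → ℚ} → Σ (removals-of x (a ∷ v)) F ≡ 𝟙 (x ≟ a) *ℚ F v +ℚ Σ (removals-of x v) (λ z → F (a ∷ z))
  Σ-removals-∷ x a v {F} with x ≟ a
  ... | yes _ = cong₂ _+ℚ_ (sym (ℚₚ.*-identityˡ (F v))) (Σ-map (a ∷_) (removals-of x v))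
  ... | no _  = trans (Σ-map (a ∷_) (removals-of x v)) (sym (trans (cong (_+ℚ Σ (removals-of x v) (λ z → F (a ∷ z))) (ℚₚ.*-zeroˡ (F v))) (ℚₚ.+-identityˡ _)))

  𝟙-∷ : ∀ a b (v w : List A) → 𝟙 ((a ∷ v) ≟ᴸ (b ∷ w)) ≡ 𝟙 (a ≟ b) *ℚ 𝟙 (v ≟ᴸ w)
  𝟙-∷ a b v w = trans (𝟙-cong ((a ∷ v) ≟ᴸ (b ∷ w)) ((a ≟ b) ×-dec (v ≟ᴸ w)) ∷-injective (λ { (refl , refl) → refl }))
                      (𝟙-× (a ≟ b) (v ≟ᴸ w))

  𝟙-sym : ∀ a b → 𝟙 (a ≟ b) ≡ 𝟙 (b ≟ a)
  𝟙-sym a b = 𝟙-cong (a ≟ b) (b ≟ a) sym sym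

  -- Inserting x into y so as to obtain v, and deleting an x from v so as to obtain y, are inverse
  -- choices; the multiplicities caused by repeated letters agree.
  insertions-removals : ∀ x y v → Σ (insertions x y) (λ z → 𝟙 (v ≟ᴸ z)) ≡ Σ (removals-of x v) (λ z → 𝟙 (z ≟ᴸ y))
  insertions-removals x []      []      = refl
  insertions-removals x []      (a ∷ v) = trans (ℚₚ.+-identityʳ (𝟙 ((a ∷ v) ≟ᴸ (x ∷ []))))
    (trans (trans (𝟙-∷ a x v []) (cong (_*ℚ 𝟙 (v ≟ᴸ [])) (𝟙-sym a x)))
    (sym (trans (Σ-removals-∷ x a v) (trans (cong (𝟙 (x ≟ a) *ℚ 𝟙 (v ≟ᴸ []) +ℚ_)
      (Σ-zero (removals-of x v) {λ z → 𝟙 ((a ∷ z) ≟ᴸ [])} (λ z _ → refl))) (ℚₚ.+-identityʳ (𝟙 (x ≟ a) *ℚ 𝟙 (v ≟ᴸ [])))))))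
  insertions-removals x (b ∷ y) []      = trans (ℚₚ.+-identityˡ _) (trans (Σ-map (b ∷_) (insertions x y))
    (Σ-zero (insertions x y) {λ z → 𝟙 ([] ≟ᴸ (b ∷ z))} (λ z _ → refl)))
  insertions-removals x (b ∷ y) (a ∷ v) = begin
    𝟙 ((a ∷ v) ≟ᴸ (x ∷ b ∷ y)) +ℚ Σ (map (b ∷_) (insertions x y)) (λ z → 𝟙 ((a ∷ v) ≟ᴸ z))
      ≡⟨ cong₂ _+ℚ_ (trans (𝟙-∷ a x v (b ∷ y)) (cong (_*ℚ 𝟙 (v ≟ᴸ (b ∷ y))) (𝟙-sym a x)))
           (trans (Σ-map (b ∷_) (insertions x y)) (trans (Σ-cong (insertions x y) (λ z → 𝟙-∷ a b v z)) (Σ-distribˡ (𝟙 (a ≟ b)) (insertions x y)))) ⟩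
    𝟙 (x ≟ a) *ℚ 𝟙 (v ≟ᴸ (b ∷ y)) +ℚ 𝟙 (a ≟ b) *ℚ Σ (insertions x y) (λ z → 𝟙 (v ≟ᴸ z))
      ≡⟨ cong (λ s → 𝟙 (x ≟ a) *ℚ 𝟙 (v ≟ᴸ (b ∷ y)) +ℚ 𝟙 (a ≟ b) *ℚ s) (insertions-removals x y v) ⟩
    𝟙 (x ≟ a) *ℚ 𝟙 (v ≟ᴸ (b ∷ y)) +ℚ 𝟙 (a ≟ b) *ℚ Σ (removals-of x v) (λ z → 𝟙 (z ≟ᴸ y))
      ≡⟨ cong (𝟙 (x ≟ a) *ℚ 𝟙 (v ≟ᴸ (b ∷ y)) +ℚ_) (trans (sym (Σ-distribˡ (𝟙 (a ≟ b)) (removals-of x v))) (Σ-cong (removals-of x v) (λ z → sym (𝟙-∷ a b z y)))) ⟩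
    𝟙 (x ≟ a) *ℚ 𝟙 (v ≟ᴸ (b ∷ y)) +ℚ Σ (removals-of x v) (λ z → 𝟙 ((a ∷ z) ≟ᴸ (b ∷ y)))
      ≡⟨ Σ-removals-∷ x a v ⟨
    Σ (removals-of x (a ∷ v)) (λ z → 𝟙 (z ≟ᴸ (b ∷ y))) ∎
    where open ≡-Reasoning

  -- The list `perms w` keeps repetitions: v occurs once for every permutation of positions that
  -- fixes v. In the induction the new factor is the number of ways to delete the letter x from v.
  multiplicity-in-perms : ∀ w v → v ↭ w → Σ (perms w) (λ z → 𝟙 (v ≟ᴸ z)) ≡ ℕ→ℚ (fct w)
  multiplicity-in-perms []      v p with refl ← ↭ₚ.↭-empty-inv p = refl
  multiplicity-in-perms (x ∷ w) v p = begin
    Σ (perms (x ∷ w)) (λ z → 𝟙 (v ≟ᴸ z))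
      ≡⟨ Σ-concatMap (insertions x) (perms w) ⟩
    Σ (perms w) (λ y → Σ (insertions x y) (λ z → 𝟙 (v ≟ᴸ z)))
      ≡⟨ Σ-cong (perms w) (λ y → insertions-removals x y v) ⟩
    Σ (perms w) (λ y → Σ (removals-of x v) (λ z → 𝟙 (z ≟ᴸ y)))
      ≡⟨ Σ-swap (perms w) (removals-of x v) ⟩
    Σ (removals-of x v) (λ z → Σ (perms w) (λ y → 𝟙 (z ≟ᴸ y)))
      ≡⟨ Σ-cong-∈ (removals-of x v) (λ z z∈ → multiplicity-in-perms w z (↭ₚ.drop-∷ (↭-trans (∈-removals⇒↭ x v z∈) p))) ⟩
    Σ (removals-of x v) (λ _ → ℕ→ℚ (fct w))
      ≡⟨ Σ-const (ℕ→ℚ (fct w)) (removals-of x v) ⟩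
    ℕ→ℚ (length (removals-of x v)) *ℚ ℕ→ℚ (fct w)
      ≡⟨ cong (λ n → ℕ→ℚ n *ℚ ℕ→ℚ (fct w)) (trans (length-removals x v) (occ-↭ _≟_ x p)) ⟩
    ℕ→ℚ (occ _≟_ x (x ∷ w)) *ℚ ℕ→ℚ (fct w)
      ≡⟨ ℕ→ℚ-* (occ _≟_ x (x ∷ w)) (fct w) ⟨
    ℕ→ℚ (fct (x ∷ w)) ∎
    where open ≡-Reasoning

  fct-↭ : ∀ {v w} → v ↭ w → fct v ≡ fct w
  fct-↭ Perm.refl = refl
  fct-↭ (prep x p) = cong₂ _*_ (occ-↭ _≟_ x (prep x p)) (fct-↭ p)
  fct-↭ {x ∷ y ∷ v} {_ ∷ _ ∷ w} (swap .x .y p) = trans (exchange v)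
    (cong₂ _*_ (occ-↭ _≟_ y (prep y (prep x p))) (cong₂ _*_ (occ-↭ _≟_ x (prep x p)) (fct-↭ p)))
    where
      exchange : ∀ v → fct (x ∷ y ∷ v) ≡ fct (y ∷ x ∷ v)
      exchange v with x ≟ y
      ... | yes refl = refl
      ... | no x≢y = trans (cong (λ a → a * (occ _≟_ y (y ∷ v) * fct v)) occ-xy)
                     (trans (*-swapˡ (occ _≟_ x (x ∷ v)) (occ _≟_ y (y ∷ v)) (fct v)) (cong (λ b → b * (occ _≟_ x (x ∷ v) * fct v)) (sym occ-yx)))
        where
          occ-xy : occ _≟_ x (x ∷ y ∷ v) ≡ occ _≟_ x (x ∷ v)
          occ-xy = trans (occ-yes _≟_ (y ∷ v) refl) (trans (cong suc (occ-no _≟_ v x≢y)) (sym (occ-yes _≟_ v refl)))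
          occ-yx : occ _≟_ y (y ∷ x ∷ v) ≡ occ _≟_ y (y ∷ v)
          occ-yx = trans (occ-yes _≟_ (x ∷ v) refl) (trans (cong suc (occ-no _≟_ v (≢-sym x≢y))) (sym (occ-yes _≟_ v refl)))
  fct-↭ (Perm.trans p q) = trans (fct-↭ p) (fct-↭ q)

  occ-∈ : ∀ {a} xs → 0 < occ _≟_ a xs → a ∈ xs
  occ-∈ {a} (x ∷ xs) h with a ≟ x
  ... | yes e = here e
  ... | no _  = there (occ-∈ xs h)

  occ-≡⇒↭ : ∀ v w → (∀ a → occ _≟_ a v ≡ occ _≟_ a w) → v ↭ w
  occ-≡⇒↭ []      []      h = ↭-refl
  occ-≡⇒↭ []      (x ∷ w) h = contradiction (trans (h x) (occ-yes _≟_ w refl)) λ ()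
  occ-≡⇒↭ (x ∷ v) w       h with ∈-∃++ (occ-∈ w (subst (0 <_) (trans (sym (occ-yes _≟_ v refl)) (h x)) (s≤s z≤n)))
  ... | ys , zs , refl = ↭-trans (prep x (occ-≡⇒↭ v (ys ++ zs) rest)) (↭-sym (↭ₚ.shift x ys zs))
    where
      cancel : ∀ a → occ _≟_ a (x ∷ v) ≡ occ _≟_ a (x ∷ ys ++ zs)
      cancel a = trans (h a) (occ-↭ _≟_ a (↭ₚ.shift x ys zs))
      rest : ∀ a → occ _≟_ a v ≡ occ _≟_ a (ys ++ zs)
      rest a with a ≟ x
      ... | yes e = ℕₚ.suc-injective (trans (sym (occ-yes _≟_ v e)) (trans (cancel a) (occ-yes _≟_ (ys ++ zs) e)))
      ... | no ≢  = trans (sym (occ-no _≟_ v ≢)) (trans (cancel a) (occ-no _≟_ (ys ++ zs) ≢))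

  occ-∉ : ∀ {a} xs → a ∉ xs → occ _≟_ a xs ≡ 0
  occ-∉ []       a∉ = refl
  occ-∉ (x ∷ xs) a∉ = trans (occ-no _≟_ xs (λ e → a∉ (here e))) (occ-∉ xs (a∉ ∘ there))

  product-!-∷ : ∀ {L} x w → Unique L → x ∈ L →
    product (map (λ b → occ _≟_ b (x ∷ w) !) L) ≡ occ _≟_ x (x ∷ w) * product (map (λ b → occ _≟_ b w !) L)
  product-!-∷ {l ∷ L} x w (l∉ ∷ u) (here refl) = begin
    (occ _≟_ l (l ∷ w) !) * product (map (λ b → occ _≟_ b (l ∷ w) !) L)
      ≡⟨ cong₂ (λ m n → (m !) * n) (occ-yes _≟_ w refl) (unchanged L l∉) ⟩
    (suc (occ _≟_ l w) !) * product (map (λ b → occ _≟_ b w !) L)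
      ≡⟨ ℕₚ.*-assoc (suc (occ _≟_ l w)) (occ _≟_ l w !) _ ⟩
    suc (occ _≟_ l w) * ((occ _≟_ l w !) * product (map (λ b → occ _≟_ b w !) L))
      ≡⟨ cong (_* ((occ _≟_ l w !) * product (map (λ b → occ _≟_ b w !) L))) (occ-yes _≟_ w refl) ⟨
    occ _≟_ l (l ∷ w) * ((occ _≟_ l w !) * product (map (λ b → occ _≟_ b w !) L)) ∎
    where
      open ≡-Reasoning
      unchanged : ∀ L → All (l ≢_) L → product (map (λ b → occ _≟_ b (l ∷ w) !) L) ≡ product (map (λ b → occ _≟_ b w !) L)
      unchanged []      []       = refl
      unchanged (b ∷ L) (≢ ∷ ≢s) = cong₂ (λ m n → (m !) * n) (occ-no _≟_ w (≢-sym ≢)) (unchanged L ≢s)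
  product-!-∷ {l ∷ L} x w (l∉ ∷ u) (there x∈) = trans
    (cong₂ (λ m n → (m !) * n) (occ-no _≟_ w (All.lookup l∉ x∈)) (product-!-∷ x w u x∈))
    (*-swapˡ (occ _≟_ l w !) (occ _≟_ x (x ∷ w)) (product (map (λ b → occ _≟_ b w !) L)))

  -- The recursion of `fct` multiplies 1, 2, ..., m for each letter of multiplicity m. Letters of L
  -- that do not occur in w contribute 0! = 1.
  product-! : ∀ {L} w → Unique L → All (_∈ L) w → product (map (λ b → occ _≟_ b w !) L) ≡ fct w
  product-! {L} []      u []       = ones L
    where
      ones : ∀ L → product (map (λ b → 1) L) ≡ 1
      ones []      = refl
      ones (_ ∷ L) = trans (ℕₚ.+-identityʳ _) (ones L)
  product-! {L} (x ∷ w) u (x∈ ∷ ∈s) = trans (product-!-∷ x w u x∈) (cong (occ _≟_ x (x ∷ w) *_) (product-! w u ∈s))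

contents-injective : ∀ k v w → contents k v ≡ contents k w → ∀ i → i < k → occ ℕₚ._≟_ i v ≡ occ ℕₚ._≟_ i w
contents-injective (suc k) v w e i i<sk with ℕₚ.m≤n⇒m<n∨m≡n (ℕₚ.≤-pred i<sk)
... | inj₁ i<k  = contents-injective k v w (proj₂ (∷-injective e)) i i<k
... | inj₂ refl = proj₁ (∷-injective e)

contents-≡⇒↭ : ∀ k {v w} → All (_< k) v → All (_< k) w → contents k v ≡ contents k w → v ↭ w
contents-≡⇒↭ k {v} {w} v< w< e = occ-≡⇒↭ ℕₚ._≟_ v w λ a → case a (a ℕₚ.<? k)
  where
    case : ∀ a → Dec (a < k) → occ ℕₚ._≟_ a v ≡ occ ℕₚ._≟_ a w
    case a (yes a<k) = contents-injective k v w e a a<k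
    case a (no a≮k)  = trans (occ-none ℕₚ._≟_ (All.map (λ { b<k refl → a≮k b<k }) v<)) (sym (occ-none ℕₚ._≟_ (All.map (λ { b<k refl → a≮k b<k }) w<)))

fctᴺ : Word → ℕ
fctᴺ = fct ℕₚ._≟_

-- Each distinct rearrangement of u occurs `fctᴺ u` times in `perms u`. This is the origin of the
-- factor μ! in (i), since S_λ counts labellings rather than fillings.
Σ-perms : ∀ n k u {F : Word → ℚ} → length u ≡ n → All (_< k) u →
  Σ (perms u) F ≡ ℕ→ℚ (fctᴺ u) *ℚ Σ (allWords n k) (λ v → 𝟙 (contents k v ≟L contents k u) *ℚ F v)
Σ-perms n k u {F} lu u<k = begin
  Σ (perms u) F
    ≡⟨ Σ-cong-∈ (perms u) (λ z z∈ → sym (Σ-pick (_≟L z) (Unique-allWords n k) (in-W z (∈-perms⇒↭ u z∈)) refl (λ _ _ e → e))) ⟩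
  Σ (perms u) (λ z → Σ W (λ v → 𝟙 (v ≟L z) *ℚ F v))
    ≡⟨ Σ-swap (perms u) W ⟩
  Σ W (λ v → Σ (perms u) (λ z → 𝟙 (v ≟L z) *ℚ F v))
    ≡⟨ Σ-cong-∈ W (λ v v∈ → trans (Σ-distribʳ (F v) (perms u)) (trans (cong (_*ℚ F v) (count v v∈)) (regroup (𝟙 (contents k v ≟L contents k u)) (ℕ→ℚ (fctᴺ u)) (F v)))) ⟩
  Σ W (λ v → ℕ→ℚ (fctᴺ u) *ℚ (𝟙 (contents k v ≟L contents k u) *ℚ F v))
    ≡⟨ Σ-distribˡ (ℕ→ℚ (fctᴺ u)) W ⟩
  ℕ→ℚ (fctᴺ u) *ℚ Σ W (λ v → 𝟙 (contents k v ≟L contents k u) *ℚ F v) ∎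
  where
    open ≡-Reasoning
    W = allWords n k
    in-W : ∀ z → z ↭ u → z ∈ W
    in-W z p = ∈-allWords⁺ z (trans (↭ₚ.↭-length p) lu) (↭ₚ.All-resp-↭ (↭-sym p) u<k)
    regroup : ∀ x y z → (x *ℚ y) *ℚ z ≡ y *ℚ (x *ℚ z)
    regroup x y z = trans (cong (_*ℚ z) (ℚₚ.*-comm x y)) (ℚₚ.*-assoc y x z)
    count : ∀ v → v ∈ W → Σ (perms u) (λ z → 𝟙 (v ≟L z)) ≡ 𝟙 (contents k v ≟L contents k u) *ℚ ℕ→ℚ (fctᴺ u)
    count v v∈ =
      [ (λ e → trans (multiplicity-in-perms ℕₚ._≟_ u v (contents-≡⇒↭ k (proj₂ (∈-allWords⁻ n k v∈)) u<k e))
                     (sym (𝟙*-yes (contents k v ≟L contents k u) e)))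
      , (λ e≢ → trans (Σ-zero (perms u) (λ z z∈ → 𝟙-no (v ≟L z) (λ { refl → e≢ (contents-↭ k (∈-perms⇒↭ u z∈)) })))
                      (sym (𝟙*-no (contents k v ≟L contents k u) e≢))) ]′ (toSum (contents k v ≟L contents k u))

map-at-upTo : ∀ w → map (at w) (upTo (length w)) ≡ w
map-at-upTo []      = refl
map-at-upTo (x ∷ w) = cong (x ∷_) (trans (cong (map (at (x ∷ w))) (sym (map-upTo suc (length w))))
  (trans (sym (map-∘ (upTo (length w)))) (map-at-upTo w)))

Scount-length : ∀ ν w → length w ≡ sum ν → Scount ν w ≡ countTrue (λ p → isSSYT ν (map (at w) p)) (perms (upTo (sum ν)))
Scount-length ν w e with length w ℕₚ.≟ sum ν
... | yes _ = refl
... | no l≢ = contradiction e l≢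

Scount-length-≢ : ∀ ν w → length w ≢ sum ν → Scount ν w ≡ 0
Scount-length-≢ ν w l≢ with length w ℕₚ.≟ sum ν
... | yes e = contradiction e l≢
... | no _  = refl

-- Replacing every label k by the letter w_k carries the labellings to the rearrangements of w, with
-- repetitions.
S-perms : ∀ ν w → length w ≡ sum ν → S ν w ≡ Σ (perms w) (λ v → 𝟙 (T? (isSSYT ν v)))
S-perms ν w e = begin
  ℕ→ℚ (Scount ν w)
    ≡⟨ cong ℕ→ℚ (Scount-length ν w e) ⟩
  ℕ→ℚ (countTrue (λ p → isSSYT ν (map (at w) p)) (perms (upTo (sum ν))))
    ≡⟨ countTrue-Σ (λ p → isSSYT ν (map (at w) p)) (perms (upTo (sum ν))) ⟩
  Σ (perms (upTo (sum ν))) (λ p → 𝟙 (T? (isSSYT ν (map (at w) p))))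
    ≡⟨ Σ-map (map (at w)) (perms (upTo (sum ν))) ⟨
  Σ (map (map (at w)) (perms (upTo (sum ν)))) (λ v → 𝟙 (T? (isSSYT ν v)))
    ≡⟨ cong (λ xs → Σ xs (λ v → 𝟙 (T? (isSSYT ν v)))) (trans (perms-map (at w) (upTo (sum ν)))
         (cong perms (trans (cong (map (at w) ∘ upTo) (sym e)) (map-at-upTo w)))) ⟩
  Σ (perms w) (λ v → 𝟙 (T? (isSSYT ν v))) ∎
  where open ≡-Reasoning

S-length-≢ : ∀ ν w → length w ≢ sum ν → S ν w ≡ 0ℚ
S-length-≢ ν w l≢ = cong ℕ→ℚ (Scount-length-≢ ν w l≢)

S-fillings : ∀ ν k w → length w ≡ sum ν → All (_< k) w → S ν w ≡ ℕ→ℚ (fctᴺ w) *ℚ fillings k ν (contents k w)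
S-fillings ν k w lw w<k = trans (S-perms ν w lw) (trans (Σ-perms (sum ν) k w lw w<k)
  (cong (ℕ→ℚ (fctᴺ w) *ℚ_) (Σ-cong (allWords (sum ν) k) (λ v → ℚₚ.*-comm (𝟙 (contents k v ≟L contents k w)) (𝟙 (T? (isSSYT ν v)))))))

-- The Cauchy identity for the S_λ

-- A partial bijection between two alphabets, given by its graph. Renaming a word is then a
-- `Pointwise` relation, and no value has to be chosen for letters that do not occur.
BiUnique : (A → B → Set) → Set
BiUnique R = (∀ {a b b′} → R a b → R a b′ → b ≡ b′) × (∀ {a a′ b} → R a b → R a′ b → a ≡ a′)

module _ (_≟ᵃ_ : DecidableEquality A) (_≟ᵇ_ : DecidableEquality B) {R : A → B → Set} (bi : BiUnique R) where

  occ-relabel : ∀ {a b xs ys} → R a b → Pointwise R xs ys → occ _≟ᵃ_ a xs ≡ occ _≟ᵇ_ b ys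
  occ-relabel r [] = refl
  occ-relabel {a} {b} {x ∷ xs} {y ∷ ys} r (r′ ∷ rs) with a ≟ᵃ x | b ≟ᵇ y
  ... | yes _    | yes _    = cong suc (occ-relabel r rs)
  ... | yes refl | no ≢     = contradiction (proj₁ bi r r′) ≢
  ... | no ≢     | yes refl = contradiction (proj₂ bi r r′) ≢
  ... | no _     | no _     = occ-relabel r rs

  fct-relabel : ∀ {xs ys} → Pointwise R xs ys → fct _≟ᵃ_ xs ≡ fct _≟ᵇ_ ys
  fct-relabel []       = refl
  fct-relabel (r ∷ rs) = cong₂ _*_ (occ-relabel r (r ∷ rs)) (fct-relabel rs)

fct-++ : (_≟_ : DecidableEquality A) (xs ys : List A) → Disjoint xs ys → fct _≟_ (xs ++ ys) ≡ fct _≟_ xs * fct _≟_ ys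
fct-++ _≟_ []       ys d = sym (ℕₚ.+-identityʳ _)
fct-++ _≟_ (x ∷ xs) ys d = trans (cong₂ _*_
    (trans (occ-++ _≟_ x (x ∷ xs) ys) (trans (cong (occ _≟_ x (x ∷ xs) +_) (occ-∉ _≟_ ys (λ x∈ → d (here refl , x∈)))) (ℕₚ.+-identityʳ _)))
    (fct-++ _≟_ xs ys (λ { (p , q) → d (there p , q) })))
  (sym (ℕₚ.*-assoc (occ _≟_ x (x ∷ xs)) (fct _≟_ xs) (fct _≟_ ys)))

fct-replicate : (_≟_ : DecidableEquality A) (a : A) (n : ℕ) → fct _≟_ (replicate n a) ≡ n !
fct-replicate _≟_ a zero    = refl
fct-replicate _≟_ a (suc n) = cong₂ _*_ (occ-replicate _≟_ a (suc n)) (fct-replicate _≟_ a n)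

-- Multiplicities of pairs of letters, and matrices

fctᴾ : List (ℕ × ℕ) → ℕ
fctᴾ = fct (×-≡-dec ℕₚ._≟_ ℕₚ._≟_)

-- The weakly decreasing word with contents γ. The block of its largest letter comes first, ready to
-- be split off.
realize : List ℕ → Word
realize []      = []
realize (g ∷ γ) = replicate g (length γ) ++ realize γ

realize-< : ∀ γ → All (_< length γ) (realize γ)
realize-< []      = []
realize-< (g ∷ γ) = Allₚ.++⁺ (Allₚ.replicate⁺ g ℕₚ.≤-refl) (All.map ℕₚ.m≤n⇒m≤1+n (realize-< γ))

length-realize : ∀ γ → length (realize γ) ≡ sum γ
length-realize []      = refl
length-realize (g ∷ γ) = trans (length-++ (replicate g (length γ))) (cong₂ _+_ (length-replicate g) (length-realize γ))

contents-realize : ∀ γ → contents (length γ) (realize γ) ≡ γ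
contents-realize []      = refl
contents-realize (g ∷ γ) = trans (contents-↭ (suc (length γ)) (↭ₚ.++-comm (replicate g (length γ)) (realize γ)))
  (trans (contents-pad (length γ) (realize γ) g (realize-< γ)) (cong (g ∷_) (contents-realize γ)))

↭-realize : ∀ k w → All (_< k) w → w ↭ realize (contents k w)
↭-realize k w w<k = contents-≡⇒↭ k w<k (subst (λ n → All (_< n) (realize (contents k w))) (length-contents k w) (realize-< (contents k w)))
  (sym (subst (λ n → contents n (realize (contents k w)) ≡ contents k w) (length-contents k w) (contents-realize (contents k w))))

sum-contents : ∀ k w → All (_< k) w → sum (contents k w) ≡ length w
sum-contents k w w<k = trans (sym (length-realize (contents k w))) (sym (↭ₚ.↭-length (↭-realize k w w<k)))

fct-realize : ∀ γ → fctᴺ (realize γ) ≡ product (map _! γ)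
fct-realize []      = refl
fct-realize (g ∷ γ) = trans (fct-++ ℕₚ._≟_ (replicate g (length γ)) (realize γ) disjoint)
  (cong₂ _*_ (fct-replicate ℕₚ._≟_ (length γ) g) (fct-realize γ))
  where
    disjoint : Disjoint (replicate g (length γ)) (realize γ)
    disjoint (p , q) = ℕₚ.<⇒≢ (All.lookup (realize-< γ) q) (All.lookup (Allₚ.replicate⁺ {P = λ x → x ≡ length γ} g refl) p)

-- All words with contents γ share one value of `fctᴺ`, and their number is b! divided by it. This
-- is `Σ-perms` for a representative and the constant 1.
Σ-multinomial : ∀ k b γ → length γ ≡ k →
  Σ (allWords b k) (λ v → ℕ→ℚ (fctᴺ v) *ℚ 𝟙 (contents k v ≟L γ)) ≡ ℕ→ℚ (b !) *ℚ 𝟙 (sum γ ℕₚ.≟ b)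
Σ-multinomial k b γ refl = [ realizable , unrealizable ]′ (toSum (sum γ ℕₚ.≟ b))
  where
    open ≡-Reasoning
    unrealizable : sum γ ≢ b → Σ (allWords b k) (λ v → ℕ→ℚ (fctᴺ v) *ℚ 𝟙 (contents k v ≟L γ)) ≡ ℕ→ℚ (b !) *ℚ 𝟙 (sum γ ℕₚ.≟ b)
    unrealizable s≢ = trans (Σ-zero (allWords b k) (λ v v∈ → *𝟙-no (contents k v ≟L γ) (ℕ→ℚ (fctᴺ v))
        (λ e → s≢ (trans (cong sum (sym e)) (trans (sum-contents k v (proj₂ (∈-allWords⁻ b k v∈))) (proj₁ (∈-allWords⁻ b k v∈)))))))
      (sym (*𝟙-no (sum γ ℕₚ.≟ b) (ℕ→ℚ (b !)) s≢))
    realizable : sum γ ≡ b → Σ (allWords b k) (λ v → ℕ→ℚ (fctᴺ v) *ℚ 𝟙 (contents k v ≟L γ)) ≡ ℕ→ℚ (b !) *ℚ 𝟙 (sum γ ℕₚ.≟ b)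
    realizable refl = begin
      Σ (allWords b k) (λ v → ℕ→ℚ (fctᴺ v) *ℚ 𝟙 (contents k v ≟L γ))
        ≡⟨ Σ-cong-∈ (allWords b k) (λ v v∈ → trans (ℚₚ.*-comm (ℕ→ℚ (fctᴺ v)) (𝟙 (contents k v ≟L γ)))
             (trans (𝟙*-cong (contents k v ≟L γ) (λ e → trans
               (cong ℕ→ℚ (fct-↭ ℕₚ._≟_ (contents-≡⇒↭ k (proj₂ (∈-allWords⁻ b k v∈)) (realize-< γ) (trans e (sym (contents-realize γ))))))
               (sym (ℚₚ.*-identityʳ c)))) (*ℚ-swapˡ (𝟙 (contents k v ≟L γ)) c 1ℚ))) ⟩
      Σ (allWords b k) (λ v → c *ℚ (𝟙 (contents k v ≟L γ) *ℚ 1ℚ))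
        ≡⟨ Σ-distribˡ c (allWords b k) ⟩
      c *ℚ Σ (allWords b k) (λ v → 𝟙 (contents k v ≟L γ) *ℚ 1ℚ)
        ≡⟨ cong (λ δ → c *ℚ Σ (allWords b k) (λ v → 𝟙 (contents k v ≟L δ) *ℚ 1ℚ)) (sym (contents-realize γ)) ⟩
      c *ℚ Σ (allWords b k) (λ v → 𝟙 (contents k v ≟L contents k (realize γ)) *ℚ 1ℚ)
        ≡⟨ Σ-perms b k (realize γ) {λ _ → 1ℚ} (length-realize γ) (realize-< γ) ⟨
      Σ (perms (realize γ)) (λ _ → 1ℚ)
        ≡⟨ trans (Σ-perms-1 (realize γ)) (cong (λ n → ℕ→ℚ (n !)) (length-realize γ)) ⟩
      ℕ→ℚ (b !)
        ≡⟨ *𝟙-yes (sum γ ℕₚ.≟ b) (ℕ→ℚ (b !)) refl ⟨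
      ℕ→ℚ (b !) *ℚ 𝟙 (sum γ ℕₚ.≟ b) ∎
      where c = ℕ→ℚ (fctᴺ (realize γ))

_⊕_ : List ℕ → List ℕ → List ℕ
_⊕_ = zipWith _+_

contents-++ : ∀ k v w → contents k (v ++ w) ≡ contents k v ⊕ contents k w
contents-++ zero    v w = refl
contents-++ (suc k) v w = cong₂ _∷_ (occ-++ ℕₚ._≟_ k v w) (contents-++ k v w)

complement : ∀ c α → Sub c α → ∃ λ γ → length γ ≡ length α × γ ⊕ c ≡ α × sum c + sum γ ≡ sum α ×
             (∀ δ → length δ ≡ length α → δ ⊕ c ≡ α → δ ≡ γ)
complement []      []      _ = [] , refl , refl , refl , λ { [] _ _ → refl }
complement (x ∷ c) (y ∷ α) (x≤y , s) with complement c α s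
... | γ , lγ , e , se , uniq = (y ℕ.∸ x) ∷ γ , cong suc lγ , cong₂ _∷_ (ℕₚ.m∸n+n≡m x≤y) e , sums , uniq′
  where
    sums : (x + sum c) + ((y ℕ.∸ x) + sum γ) ≡ y + sum α
    sums = trans (+-interchange x (sum c) (y ℕ.∸ x) (sum γ)) (cong₂ _+_ (ℕₚ.m+[n∸m]≡n x≤y) se)
    uniq′ : ∀ δ → length δ ≡ suc (length α) → δ ⊕ (x ∷ c) ≡ y ∷ α → δ ≡ (y ℕ.∸ x) ∷ γ
    uniq′ (d ∷ δ) l e′ = let e₁ , e₂ = ∷-injective e′ in
      cong₂ _∷_ (trans (sym (ℕₚ.m+n∸n≡m d x)) (cong (ℕ._∸ x) e₁)) (uniq δ (ℕₚ.suc-injective l) e₂)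

⊕⇒Sub : ∀ δ c α → length δ ≡ length α → length c ≡ length α → δ ⊕ c ≡ α → Sub c α
⊕⇒Sub []      []      []      _ _ _ = tt
⊕⇒Sub (d ∷ δ) (x ∷ c) (y ∷ α) l l′ e = let e₁ , e₂ = ∷-injective e in
  ℕₚ.≤-trans (ℕₚ.m≤n+m x d) (ℕₚ.≤-reflexive e₁) , ⊕⇒Sub δ c α (ℕₚ.suc-injective l) (ℕₚ.suc-injective l′) e₂

-- The guard fixes the contents of v as the entrywise difference α - c, which exists exactly when c
-- ≤ α entrywise and has sum b exactly when the sizes match.
Σ-multinomial-⊕ : ∀ k b c α → length α ≡ k → length c ≡ k →
  Σ (allWords b k) (λ v → ℕ→ℚ (fctᴺ v) *ℚ 𝟙 ((contents k v ⊕ c) ≟L α)) ≡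
  ℕ→ℚ (b !) *ℚ 𝟙 (sub? c α ×-dec (sum c + b ℕₚ.≟ sum α))
Σ-multinomial-⊕ k b c α refl lc = [ within , outside ]′ (toSum (sub? c α))
  where
    goal : Set
    goal = Σ (allWords b k) (λ v → ℕ→ℚ (fctᴺ v) *ℚ 𝟙 ((contents k v ⊕ c) ≟L α)) ≡ ℕ→ℚ (b !) *ℚ 𝟙 (sub? c α ×-dec (sum c + b ℕₚ.≟ sum α))
    outside : ¬ Sub c α → goal
    outside ¬s = trans (Σ-zero (allWords b k) (λ v _ → *𝟙-no ((contents k v ⊕ c) ≟L α) (ℕ→ℚ (fctᴺ v))
        (λ e → ¬s (⊕⇒Sub (contents k v) c α (length-contents k v) lc e))))
      (sym (*𝟙-no (sub? c α ×-dec (sum c + b ℕₚ.≟ sum α)) (ℕ→ℚ (b !)) (¬s ∘ proj₁)))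
    within : Sub c α → goal
    within s = let γ , lγ , e , se , uniq = complement c α s in trans
      (Σ-cong (allWords b k) (λ v → cong (ℕ→ℚ (fctᴺ v) *ℚ_) (𝟙-cong ((contents k v ⊕ c) ≟L α) (contents k v ≟L γ)
        (uniq (contents k v) (length-contents k v)) (λ e′ → trans (cong (_⊕ c) e′) e))))
      (trans (Σ-multinomial k b γ lγ) (cong (ℕ→ℚ (b !) *ℚ_) (𝟙-cong (sum γ ℕₚ.≟ b) (sub? c α ×-dec (sum c + b ℕₚ.≟ sum α))
        (λ e′ → s , trans (cong (sum c +_) (sym e′)) se) (λ { (_ , e′) → ℕₚ.+-cancelˡ-≡ (sum c) (sum γ) b (trans se (sym e′)) }))))

-- Permuting the positions of w and v together permutes the list of pairs, and the set of all words
-- v is stable under permutations of positions.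
Σ-zip-↭ : ∀ k {w w′} {F : List (ℕ × ℕ) → ℚ} → (∀ {x y} → x ↭ y → F x ≡ F y) → w ↭ w′ →
  Σ (allWords (length w) k) (λ v → F (zip w v)) ≡ Σ (allWords (length w′) k) (λ v → F (zip w′ v))
Σ-zip-↭ k h Perm.refl = refl
Σ-zip-↭ k {F = F} h (prep {xs} {ys} x p) = trans (allWords-Σ (length xs) k) (trans
  (Σ-cong (upTo k) (λ a → Σ-zip-↭ k {F = λ z → F ((x , a) ∷ z)} (h ∘ prep (x , a)) p)) (sym (allWords-Σ (length ys) k)))
Σ-zip-↭ k {F = F} h (swap {xs} {ys} x y p) = begin
  Σ (allWords (suc (suc (length xs))) k) (λ v → F (zip (x ∷ y ∷ xs) v))
    ≡⟨ trans (allWords-Σ (suc (length xs)) k) (Σ-cong (upTo k) (λ a → allWords-Σ (length xs) k)) ⟩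
  Σ (upTo k) (λ a → Σ (upTo k) (λ b → Σ (allWords (length xs) k) (λ v → F ((x , a) ∷ (y , b) ∷ zip xs v))))
    ≡⟨ Σ-cong (upTo k) (λ a → Σ-cong (upTo k) (λ b → trans (Σ-cong (allWords (length xs) k) (λ v → h (swap (x , a) (y , b) ↭-refl)))
         (Σ-zip-↭ k {F = λ z → F ((y , b) ∷ (x , a) ∷ z)} (h ∘ prep (y , b) ∘ prep (x , a)) p))) ⟩
  Σ (upTo k) (λ a → Σ (upTo k) (λ b → Σ (allWords (length ys) k) (λ v → F ((y , b) ∷ (x , a) ∷ zip ys v))))
    ≡⟨ Σ-swap (upTo k) (upTo k) ⟩
  Σ (upTo k) (λ b → Σ (upTo k) (λ a → Σ (allWords (length ys) k) (λ v → F ((y , b) ∷ (x , a) ∷ zip ys v))))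
    ≡⟨ trans (allWords-Σ (suc (length ys)) k) (Σ-cong (upTo k) (λ b → allWords-Σ (length ys) k)) ⟨
  Σ (allWords (suc (suc (length ys))) k) (λ v → F (zip (y ∷ x ∷ ys) v)) ∎
  where open ≡-Reasoning
Σ-zip-↭ k h (Perm.trans p q) = trans (Σ-zip-↭ k h p) (Σ-zip-↭ k h q)

map-proj₂-zip : ∀ (w v : Word) → length w ≡ length v → map proj₂ (zip w v) ≡ v
map-proj₂-zip []      []      _ = refl
map-proj₂-zip (x ∷ w) (y ∷ v) l = cong (y ∷_) (map-proj₂-zip w v (ℕₚ.suc-injective l))

zip-++ : ∀ (w w′ v v′ : Word) → length w ≡ length v → zip (w ++ w′) (v ++ v′) ≡ zip w v ++ zip w′ v′
zip-++ []      w′ []      v′ _ = refl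
zip-++ (x ∷ w) w′ (y ∷ v) v′ l = cong ((x , y) ∷_) (zip-++ w w′ v v′ (ℕₚ.suc-injective l))

∈-zip⇒∈ˡ : ∀ (w v : Word) {p} → p ∈ zip w v → proj₁ p ∈ w
∈-zip⇒∈ˡ (x ∷ w) (y ∷ v) (here refl) = here refl
∈-zip⇒∈ˡ (x ∷ w) (y ∷ v) (there p)   = there (∈-zip⇒∈ˡ w v p)

fct-zip-replicate : ∀ l v → fctᴾ (zip (replicate (length v) l) v) ≡ fctᴺ v
fct-zip-replicate l v = fct-relabel _ ℕₚ._≟_ {λ p a → p ≡ (l , a)} ((λ { refl refl → refl }) , (λ { refl refl → refl })) (go v)
  where
    go : ∀ v → Pointwise (λ p a → p ≡ (l , a)) (zip (replicate (length v) l) v) v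
    go []      = []
    go (a ∷ v) = refl ∷ go v

-- Sum of the coefficients at w of the functions h_{ker v} over the words v with contents α.
pairs : ℕ → Word → List ℕ → ℚ
pairs k w α = Σ (allWords (length w) k) (λ v → 𝟙 (contents k v ≟L α) *ℚ ℕ→ℚ (fctᴾ (zip w v)))

pairs-↭ : ∀ k {w w′} α → w ↭ w′ → pairs k w α ≡ pairs k w′ α
pairs-↭ k {w} {w′} α p = trans (to w) (trans (Σ-zip-↭ k {F = F} inv p) (sym (to w′)))
  where
    F : List (ℕ × ℕ) → ℚ
    F z = 𝟙 (contents k (map proj₂ z) ≟L α) *ℚ ℕ→ℚ (fctᴾ z)
    inv : ∀ {x y} → x ↭ y → F x ≡ F y
    inv q = cong₂ (λ c f → 𝟙 (c ≟L α) *ℚ ℕ→ℚ f) (contents-↭ k (↭ₚ.map⁺ proj₂ q)) (fct-↭ _ q)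
    to : ∀ w → pairs k w α ≡ Σ (allWords (length w) k) (λ v → F (zip w v))
    to w = Σ-cong-∈ (allWords (length w) k) (λ v v∈ → cong (λ u → 𝟙 (contents k u ≟L α) *ℚ ℕ→ℚ (fctᴾ (zip w v)))
      (sym (map-proj₂-zip w v (sym (proj₁ (∈-allWords⁻ (length w) k v∈))))))

-- Pairs over the block of letters l differ from all other pairs, so the product of factorials
-- splits. Summed over the letters of v at those positions, with contents α - α′, the first factor
-- gives b! for each admissible α′.
pairs-peel : ∀ k B l b w α → length α ≡ k → All (_< B) α → All (_< l) w →
  pairs k (replicate b l ++ w) α ≡
  ℕ→ℚ (b !) *ℚ Σ (allWords k B) (λ α′ → 𝟙 (sub? α′ α ×-dec (sum α′ + b ℕₚ.≟ sum α)) *ℚ pairs k w α′)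
pairs-peel k B l b w α lα α<B w<l = begin
  pairs k (replicate b l ++ w) α
    ≡⟨ cong (λ n → Σ (allWords n k) (λ v → 𝟙 (contents k v ≟L α) *ℚ ℕ→ℚ (fctᴾ (zip (replicate b l ++ w) v))))
         (trans (length-++ (replicate b l)) (cong (_+ length w) (length-replicate b))) ⟩
  Σ (allWords (b + length w) k) (λ v → 𝟙 (contents k v ≟L α) *ℚ ℕ→ℚ (fctᴾ (zip (replicate b l ++ w) v)))
    ≡⟨ allWords-++-Σ b (length w) k ⟩
  Σ (allWords b k) (λ v → Σ V (λ v′ → 𝟙 (contents k (v ++ v′) ≟L α) *ℚ ℕ→ℚ (fctᴾ (zip (replicate b l ++ w) (v ++ v′)))))
    ≡⟨ Σ-cong-∈ (allWords b k) (λ v v∈ → Σ-cong V (λ v′ → factor v v′ (proj₁ (∈-allWords⁻ b k v∈)))) ⟩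
  Σ (allWords b k) (λ v → Σ V (λ v′ → (ℕ→ℚ (fctᴺ v) *ℚ 𝟙 ((contents k v ⊕ contents k v′) ≟L α)) *ℚ ℕ→ℚ (fctᴾ (zip w v′))))
    ≡⟨ Σ-swap (allWords b k) V ⟩
  Σ V (λ v′ → Σ (allWords b k) (λ v → (ℕ→ℚ (fctᴺ v) *ℚ 𝟙 ((contents k v ⊕ contents k v′) ≟L α)) *ℚ ℕ→ℚ (fctᴾ (zip w v′))))
    ≡⟨ Σ-cong V (λ v′ → trans (Σ-distribʳ (ℕ→ℚ (fctᴾ (zip w v′))) (allWords b k))
         (trans (cong (_*ℚ ℕ→ℚ (fctᴾ (zip w v′))) (Σ-multinomial-⊕ k b (contents k v′) α lα (length-contents k v′)))
         (trans (ℚₚ.*-assoc (ℕ→ℚ (b !)) (𝟙 (sm (contents k v′))) (ℕ→ℚ (fctᴾ (zip w v′))))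
         (cong (ℕ→ℚ (b !) *ℚ_) (expand v′))))) ⟩
  Σ V (λ v′ → ℕ→ℚ (b !) *ℚ Σ W (λ α′ → 𝟙 (contents k v′ ≟L α′) *ℚ (𝟙 (sm α′) *ℚ ℕ→ℚ (fctᴾ (zip w v′)))))
    ≡⟨ trans (Σ-distribˡ (ℕ→ℚ (b !)) V) (cong (ℕ→ℚ (b !) *ℚ_) (Σ-swap V W)) ⟩
  ℕ→ℚ (b !) *ℚ Σ W (λ α′ → Σ V (λ v′ → 𝟙 (contents k v′ ≟L α′) *ℚ (𝟙 (sm α′) *ℚ ℕ→ℚ (fctᴾ (zip w v′)))))
    ≡⟨ cong (ℕ→ℚ (b !) *ℚ_) (Σ-cong W (λ α′ → trans
         (Σ-cong V (λ v′ → *ℚ-swapˡ (𝟙 (contents k v′ ≟L α′)) (𝟙 (sm α′)) (ℕ→ℚ (fctᴾ (zip w v′)))))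
         (Σ-distribˡ (𝟙 (sm α′)) V))) ⟩
  ℕ→ℚ (b !) *ℚ Σ W (λ α′ → 𝟙 (sm α′) *ℚ pairs k w α′) ∎
  where
    open ≡-Reasoning
    V = allWords (length w) k
    W = allWords k B
    sm = λ α′ → sub? α′ α ×-dec (sum α′ + b ℕₚ.≟ sum α)
    Sub-< : ∀ {x y} → Sub x y → All (_< B) y → length x ≡ length y × All (_< B) x
    Sub-< {[]}    {[]}    _       _         = refl , []
    Sub-< {_ ∷ _} {_ ∷ _} (h , s) (y< ∷ ys<) = let l , xs< = Sub-< s ys< in cong suc l , ℕₚ.≤-<-trans h y< ∷ xs<
    expand : ∀ v′ → 𝟙 (sm (contents k v′)) *ℚ ℕ→ℚ (fctᴾ (zip w v′)) ≡
             Σ W (λ α′ → 𝟙 (contents k v′ ≟L α′) *ℚ (𝟙 (sm α′) *ℚ ℕ→ℚ (fctᴾ (zip w v′))))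
    expand v′ =
      [ (λ { (s , _) → sym (Σ-pick (contents k v′ ≟L_) {f = λ α′ → 𝟙 (sm α′) *ℚ ℕ→ℚ (fctᴾ (zip w v′))} (Unique-allWords k B)
          (∈-allWords⁺ (contents k v′) (length-contents k v′) (proj₂ (Sub-< s α<B))) refl (λ _ _ → sym)) })
      , (λ ¬sm → trans (𝟙*-no (sm (contents k v′)) ¬sm) (sym (Σ-zero W (λ α′ _ →
          𝟙*-zero (contents k v′ ≟L α′) (λ { refl → 𝟙*-no (sm α′) ¬sm }))))) ]′ (toSum (sm (contents k v′)))
    factor : ∀ v v′ → length v ≡ b →
      𝟙 (contents k (v ++ v′) ≟L α) *ℚ ℕ→ℚ (fctᴾ (zip (replicate b l ++ w) (v ++ v′))) ≡
      (ℕ→ℚ (fctᴺ v) *ℚ 𝟙 ((contents k v ⊕ contents k v′) ≟L α)) *ℚ ℕ→ℚ (fctᴾ (zip w v′))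
    factor v v′ refl = begin
      𝟙 (contents k (v ++ v′) ≟L α) *ℚ ℕ→ℚ (fctᴾ (zip (replicate b l ++ w) (v ++ v′)))
        ≡⟨ cong₂ (λ c f → 𝟙 (c ≟L α) *ℚ ℕ→ℚ f) (contents-++ k v v′) (trans (cong fctᴾ (zip-++ (replicate b l) w v v′ (length-replicate b)))
             (trans (fct-++ _ (zip (replicate b l) v) (zip w v′) disjoint) (cong (_* fctᴾ (zip w v′)) (fct-zip-replicate l v)))) ⟩
      i *ℚ ℕ→ℚ (fctᴺ v * fctᴾ (zip w v′))
        ≡⟨ cong (i *ℚ_) (ℕ→ℚ-* (fctᴺ v) (fctᴾ (zip w v′))) ⟩
      i *ℚ (ℕ→ℚ (fctᴺ v) *ℚ ℕ→ℚ (fctᴾ (zip w v′)))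
        ≡⟨ *ℚ-swapˡ i (ℕ→ℚ (fctᴺ v)) (ℕ→ℚ (fctᴾ (zip w v′))) ⟩
      ℕ→ℚ (fctᴺ v) *ℚ (i *ℚ ℕ→ℚ (fctᴾ (zip w v′)))
        ≡⟨ ℚₚ.*-assoc (ℕ→ℚ (fctᴺ v)) i (ℕ→ℚ (fctᴾ (zip w v′))) ⟨
      (ℕ→ℚ (fctᴺ v) *ℚ i) *ℚ ℕ→ℚ (fctᴾ (zip w v′)) ∎
      where
        i = 𝟙 ((contents k v ⊕ contents k v′) ≟L α)
        disjoint : Disjoint (zip (replicate b l) v) (zip w v′)
        disjoint (p , q) = ℕₚ.<⇒≢ (All.lookup w<l (∈-zip⇒∈ˡ w v′ q))
          (All.lookup (Allₚ.replicate⁺ {P = λ x → x ≡ l} b refl) (∈-zip⇒∈ˡ (replicate b l) v p))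

-- The multiplicities m_ij of the pairs form a matrix with sums β and α. It arises from ∏ β_i! / ∏
-- m_ij! words v, each of weight ∏ m_ij!, so every matrix contributes the same ∏ β_i!.
pairs-matrices : ∀ k B β α → length α ≡ k → All (_< B) α →
  pairs k (realize β) α ≡ ℕ→ℚ (product (map _! β)) *ℚ matrices B α β
pairs-matrices k B []      α refl α<B = trans (ℚₚ.+-identityʳ _) (trans (ℚₚ.*-identityʳ (𝟙 (contents k [] ≟L α)))
  (trans (𝟙-cong (contents k [] ≟L α) (sum α ℕₚ.≟ 0) (λ e → trans (cong sum (sym e)) (sum-contents k [] []))
    (λ e → sum≡0-unique (contents k []) α (length-contents k []) (sum-contents k [] []) e)) (sym (ℚₚ.*-identityˡ _))))
pairs-matrices k B (b ∷ β) α refl α<B = begin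
  pairs k (replicate b (length β) ++ realize β) α
    ≡⟨ pairs-peel k B (length β) b (realize β) α refl α<B (realize-< β) ⟩
  ℕ→ℚ (b !) *ℚ Σ W (λ α′ → 𝟙 (sm α′) *ℚ pairs k (realize β) α′)
    ≡⟨ cong (ℕ→ℚ (b !) *ℚ_) (Σ-cong-∈ W (λ α′ α′∈ → trans
         (cong (𝟙 (sm α′) *ℚ_) (pairs-matrices k B β α′ (proj₁ (∈-allWords⁻ k B α′∈)) (proj₂ (∈-allWords⁻ k B α′∈))))
         (*ℚ-swapˡ (𝟙 (sm α′)) c (matrices B α′ β)))) ⟩
  ℕ→ℚ (b !) *ℚ Σ W (λ α′ → c *ℚ (𝟙 (sm α′) *ℚ matrices B α′ β))
    ≡⟨ cong (ℕ→ℚ (b !) *ℚ_) (Σ-distribˡ c W) ⟩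
  ℕ→ℚ (b !) *ℚ (c *ℚ matrices B α (b ∷ β))
    ≡⟨ ℚₚ.*-assoc (ℕ→ℚ (b !)) c (matrices B α (b ∷ β)) ⟨
  (ℕ→ℚ (b !) *ℚ c) *ℚ matrices B α (b ∷ β)
    ≡⟨ cong (_*ℚ matrices B α (b ∷ β)) (ℕ→ℚ-* (b !) (product (map _! β))) ⟨
  ℕ→ℚ (product (map _! (b ∷ β))) *ℚ matrices B α (b ∷ β) ∎
  where
    open ≡-Reasoning
    W = allWords (length α) B
    sm = λ α′ → sub? α′ α ×-dec (sum α′ + b ℕₚ.≟ sum α)
    c = ℕ→ℚ (product (map _! β))

-- Partitions of n inside the box of padded lists

∈-partitionsOf⁻ : ∀ n {ν} → ν ∈ partitionsOf n → ν ⊢ n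
∈-partitionsOf⁻ n ν∈ = proj₂ (∈-filter⁻ (λ μ → isPartition? μ ×-dec (sum μ ℕₚ.≟ n)) {xs = concatMap (λ ℓ → allWords ℓ (suc n)) (upTo (suc n))} ν∈)

length≤sum : ∀ ν → All (0 <_) ν → length ν ≤ sum ν
length≤sum []      []         = z≤n
length≤sum (x ∷ ν) (x>0 ∷ ν>0) = ℕₚ.+-mono-≤ x>0 (length≤sum ν ν>0)

All≤sum : ∀ ν {n} → sum ν ≤ n → All (_< suc n) ν
All≤sum []      h = []
All≤sum (x ∷ ν) h = s≤s (ℕₚ.≤-trans (ℕₚ.m≤m+n x (sum ν)) h) ∷ All≤sum ν (ℕₚ.≤-trans (ℕₚ.m≤n+m (sum ν) x) h)

∈-partitionsOf⁺ : ∀ n {ν} → ν ⊢ n → ν ∈ partitionsOf n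
∈-partitionsOf⁺ n {ν} p@((_ , ν>0) , sν) = ∈-filter⁺ (λ μ → isPartition? μ ×-dec (sum μ ℕₚ.≟ n))
  (∈-concatMap⁺ (λ ℓ → allWords ℓ (suc n)) {xs = upTo (suc n)} (lose
    (∈-upTo⁺ (s≤s (ℕₚ.≤-trans (length≤sum ν ν>0) (ℕₚ.≤-reflexive sν)))) (∈-allWords⁺ ν refl (All≤sum ν (ℕₚ.≤-reflexive sν))))) p

Unique-partitionsOf : ∀ n → Unique (partitionsOf n)
Unique-partitionsOf n = Uniqueₚ.filter⁺ (λ μ → isPartition? μ ×-dec (sum μ ℕₚ.≟ n)) (go (upTo (suc n)) (Uniqueₚ.upTo⁺ (suc n)))
  where
    go : ∀ ls → Unique ls → Unique (concatMap (λ ℓ → allWords ℓ (suc n)) ls)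
    go []       _         = []
    go (ℓ ∷ ls) (ℓ∉ ∷ u) = Uniqueₚ.++⁺ (Unique-allWords ℓ (suc n)) (go ls u) disjoint
      where
        disjoint : Disjoint (allWords ℓ (suc n)) (concatMap (λ ℓ → allWords ℓ (suc n)) ls)
        disjoint (p , q) with find (∈-concatMap⁻ (λ ℓ → allWords ℓ (suc n)) {xs = ls} q)
        ... | m , m∈ , q′ = All.lookup ℓ∉ m∈ (trans (sym (proj₁ (∈-allWords⁻ ℓ (suc n) p))) (proj₁ (∈-allWords⁻ m (suc n) q′)))

strip : List ℕ → List ℕ
strip = filter (0 ℕₚ.<?_)

strip-pad : ∀ ℓ ν → All (0 <_) ν → strip (pad ℓ ν) ≡ ν
strip-pad ℓ ν ν>0 = trans (filter-++ (0 ℕₚ.<?_) ν (replicate (ℓ ℕ.∸ length ν) 0))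
  (trans (cong₂ _++_ (filter-all (0 ℕₚ.<?_) ν>0) (zeros (ℓ ℕ.∸ length ν))) (++-identityʳ ν))
  where
    zeros : ∀ z → strip (replicate z 0) ≡ []
    zeros zero    = refl
    zeros (suc z) = zeros z

strip-0 : ∀ l → sum l ≡ 0 → strip l ≡ [] × l ≡ replicate (length l) 0
strip-0 []         e = refl , refl
strip-0 (zero ∷ l) e = let p , q = strip-0 l e in p , cong (0 ∷_) q

Decreasing-zeros : ∀ l → Decreasing (0 ∷ l) → sum l ≡ 0
Decreasing-zeros []         _       = refl
Decreasing-zeros (zero ∷ l) (_ ∷ d) = Decreasing-zeros l d

pad-strip : ∀ l → Decreasing l → l ≡ pad (length l) (strip l)
pad-strip []           _ = refl
pad-strip (zero ∷ l)   d =
  let p , q = strip-0 l (Decreasing-zeros l d)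
  in trans (cong (0 ∷_) q) (cong (pad (suc (length l))) (sym p))
pad-strip (suc x ∷ l)  d = cong (suc x ∷_) (pad-strip l (Linked.tail d))

strip-Decreasing : ∀ l → Decreasing l → Decreasing (strip l)
strip-Decreasing []          _ = []
strip-Decreasing (zero ∷ l)  d = subst Decreasing (sym (proj₁ (strip-0 l (Decreasing-zeros l d)))) []
strip-Decreasing (suc x ∷ []) d = [-]
strip-Decreasing (suc x ∷ zero ∷ l) (_ ∷ d) = subst (λ z → Decreasing (suc x ∷ z)) (sym (proj₁ (strip-0 l (Decreasing-zeros l d)))) [-]
strip-Decreasing (suc x ∷ suc y ∷ l) (h ∷ d) = h ∷ strip-Decreasing (suc y ∷ l) d

pad-Decreasing : ∀ ν z → Decreasing ν → Decreasing (ν ++ replicate z 0)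
pad-Decreasing []          zero          d = []
pad-Decreasing []          (suc zero)    d = [-]
pad-Decreasing []          (suc (suc z)) d = z≤n ∷ pad-Decreasing [] (suc z) []
pad-Decreasing (x ∷ [])    zero          d = [-]
pad-Decreasing (x ∷ [])    (suc z)       d = z≤n ∷ pad-Decreasing [] (suc z) []
pad-Decreasing (x ∷ y ∷ ν) z       (h ∷ d) = h ∷ pad-Decreasing (y ∷ ν) z d

sum-strip : ∀ l → sum (strip l) ≡ sum l
sum-strip []          = refl
sum-strip (zero ∷ l)  = sum-strip l
sum-strip (suc x ∷ l) = cong (suc x +_) (sum-strip l)

HS⇒Decreasing : ∀ l κ → HS l κ → Decreasing l
HS⇒Decreasing (k ∷ [])     (t ∷ []) h = [-]
HS⇒Decreasing (k ∷ k′ ∷ l) (t ∷ κ) ((k′≤t , t≤k) , h) = ℕₚ.≤-trans k′≤t t≤k ∷ HS⇒Decreasing (k′ ∷ l) κ h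

pad-∈ : ∀ n {ν} → ν ⊢ n → length (pad (suc n) ν) ≡ suc n × All (_< suc n) (pad (suc n) ν)
pad-∈ n {ν} ((_ , ν>0) , sν) =
  trans (length-++ ν) (trans (cong (length ν +_) (length-replicate (suc n ℕ.∸ length ν)))
    (ℕₚ.m+[n∸m]≡n (ℕₚ.m≤n⇒m≤1+n (ℕₚ.≤-trans (length≤sum ν ν>0) (ℕₚ.≤-reflexive sν))))) ,
  Allₚ.++⁺ (All≤sum ν (ℕₚ.≤-reflexive sν)) (Allₚ.replicate⁺ (suc n ℕ.∸ length ν) (s≤s z≤n))

module _ (n : ℕ) where
  open Strips n (suc n)

  K-Decreasing : ∀ l α → ¬ Decreasing l → K l α ≡ 0ℚ
  K-Decreasing l []      ¬d = 𝟙-no (sum l ℕₚ.≟ 0) (λ e → ¬d (subst Decreasing (sym (proj₂ (strip-0 l e))) (pad-Decreasing [] (length l) [])))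
  K-Decreasing l (a ∷ α) ¬d = Σ-none (λ κ → hs? l κ ×-dec (sum κ + a ℕₚ.≟ sum l)) {xs = Λ} {λ κ → K κ α} (λ { κ _ (h , _) → ¬d (HS⇒Decreasing l κ h) })

  S-K : ∀ ν k w → ν ⊢ n → length w ≡ n → All (_< k) w → S ν w ≡ ℕ→ℚ (fctᴺ w) *ℚ K (pad (suc n) ν) (contents k w)
  S-K ν k w p@((d , ν>0) , sν) lw w<k = trans (S-fillings ν k w (trans lw (sym sν)) w<k) (cong (ℕ→ℚ (fctᴺ w) *ℚ_) (begin
    fillings k ν (contents k w)
      ≡⟨ fillings-pad k ν (suc n ℕ.∸ length ν) (contents k w) ⟨
    fillings k (pad (suc n) ν) (contents k w)
      ≡⟨ cong (λ m → fillings m (pad (suc n) ν) (contents k w)) (sym (length-contents k w)) ⟩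
    fillings (length (contents k w)) (pad (suc n) ν) (contents k w)
      ≡⟨ fillings≡K n (suc n) (contents k w) (pad (suc n) ν) (proj₁ (pad-∈ n p)) (proj₂ (pad-∈ n p)) (pad-Decreasing ν (suc n ℕ.∸ length ν) d) ⟩
    K (pad (suc n) ν) (contents k w) ∎))
    where open ≡-Reasoning

  -- A list of the box contributes only if it has size n and decreases weakly, and such a list is
  -- the padding of the partition formed by its positive entries.
  Σ-partitions-K : ∀ α β → sum α ≡ n → Σ Λ (λ l → K l α *ℚ K l β) ≡ Σ (partitionsOf n) (λ ν → K (pad (suc n) ν) α *ℚ K (pad (suc n) ν) β)
  Σ-partitions-K α β sα = Σ-image _≟L_ (pad (suc n)) (Unique-partitionsOf n) (Unique-allWords (suc n) (suc n))
    (λ ν ν∈ → let l , b = pad-∈ n (∈-partitionsOf⁻ n ν∈) in ∈-allWords⁺ (pad (suc n) ν) l b)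
    (λ ν ν′ ν∈ ν′∈ e → trans (sym (strip-pad (suc n) ν (proj₂ (proj₁ (∈-partitionsOf⁻ n ν∈)))))
      (trans (cong strip e) (strip-pad (suc n) ν′ (proj₂ (proj₁ (∈-partitionsOf⁻ n ν′∈))))))
    (λ l l∈ ¬ν → trans (cong (_*ℚ K l β) (vanish l (proj₁ (∈-allWords⁻ (suc n) (suc n) l∈)) ¬ν)) (ℚₚ.*-zeroˡ (K l β)))
    where
      vanish : ∀ l → length l ≡ suc n → ¬ (∃ λ ν → ν ∈ partitionsOf n × pad (suc n) ν ≡ l) → K l α ≡ 0ℚ
      vanish l ll ¬ν with sum l ℕₚ.≟ sum α | linked? (λ a b → b ℕₚ.≤? a) l
      ... | no ≢  | _     = K-graded l α ≢
      ... | yes e | no ¬d = K-Decreasing l α ¬d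
      ... | yes e | yes d = contradiction (strip l
                , ∈-partitionsOf⁺ n ((strip-Decreasing l d , Allₚ.all-filter (0 ℕₚ.<?_) l) , trans (sum-strip l) (trans e sα))
                , trans (cong (λ m → pad m (strip l)) (sym ll)) (sym (pad-strip l d))) ¬ν

  cauchy : ∀ u w → length u ≡ n → length w ≡ n →
    Σ (perms u) (λ v → ℕ→ℚ (fctᴾ (zip w v))) ≡ Σ (partitionsOf n) (λ ν → S ν u *ℚ S ν w)
  cauchy u w lu lw = begin
    Σ (perms u) (λ v → ℕ→ℚ (fctᴾ (zip w v)))
      ≡⟨ Σ-perms n k u lu u<k ⟩
    fu *ℚ Σ (allWords n k) (λ v → 𝟙 (contents k v ≟L α) *ℚ ℕ→ℚ (fctᴾ (zip w v)))
      ≡⟨ cong (λ m → fu *ℚ Σ (allWords m k) (λ v → 𝟙 (contents k v ≟L α) *ℚ ℕ→ℚ (fctᴾ (zip w v)))) (sym lw) ⟩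
    fu *ℚ pairs k w α
      ≡⟨ cong (fu *ℚ_) (pairs-↭ k α (↭-realize k w w<k)) ⟩
    fu *ℚ pairs k (realize β) α
      ≡⟨ cong (fu *ℚ_) (pairs-matrices k (suc n) β α (length-contents k u) (All≤sum α (ℕₚ.≤-reflexive sα))) ⟩
    fu *ℚ (ℕ→ℚ (product (map _! β)) *ℚ matrices (suc n) α β)
      ≡⟨ cong (λ m → fu *ℚ (ℕ→ℚ m *ℚ matrices (suc n) α β)) (trans (sym (fct-realize β)) (sym (fct-↭ ℕₚ._≟_ (↭-realize k w w<k)))) ⟩
    fu *ℚ (fw *ℚ matrices (suc n) α β)
      ≡⟨ cong (λ m → fu *ℚ (fw *ℚ m)) (trans (sym (cauchy-K β α (ℕₚ.≤-reflexive sβ) (s≤s (ℕₚ.≤-reflexive sα)))) (Σ-partitions-K α β sα)) ⟩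
    fu *ℚ (fw *ℚ Σ (partitionsOf n) (λ ν → K (pad (suc n) ν) α *ℚ K (pad (suc n) ν) β))
      ≡⟨ trans (Σ-distribˡ fu (partitionsOf n)) (cong (fu *ℚ_) (Σ-distribˡ fw (partitionsOf n))) ⟨
    Σ (partitionsOf n) (λ ν → fu *ℚ (fw *ℚ (K (pad (suc n) ν) α *ℚ K (pad (suc n) ν) β)))
      ≡⟨ Σ-cong-∈ (partitionsOf n) (λ ν ν∈ → trans (regroup fu fw (K (pad (suc n) ν) α) (K (pad (suc n) ν) β))
           (sym (cong₂ _*ℚ_ (S-K ν k u (∈-partitionsOf⁻ n ν∈) lu u<k) (S-K ν k w (∈-partitionsOf⁻ n ν∈) lw w<k)))) ⟩
    Σ (partitionsOf n) (λ ν → S ν u *ℚ S ν w) ∎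
    where
      open ≡-Reasoning
      -- A common alphabet: one more than the sum of all letters exceeds each of them.
      k = suc (sum (u ++ w))
      bound : All (_< k) (u ++ w)
      bound = All≤sum (u ++ w) ℕₚ.≤-refl
      u<k = Allₚ.++⁻ˡ u bound
      w<k = Allₚ.++⁻ʳ u bound
      α = contents k u
      β = contents k w
      fu = ℕ→ℚ (fctᴺ u)
      fw = ℕ→ℚ (fctᴺ w)
      sα : sum α ≡ n
      sα = trans (sum-contents k u u<k) lu
      sβ : sum β ≡ n
      sβ = trans (sum-contents k w w<k) lw
      regroup : ∀ a b x y → a *ℚ (b *ℚ (x *ℚ y)) ≡ (a *ℚ x) *ℚ (b *ℚ y)
      regroup a b x y = trans (cong (a *ℚ_) (*ℚ-swapˡ b x y)) (sym (ℚₚ.*-assoc a x (b *ℚ y)))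

-- Dominance and linear independence

-- For a partition, `std` reads the superstandard tableau, whose row i is filled with i, rows being
-- counted from 0. In general it is a test word with multiplicities μ.
stdFrom : ℕ → List ℕ → Word
stdFrom c []      = []
stdFrom c (a ∷ μ) = replicate a c ++ stdFrom (suc c) μ

std : List ℕ → Word
std = stdFrom 0

length-stdFrom : ∀ c μ → length (stdFrom c μ) ≡ sum μ
length-stdFrom c []      = refl
length-stdFrom c (a ∷ μ) = trans (length-++ (replicate a c)) (cong₂ _+_ (length-replicate a) (length-stdFrom (suc c) μ))

stdFrom-≥ : ∀ c μ → All (c ≤_) (stdFrom c μ)
stdFrom-≥ c []      = []
stdFrom-≥ c (a ∷ μ) = Allₚ.++⁺ (Allₚ.replicate⁺ a ℕₚ.≤-refl) (All.map ℕₚ.<⇒≤ (stdFrom-≥ (suc c) μ))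

stdFrom-< : ∀ c μ → All (_< c + length μ) (stdFrom c μ)
stdFrom-< c []      = []
stdFrom-< c (a ∷ μ) = Allₚ.++⁺ (Allₚ.replicate⁺ a (ℕₚ.m<m+n c (s≤s z≤n)))
  (subst (λ n → All (_< n) (stdFrom (suc c) μ)) (sym (ℕₚ.+-suc c (length μ))) (stdFrom-< (suc c) μ))

occ-stdFrom : ∀ c μ → map (λ i → occ ℕₚ._≟_ (c + i) (stdFrom c μ)) (upTo (length μ)) ≡ μ
occ-stdFrom c []      = refl
occ-stdFrom c (a ∷ μ) = cong₂ _∷_ first rest
  where
    open ≡-Reasoning
    first : occ ℕₚ._≟_ (c + 0) (replicate a c ++ stdFrom (suc c) μ) ≡ a
    first = trans (cong (λ i → occ ℕₚ._≟_ i (replicate a c ++ stdFrom (suc c) μ)) (ℕₚ.+-identityʳ c))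
      (trans (occ-++ ℕₚ._≟_ c (replicate a c) (stdFrom (suc c) μ))
      (trans (cong₂ _+_ (occ-replicate ℕₚ._≟_ c a) (occ-none ℕₚ._≟_ (All.map ℕₚ.<⇒≢ (stdFrom-≥ (suc c) μ)))) (ℕₚ.+-identityʳ a)))
    shift : ∀ i → occ ℕₚ._≟_ (c + suc i) (replicate a c ++ stdFrom (suc c) μ) ≡ occ ℕₚ._≟_ (suc c + i) (stdFrom (suc c) μ)
    shift i = trans (occ-++ ℕₚ._≟_ (c + suc i) (replicate a c) (stdFrom (suc c) μ))
      (cong₂ _+_ (occ-replicate-≢ ℕₚ._≟_ a (ℕₚ.m+1+n≢m c)) (cong (λ j → occ ℕₚ._≟_ j (stdFrom (suc c) μ)) (ℕₚ.+-suc c i)))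
    rest : map (λ i → occ ℕₚ._≟_ (c + i) (stdFrom c (a ∷ μ))) (applyUpTo suc (length μ)) ≡ μ
    rest = begin
      map (λ i → occ ℕₚ._≟_ (c + i) (stdFrom c (a ∷ μ))) (applyUpTo suc (length μ))
        ≡⟨ cong (map (λ i → occ ℕₚ._≟_ (c + i) (stdFrom c (a ∷ μ)))) (map-upTo suc (length μ)) ⟨
      map (λ i → occ ℕₚ._≟_ (c + i) (stdFrom c (a ∷ μ))) (map suc (upTo (length μ)))
        ≡⟨ map-∘ (upTo (length μ)) ⟨
      map (λ i → occ ℕₚ._≟_ (c + suc i) (stdFrom c (a ∷ μ))) (upTo (length μ))
        ≡⟨ map-cong shift (upTo (length μ)) ⟩
      map (λ i → occ ℕₚ._≟_ (suc c + i) (stdFrom (suc c) μ)) (upTo (length μ))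
        ≡⟨ occ-stdFrom (suc c) μ ⟩
      μ ∎

contents-std : ∀ μ → contents (length μ) (std μ) ≡ reverse μ
contents-std μ = trans (sym (contents-reverse (length μ) (std μ))) (cong reverse (occ-stdFrom 0 μ))

count< : ℕ → Word → ℕ
count< m w = length (filter (ℕₚ._<? m) w)

count<-++ : ∀ m v w → count< m (v ++ w) ≡ count< m v + count< m w
count<-++ m v w = trans (cong length (filter-++ (ℕₚ._<? m) v w)) (length-++ (filter (ℕₚ._<? m) v))

count<-none : ∀ {m w} → All (m ≤_) w → count< m w ≡ 0
count<-none {m} h = cong length (filter-none (ℕₚ._<? m) (All.map ℕₚ.≤⇒≯ h))

count<-stdFrom : ∀ c m μ → count< (c + m) (stdFrom c μ) ≡ sum (take m μ)
count<-stdFrom c zero    μ       = count<-none (subst (λ n → All (n ≤_) (stdFrom c μ)) (sym (ℕₚ.+-identityʳ c)) (stdFrom-≥ c μ))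
count<-stdFrom c (suc m) []      = refl
count<-stdFrom c (suc m) (a ∷ μ) = trans (count<-++ (c + suc m) (replicate a c) (stdFrom (suc c) μ))
  (cong₂ _+_ (trans (cong length (filter-all (ℕₚ._<? c + suc m) (Allₚ.replicate⁺ {P = _< c + suc m} a (ℕₚ.m<m+n c (s≤s z≤n))))) (length-replicate a))
             (trans (cong (λ n → count< n (stdFrom (suc c) μ)) (ℕₚ.+-suc c m)) (count<-stdFrom (suc c) m μ)))

colStrict-bound : ∀ i u v → T (colStrict u v) → length v ≤ length u → All (i ≤_) u → All (suc i ≤_) v
colStrict-bound i u       []      _ _ _ = []
colStrict-bound i (a ∷ u) (b ∷ v) h (s≤s l) (i≤a ∷ i≤u) =
  let ab , t = T-∧⁻ {a ℕ.<ᵇ b} h in ℕₚ.≤-<-trans i≤a (ℕₚ.<ᵇ⇒< a b ab) ∷ colStrict-bound i u v t l i≤u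

isSSYTRows-∷ : ∀ r R → T (isSSYTRows (r ∷ R)) → T (isSSYTRows R)
isSSYTRows-∷ r []       _ = tt
isSSYTRows-∷ r (r′ ∷ R) h = proj₂ (T-∧⁻ {colStrict r r′} (proj₂ (T-∧⁻ {weakInc r} h)))

module _ {r r′ rs v} (r′≤r : r′ ≤ r) (lv : length v ≡ r + (r′ + sum rs)) (h : T (isSSYT (r ∷ r′ ∷ rs) v)) where

  next-row-bound : ∀ i → All (i ≤_) (take r v) → All (suc i ≤_) (take r′ (drop r v))
  next-row-bound i = colStrict-bound i (take r v) (take r′ (drop r v))
    (proj₁ (T-∧⁻ {colStrict (take r v) (take r′ (drop r v))} (proj₂ (T-∧⁻ {weakInc (take r v)} h))))
    (ℕₚ.≤-trans (ℕₚ.≤-trans (ℕₚ.≤-reflexive (length-take r′ (drop r v))) (ℕₚ.m⊓n≤m r′ _)) (ℕₚ.≤-trans r′≤r (ℕₚ.≤-reflexive (sym lt))))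
    where
      lt : length (take r v) ≡ r
      lt = trans (length-take r v) (ℕₚ.m≤n⇒m⊓n≡m (ℕₚ.≤-trans (ℕₚ.m≤m+n r _) (ℕₚ.≤-reflexive (sym lv))))

length-drop-sum : ∀ r {s} (v : Word) → length v ≡ r + s → length (drop r v) ≡ s
length-drop-sum r {s} v e = trans (length-drop r v) (trans (cong (ℕ._∸ r) e) (ℕₚ.m+n∸m≡n r s))

SSYT-bound : ∀ i r rs v → Decreasing (r ∷ rs) → length v ≡ sum (r ∷ rs) → T (isSSYT (r ∷ rs) v) →
             All (i ≤_) (take r v) → All (i ≤_) v
SSYT-bound i r rs v d lv h b = subst (All (i ≤_)) (take++drop≡id r v) (Allₚ.++⁺ b (rest rs d lv h))
  where
    rest : ∀ rs → Decreasing (r ∷ rs) → length v ≡ sum (r ∷ rs) → T (isSSYT (r ∷ rs) v) → All (i ≤_) (drop r v)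
    rest []        d       lv h with drop r v | length-drop-sum r v lv
    ... | [] | _ = []
    rest (r′ ∷ rs) (r′≤r ∷ d) lv h = All.map ℕₚ.<⇒≤ (SSYT-bound (suc i) r′ rs (drop r v) d (length-drop-sum r v lv)
      (isSSYTRows-∷ (take r v) (rowsOf (r′ ∷ rs) (drop r v)) h) (next-row-bound {rs = rs} r′≤r lv h i b))

-- The lower bound on the entries grows by 1 from each row to the next, so letters less than i + m
-- lie in the first m rows. The recursion raises i along with the rows.
SSYT-count : ∀ i m rs v → Decreasing rs → length v ≡ sum rs → T (isSSYT rs v) →
             (∀ r rs′ → rs ≡ r ∷ rs′ → All (i ≤_) (take r v)) → count< (i + m) v ≤ sum (take m rs)
SSYT-count i m       []       []  d lv h b = z≤n
SSYT-count i zero    (r ∷ rs) v d lv h b = ℕₚ.≤-reflexive (count<-none (subst (λ n → All (n ≤_) v) (sym (ℕₚ.+-identityʳ i)) (SSYT-bound i r rs v d lv h (b r rs refl))))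
SSYT-count i (suc m) (r ∷ rs) v d lv h b = begin
  count< (i + suc m) v
    ≡⟨ cong (count< (i + suc m)) (take++drop≡id r v) ⟨
  count< (i + suc m) (take r v ++ drop r v)
    ≡⟨ count<-++ (i + suc m) (take r v) (drop r v) ⟩
  count< (i + suc m) (take r v) + count< (i + suc m) (drop r v)
    ≤⟨ ℕₚ.+-mono-≤ (ℕₚ.≤-trans (length-filter (ℕₚ._<? (i + suc m)) (take r v)) (ℕₚ.≤-trans (ℕₚ.≤-reflexive (length-take r v)) (ℕₚ.m⊓n≤m r _)))
         (ℕₚ.≤-trans (ℕₚ.≤-reflexive (cong (λ n → count< n (drop r v)) (ℕₚ.+-suc i m)))
           (SSYT-count (suc i) m rs (drop r v) (Linked.tail d) (length-drop-sum r v lv) (isSSYTRows-∷ (take r v) (rowsOf rs (drop r v)) h) (next rs d lv h))) ⟩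
  r + sum (take m rs) ∎
  where
    open ℕₚ.≤-Reasoning
    next : ∀ rs → Decreasing (r ∷ rs) → length v ≡ sum (r ∷ rs) → T (isSSYT (r ∷ rs) v) →
           ∀ r′ rs′ → rs ≡ r′ ∷ rs′ → All (suc i ≤_) (take r′ (drop r v))
    next .(r′ ∷ rs′) (r′≤r ∷ _) lv h r′ rs′ refl = next-row-bound {rs = rs′} r′≤r lv h i (b r _ refl)

-- In a semistandard filling of ν by the letters of `std μ`, those less than k lie in the first k
-- rows for every k, and this is dominance.
S-std-⋬ : ∀ ν μ → IsPartition ν → ¬ (μ ⊴ ν) → S ν (std μ) ≡ 0ℚ
S-std-⋬ ν μ (d , _) ¬dom = [ same-size , S-length-≢ ν (std μ) ]′ (toSum (length (std μ) ℕₚ.≟ sum ν))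
  where
    open ℕₚ.≤-Reasoning
    same-size : length (std μ) ≡ sum ν → S ν (std μ) ≡ 0ℚ
    same-size e = trans (S-perms ν (std μ) e) (Σ-zero (perms (std μ)) (λ v v∈ → 𝟙-no (T? (isSSYT ν v)) (λ h → ¬dom (λ k → begin
      sum (take k μ)      ≡⟨ count<-stdFrom 0 k μ ⟨
      count< k (std μ)    ≡⟨ ↭ₚ.↭-length (↭ₚ.filter-↭ (ℕₚ._<? k) (∈-perms⇒↭ (std μ) v∈)) ⟨
      count< k v          ≤⟨ SSYT-count 0 k ν v d (trans (↭ₚ.↭-length (∈-perms⇒↭ (std μ) v∈)) e) h (λ r _ _ → All.universal (λ _ → z≤n) (take r v)) ⟩
      sum (take k ν)      ∎))))

∈-perms-refl : (xs : List A) → xs ∈ perms xs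
∈-perms-refl []       = here refl
∈-perms-refl (x ∷ xs) = ∈-concatMap⁺ (insertions x) (lose (∈-perms-refl xs) (insert-first xs))
  where
    insert-first : ∀ ys → (x ∷ ys) ∈ insertions x ys
    insert-first []      = here refl
    insert-first (_ ∷ _) = here refl

countTrue-positive : (p : A → Bool) {xs : List A} {x : A} → x ∈ xs → T (p x) → 0 < countTrue p xs
countTrue-positive p {xs} x∈ px with filter (λ x → T? (p x)) xs | ∈-filter⁺ (λ x → T? (p x)) x∈ px
... | _ ∷ _ | _ = s≤s z≤n

weakInc-replicate : ∀ n a → T (weakInc (replicate n a))
weakInc-replicate zero          a = tt
weakInc-replicate (suc zero)    a = tt
weakInc-replicate (suc (suc n)) a = T-∧⁺ {a ℕ.≤ᵇ a} (ℕₚ.≤⇒≤ᵇ (ℕₚ.≤-refl {a})) (weakInc-replicate (suc n) a)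

colStrict-replicate : ∀ m n {a b} → a < b → T (colStrict (replicate m a) (replicate n b))
colStrict-replicate zero    n       a<b = tt
colStrict-replicate (suc m) zero    a<b = tt
colStrict-replicate (suc m) (suc n) a<b = T-∧⁺ (ℕₚ.<⇒<ᵇ a<b) (colStrict-replicate m n a<b)

isSSYT-stdFrom : ∀ c ν → T (isSSYT ν (stdFrom c ν))
isSSYT-stdFrom c []      = tt
isSSYT-stdFrom c (r ∷ []) = subst (T ∘ isSSYTRows) (sym (rowsOf-++ [] (replicate r c) [] (length-replicate r))) (weakInc-replicate r c)
isSSYT-stdFrom c (r ∷ r′ ∷ ν) = subst (T ∘ isSSYTRows)
  (sym (trans (rowsOf-++ (r′ ∷ ν) (replicate r c) (stdFrom (suc c) (r′ ∷ ν)) (length-replicate r))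
              (cong (replicate r c ∷_) (rowsOf-++ ν (replicate r′ (suc c)) (stdFrom (suc (suc c)) ν) (length-replicate r′)))))
  (T-∧⁺ (weakInc-replicate r c) (T-∧⁺ (colStrict-replicate r r′ ℕₚ.≤-refl)
    (subst (T ∘ isSSYTRows) (rowsOf-++ ν (replicate r′ (suc c)) (stdFrom (suc (suc c)) ν) (length-replicate r′)) (isSSYT-stdFrom (suc c) (r′ ∷ ν)))))

-- The superstandard tableau is one of the fillings counted.
S-std-≢0 : ∀ ν → S ν (std ν) ≢ 0ℚ
S-std-≢0 ν e = ℕₚ.<⇒≢ (countTrue-positive (isSSYT ν) (∈-perms-refl (std ν)) (isSSYT-stdFrom 0 ν))
  (sym (ℕ→ℚ-injective (trans (countTrue-Σ (isSSYT ν) (perms (std ν))) (trans (sym (S-perms ν (std ν) (length-stdFrom 0 ν))) e))))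

-- Equal to Σ i μ_i with parts numbered from 1. Among partitions of one size it strictly decreases
-- along dominance, so induction on this number replaces induction along a partial order.
tailSums : List ℕ → ℕ
tailSums []      = 0
tailSums (a ∷ μ) = sum (a ∷ μ) + tailSums μ

sum≡0⇒[] : ∀ {ν} → All (0 <_) ν → sum ν ≡ 0 → ν ≡ []
sum≡0⇒[] []        _ = refl
sum≡0⇒[] {a ∷ ν} (a>0 ∷ _) e = contradiction (sym (ℕₚ.m+n≡0⇒m≡0 a e)) (ℕₚ.<⇒≢ a>0)

tailSums-mono : ∀ μ ν → All (0 <_) μ → All (0 <_) ν → (∀ k → sum (drop k ν) ≤ sum (drop k μ)) → tailSums ν < tailSums μ ⊎ μ ≡ ν
tailSums-mono []      ν       _ ν>0 h = inj₂ (sym (sum≡0⇒[] ν>0 (ℕₚ.n≤0⇒n≡0 (h 0))))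
tailSums-mono (a ∷ μ) []      (a>0 ∷ _) _ h = inj₁ (ℕₚ.<-≤-trans a>0 (ℕₚ.≤-trans (ℕₚ.m≤m+n a (sum μ)) (ℕₚ.m≤m+n (a + sum μ) (tailSums μ))))
tailSums-mono (a ∷ μ) (b ∷ ν) (_ ∷ μ>0) (_ ∷ ν>0) h with tailSums-mono μ ν μ>0 ν>0 (h ∘ suc)
... | inj₁ lt   = inj₁ (ℕₚ.+-mono-≤-< (h 0) lt)
... | inj₂ refl with ℕₚ.m≤n⇒m<n∨m≡n (ℕₚ.+-cancelʳ-≤ (sum μ) b a (h 0))
...   | inj₁ b<a  = inj₁ (ℕₚ.+-monoˡ-< (tailSums μ) (ℕₚ.+-monoˡ-< (sum μ) b<a))
...   | inj₂ refl = inj₂ refl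

⊴⇒tailSums : ∀ μ ν → All (0 <_) μ → All (0 <_) ν → sum μ ≡ sum ν → μ ⊴ ν → tailSums ν < tailSums μ ⊎ μ ≡ ν
⊴⇒tailSums μ ν μ>0 ν>0 e dom = tailSums-mono μ ν μ>0 ν>0 (λ k → ℕₚ.+-cancelˡ-≤ (sum (take k μ)) _ _ (begin
  sum (take k μ) + sum (drop k ν)  ≤⟨ ℕₚ.+-monoˡ-≤ (sum (drop k ν)) (dom k) ⟩
  sum (take k ν) + sum (drop k ν)  ≡⟨ split k ν ⟩
  sum ν                            ≡⟨ e ⟨
  sum μ                            ≡⟨ split k μ ⟨
  sum (take k μ) + sum (drop k μ)  ∎))
  where
    open ℕₚ.≤-Reasoning
    split : ∀ k ν → sum (take k ν) + sum (drop k ν) ≡ sum ν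
    split k ν = trans (sym (sum-++ (take k ν) (drop k ν))) (cong sum (take++drop≡id k ν))

S-std-triangular : ∀ μ ν → IsPartition μ → IsPartition ν → μ ≢ ν → ¬ (tailSums ν < tailSums μ) → S ν (std μ) ≡ 0ℚ
S-std-triangular μ ν (_ , μ>0) pν@(_ , ν>0) ≢ ≮ =
  [ (λ e → S-std-⋬ ν μ pν (λ dom → [ ≮ , ≢ ]′ (⊴⇒tailSums μ ν μ>0 ν>0 e dom)))
  , (λ s≢ → S-length-≢ ν (std μ) (λ e → s≢ (trans (sym (length-stdFrom 0 μ)) e))) ]′ (toSum (sum μ ℕₚ.≟ sum ν))

Unique-map-injective : {f : A → B} (xs : List A) → Unique (map f xs) → ∀ {x y} → x ∈ xs → y ∈ xs → f x ≡ f y → x ≡ y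
Unique-map-injective (z ∷ xs) (z∉ ∷ u) (here refl) (here refl) e = refl
Unique-map-injective {f = f} (z ∷ xs) (z∉ ∷ u) (here refl) (there y∈)  e = contradiction e (All.lookup z∉ (∈-map⁺ f y∈))
Unique-map-injective {f = f} (z ∷ xs) (z∉ ∷ u) (there x∈)  (here refl) e = contradiction (sym e) (All.lookup z∉ (∈-map⁺ f x∈))
Unique-map-injective (z ∷ xs) (z∉ ∷ u) (there x∈)  (there y∈)  e = Unique-map-injective xs u x∈ y∈ e

-- Evaluation at `std μ` is triangular: apart from μ itself only shapes with smaller `tailSums`
-- contribute, and their coefficients are zero by induction. Since S_μ does not vanish there, the
-- coefficient of μ must.
S-independent : ∀ (cs : List (List ℕ × ℚ)) → All (λ c → IsPartition (proj₁ c)) cs → Unique (map proj₁ cs) →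
  (∀ w → Σ cs (λ c → proj₂ c *ℚ S (proj₁ c) w) ≡ 0ℚ) → All (λ c → proj₂ c ≡ 0ℚ) cs
S-independent cs parts uniq h = All.tabulate (λ {c} c∈ → go (suc (tailSums (proj₁ c))) c c∈ ℕₚ.≤-refl)
  where
    go : ∀ m c → c ∈ cs → tailSums (proj₁ c) < m → proj₂ c ≡ 0ℚ
    go (suc m) (μ , a) c∈ (s≤s ≤m) = *ℚ-zero-factor (S-std-≢0 μ) (trans
      (sym (Σ-unique {f = λ c → proj₂ c *ℚ S (proj₁ c) (std μ)} (Uniqueₚ.map⁻ uniq) c∈ others)) (h (std μ)))
      where
        others : ∀ c → c ∈ cs → c ≢ (μ , a) → proj₂ c *ℚ S (proj₁ c) (std μ) ≡ 0ℚ
        others (ν , b) c′∈ c≢ =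
          [ (λ lt → trans (cong (_*ℚ S ν (std μ)) (go m (ν , b) c′∈ (ℕₚ.<-≤-trans lt ≤m))) (ℚₚ.*-zeroˡ (S ν (std μ))))
          , (λ ≮ → trans (cong (b *ℚ_) (S-std-triangular μ ν (All.lookup parts c∈) (All.lookup parts c′∈)
              (λ e → c≢ (Unique-map-injective cs uniq c′∈ c∈ (sym e))) ≮)) (ℚₚ.*-zeroʳ b)) ]′ (toSum (tailSums ν ℕₚ.<? tailSums μ))

S-independent-on : ∀ n (a : List ℕ → ℚ) → (∀ u → length u ≡ n → Σ (partitionsOf n) (λ ν → a ν *ℚ S ν u) ≡ 0ℚ) →
                   ∀ {ν} → ν ⊢ n → a ν ≡ 0ℚ
S-independent-on n a h {ν} p = All.lookup (S-independent cs (Allₚ.map⁺ (All.tabulate (λ ν∈ → proj₁ (∈-partitionsOf⁻ n ν∈))))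
    (subst Unique (sym (trans (sym (map-∘ (partitionsOf n))) (map-id (partitionsOf n)))) (Unique-partitionsOf n)) relation)
  (∈-map⁺ (λ ν → ν , a ν) (∈-partitionsOf⁺ n p))
  where
    cs = map (λ ν → ν , a ν) (partitionsOf n)
    relation : ∀ u → Σ cs (λ c → proj₂ c *ℚ S (proj₁ c) u) ≡ 0ℚ
    relation u = trans (Σ-map (λ ν → ν , a ν) (partitionsOf n)) (case (length u ℕₚ.≟ n))
      where
        case : Dec (length u ≡ n) → Σ (partitionsOf n) (λ ν → a ν *ℚ S ν u) ≡ 0ℚ
        case (yes e) = h u e
        case (no ≢)  = Σ-zero (partitionsOf n) (λ ν ν∈ → trans (cong (a ν *ℚ_)
          (S-length-≢ ν u (λ e → ≢ (trans e (proj₂ (∈-partitionsOf⁻ n ν∈)))))) (ℚₚ.*-zeroʳ (a ν)))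

-- Invariance of the coefficients under rearranging and renaming

difference-zero : ∀ x y → x -ℚ y ≡ 0ℚ → x ≡ y
difference-zero x y e = begin
  x                 ≡⟨ ℚₚ.+-identityʳ x ⟨
  x +ℚ 0ℚ           ≡⟨ cong (x +ℚ_) (ℚₚ.+-inverseˡ y) ⟨
  x +ℚ (-ℚ y +ℚ y)  ≡⟨ ℚₚ.+-assoc x (-ℚ y) y ⟨
  (x -ℚ y) +ℚ y     ≡⟨ cong (_+ℚ y) e ⟩
  0ℚ +ℚ y           ≡⟨ ℚₚ.+-identityˡ y ⟩
  y                 ∎
  where open ≡-Reasoning

-- By the Cauchy identity the last hypothesis says Σ_ν (S_ν(w) − S_ν(w′)) S_ν(u) = 0 for all u, and the S_ν are
-- linearly independent.
S-≡ : ∀ n w w′ → length w ≡ n → length w′ ≡ n →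
  (∀ u → length u ≡ n → Σ (perms u) (λ v → ℕ→ℚ (fctᴾ (zip w v))) ≡ Σ (perms u) (λ v → ℕ→ℚ (fctᴾ (zip w′ v)))) →
  ∀ {ν} → ν ⊢ n → S ν w ≡ S ν w′
S-≡ n w w′ lw lw′ h {ν} p = difference-zero (S ν w) (S ν w′) (S-independent-on n (λ ν → S ν w -ℚ S ν w′) relation p)
  where
    open ≡-Reasoning
    relation : ∀ u → length u ≡ n → Σ (partitionsOf n) (λ ν → (S ν w -ℚ S ν w′) *ℚ S ν u) ≡ 0ℚ
    relation u lu = begin
      Σ ps (λ ν → (S ν w -ℚ S ν w′) *ℚ S ν u)
        ≡⟨ Σ-cong ps (λ ν → trans (ℚₚ.*-distribʳ-+ (S ν u) (S ν w) (-ℚ S ν w′))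
             (cong₂ _+ℚ_ (ℚₚ.*-comm (S ν w) (S ν u)) (trans (sym (ℚₚ.neg-distribˡ-* (S ν w′) (S ν u)))
               (trans (cong -ℚ_ (ℚₚ.*-comm (S ν w′) (S ν u))) (neg (S ν u *ℚ S ν w′)))))) ⟩
      Σ ps (λ ν → S ν u *ℚ S ν w +ℚ -ℚ 1ℚ *ℚ (S ν u *ℚ S ν w′))
        ≡⟨ trans (Σ-+ ps) (cong (Σ ps (λ ν → S ν u *ℚ S ν w) +ℚ_) (Σ-distribˡ (-ℚ 1ℚ) ps)) ⟩
      Σ ps (λ ν → S ν u *ℚ S ν w) +ℚ -ℚ 1ℚ *ℚ Σ ps (λ ν → S ν u *ℚ S ν w′)
        ≡⟨ cong₂ (λ x y → x +ℚ -ℚ 1ℚ *ℚ y) (sym (cauchy n u w lu lw)) (trans (sym (cauchy n u w′ lu lw′)) (sym (h u lu))) ⟩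
      X +ℚ -ℚ 1ℚ *ℚ X
        ≡⟨ cong (X +ℚ_) (neg X) ⟨
      X +ℚ -ℚ X
        ≡⟨ ℚₚ.+-inverseʳ X ⟩
      0ℚ ∎
      where
        ps = partitionsOf n
        X = Σ (perms u) (λ v → ℕ→ℚ (fctᴾ (zip w v)))
        neg : ∀ x → -ℚ x ≡ -ℚ 1ℚ *ℚ x
        neg x = trans (cong -ℚ_ (sym (ℚₚ.*-identityˡ x))) (ℚₚ.neg-distribˡ-* 1ℚ x)

-- Written as a sum over words of given contents, the left side of the Cauchy identity is `pairs`,
-- which does not depend on the order of the letters of w.
S-↭ : ∀ n {w w′ ν} → length w ≡ n → w ↭ w′ → ν ⊢ n → S ν w ≡ S ν w′
S-↭ n {w} {w′} lw p = S-≡ n w w′ lw lw′ λ u lu →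
  let k = suc (sum u) ; u<k = All≤sum u ℕₚ.≤-refl
      expand : ∀ x → length x ≡ n → Σ (perms u) (λ v → ℕ→ℚ (fctᴾ (zip x v))) ≡ ℕ→ℚ (fctᴺ u) *ℚ pairs k x (contents k u)
      expand x lx = Σ-perms (length x) k u (trans lu (sym lx)) u<k
  in trans (expand w lw) (trans (cong (ℕ→ℚ (fctᴺ u) *ℚ_) (pairs-↭ k (contents k u) p)) (sym (expand w′ lw′)))
  where lw′ = trans (sym (↭ₚ.↭-length p)) lw

-- Renaming the letters of w renames the pairs (w_i , v_i) and leaves their multiplicities alone.
-- For Kostka numbers this contains the symmetry in the content.
S-relabel : ∀ n {R : ℕ → ℕ → Set} → BiUnique R → ∀ {w w′ ν} → Pointwise R w w′ → length w ≡ n → ν ⊢ n → S ν w ≡ S ν w′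
S-relabel n {R} (f , g) {w} {w′} rs lw = S-≡ n w w′ lw (trans (sym (Pointwise.Pointwise-length rs)) lw) λ u lu →
  Σ-cong (perms u) (λ v → cong ℕ→ℚ (fct-relabel _ _ bi (zipped rs v)))
  where
    R² : ℕ × ℕ → ℕ × ℕ → Set
    R² p q = R (proj₁ p) (proj₁ q) × proj₂ p ≡ proj₂ q
    bi : BiUnique R²
    bi = (λ { (r , refl) (r′ , refl) → cong (_, _) (f r r′) }) , (λ { (r , refl) (r′ , refl) → cong (_, _) (g r r′) })
    zipped : ∀ {w w′} → Pointwise R w w′ → ∀ v → Pointwise R² (zip w v) (zip w′ v)
    zipped []       v       = []
    zipped (r ∷ rs) []      = []
    zipped (r ∷ rs) (x ∷ v) = (r , refl) ∷ zipped rs v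

-- Kernels of words

-- The auxiliary functions of Defs are private.  The metavariables below are solved by them: a with-abstraction
-- exhibits kerAux and kerAux-found applied to distinct variables, and cong! finds indexOf as the argument in
-- which two unfolded applications of kerAux differ.

mutual
  insertDesc : ℕ → List ℕ → List ℕ
  insertDesc = _

  sortDesc-foldr : sortDesc ≡ foldr insertDesc []
  sortDesc-foldr = refl

mutual
  kerAux : DecidableEquality A → List A → List A → List ℕ
  kerAux = _

  kerBy-kerAux : (_≟_ : DecidableEquality A) (xs : List A) → ∃ λ r → kerBy _≟_ xs ≡ r
  kerBy-kerAux {A} _≟_ xs with nil
    where
      nil : List A
      nil = []
  ... | seen = kerAux _≟_ seen xs , refl

mutual
  kerAux-found : (_≟_ : DecidableEquality A) → List A → (x : A) → List A → (y : A) → List A → Dec (x ≡ y) → List ℕ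
  kerAux-found = _

  kerAux-∷∷ : (_≟_ : DecidableEquality A) (x y : A) (s xs : List A) → ∃ λ r → kerAux _≟_ (y ∷ s) (x ∷ xs) ≡ r
  kerAux-∷∷ _≟_ x y s xs with y ∷ s | x ≟ y
  ... | seen | d = kerAux-found _≟_ seen x xs y s d , refl

mutual
  indexOf : DecidableEquality A → A → List A → Maybe ℕ
  indexOf = _

  indexOf-found : (_≟_ : DecidableEquality A) (x y : A) → List A → Dec (x ≡ y) → Maybe ℕ
  indexOf-found = _

  kerAux-indexOf : (_≟_ : DecidableEquality A) (x y : A) (seen s xs : List A) →
    (∀ d → indexOf _≟_ x seen ≡ indexOf-found _≟_ x y s d) →
    kerAux _≟_ seen (x ∷ xs) ≡ kerAux-found _≟_ seen x xs y s (x ≟ y)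
  kerAux-indexOf _≟_ x y seen s xs h with x ≟ y
  ... | d = cong! (h d)

-- The graph of a table of letters. For a duplicate-free table it is a partial bijection between
-- block numbers and letters, and this is what ties a word to its kernel.
data Nth {A : Set} : List A → ℕ → A → Set where
  here  : ∀ {a l} → Nth (a ∷ l) 0 a
  there : ∀ {a b l i} → Nth l i a → Nth (b ∷ l) (suc i) a

Nth-++ : ∀ {l m : List A} {i a} → Nth l i a → Nth (l ++ m) i a
Nth-++ here      = here
Nth-++ (there n) = there (Nth-++ n)

Nth-length : ∀ (l : List A) {m a} → Nth (l ++ a ∷ m) (length l) a
Nth-length []      = here
Nth-length (x ∷ l) = there (Nth-length l)

Nth-< : ∀ {l : List A} {i a} → Nth l i a → i < length l
Nth-< here      = s≤s z≤n
Nth-< (there n) = s≤s (Nth-< n)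

Nth-∈ : ∀ {l : List A} {i a} → Nth l i a → a ∈ l
Nth-∈ here      = here refl
Nth-∈ (there n) = there (Nth-∈ n)

Nth-BiUnique : ∀ {l : List A} → Unique l → BiUnique (Nth l)
Nth-BiUnique u = fun , inj u
  where
    fun : ∀ {l : List A} {i a b} → Nth l i a → Nth l i b → a ≡ b
    fun here      here      = refl
    fun (there m) (there n) = fun m n
    inj : ∀ {l : List A} {i j a} → Unique l → Nth l i a → Nth l j a → i ≡ j
    inj _        here      here      = refl
    inj (a∉ ∷ _) here      (there n) = contradiction refl (All.lookup a∉ (Nth-∈ n))
    inj (a∉ ∷ _) (there m) here      = contradiction refl (All.lookup a∉ (Nth-∈ m))
    inj (_ ∷ u)  (there m) (there n) = cong suc (inj u m n)

module _ (_≟_ : DecidableEquality A) where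

  indexOf-just : ∀ x s {i} → indexOf _≟_ x s ≡ just i → Nth s i x
  indexOf-just x (y ∷ s) e with x ≟ y
  indexOf-just x (y ∷ s) refl | yes refl = here
  ... | no _ with indexOf _≟_ x s in eq
  indexOf-just x (y ∷ s) refl | no _ | just i = there (indexOf-just x s eq)

  indexOf-nothing : ∀ x s → indexOf _≟_ x s ≡ nothing → x ∉ s
  indexOf-nothing x (y ∷ s) e x∈ with x ≟ y
  indexOf-nothing x (y ∷ s) () x∈ | yes _
  ... | no ≢ with indexOf _≟_ x s in eq
  indexOf-nothing x (y ∷ s) e (here refl) | no ≢ | nothing = ≢ refl
  indexOf-nothing x (y ∷ s) e (there x∈)  | no ≢ | nothing = indexOf-nothing x s eq x∈

  Unique-∷ʳ : ∀ {s : List A} {x : A} → Unique s → x ∉ s → Unique (s ++ x ∷ [])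
  Unique-∷ʳ u x∉ = Uniqueₚ.++⁺ u ([] ∷ []) (λ { (p , here refl) → x∉ p })

  -- The list l consists of the letters of xs not yet in s, in order of first occurrence; the
  -- finished table s ++ l assigns to each block number its letter.
  kerAux-Nth : ∀ s xs → Unique s → ∃ λ l → Unique (s ++ l) × length l ≤ length xs × Pointwise (Nth (s ++ l)) (kerAux _≟_ s xs) xs
  kerAux-Nth s []       u = [] , subst Unique (sym (++-identityʳ s)) u , z≤n , []
  kerAux-Nth s (x ∷ xs) u with indexOf _≟_ x s in eq
  ... | just i  = let l , u′ , len , p = kerAux-Nth s xs u
                  in l , u′ , ℕₚ.m≤n⇒m≤1+n len , Nth-++ (indexOf-just x s eq) ∷ p
  ... | nothing = let l , u′ , len , p = kerAux-Nth (s ++ x ∷ []) xs (Unique-∷ʳ u (indexOf-nothing x s eq))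
                      assoc = ++-assoc s (x ∷ []) l
                  in x ∷ l , subst Unique assoc u′ , s≤s len , Nth-length s ∷ subst (λ m → Pointwise (Nth m) (kerAux _≟_ (s ++ x ∷ []) xs) xs) assoc p

  kerBy-Nth : ∀ xs → ∃ λ l → Unique l × length l ≤ length xs × Pointwise (Nth l) (kerBy _≟_ xs) xs
  kerBy-Nth xs = kerAux-Nth [] xs []

  fct-kerBy : ∀ xs → fct ℕₚ._≟_ (kerBy _≟_ xs) ≡ fct _≟_ xs
  fct-kerBy xs = let l , u , _ , p = kerBy-Nth xs in fct-relabel ℕₚ._≟_ _≟_ (Nth-BiUnique u) p

  length-kerBy : ∀ xs → length (kerBy _≟_ xs) ≡ length xs
  length-kerBy xs = Pointwise.Pointwise-length (proj₂ (proj₂ (proj₂ (kerBy-Nth xs))))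

module _ (_≟ᵃ_ : DecidableEquality A) (_≟ᵇ_ : DecidableEquality B) {R : A → B → Set} (bi : BiUnique R) where

  indexOf-relabel : ∀ {x y s t} → R x y → Pointwise R s t → indexOf _≟ᵃ_ x s ≡ indexOf _≟ᵇ_ y t
  indexOf-relabel r [] = refl
  indexOf-relabel {x} {y} {x′ ∷ s} {y′ ∷ t} r (r′ ∷ rs) with x ≟ᵃ x′ | y ≟ᵇ y′
  ... | yes _    | yes _    = refl
  ... | yes refl | no ≢     = contradiction (proj₁ bi r r′) ≢
  ... | no ≢     | yes refl = contradiction (proj₂ bi r r′) ≢
  ... | no _     | no _     with indexOf _≟ᵃ_ x s | indexOf _≟ᵇ_ y t | indexOf-relabel r rs
  ...   | just _  | just _  | refl = refl
  ...   | nothing | nothing | _    = refl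

  kerAux-relabel : ∀ {s t xs ys} → Pointwise R s t → Pointwise R xs ys → kerAux _≟ᵃ_ s xs ≡ kerAux _≟ᵇ_ t ys
  kerAux-relabel st [] = refl
  kerAux-relabel {s} {t} {x ∷ xs} {y ∷ ys} st (r ∷ rs) with indexOf _≟ᵃ_ x s | indexOf _≟ᵇ_ y t | indexOf-relabel r st
  ... | just i  | just _  | refl = cong (i ∷_) (kerAux-relabel st rs)
  ... | nothing | nothing | _    = cong₂ _∷_ (Pointwise.Pointwise-length st) (kerAux-relabel (Pointwise.++⁺ st (r ∷ [])) rs)

  kerBy-relabel : ∀ {xs ys} → Pointwise R xs ys → kerBy _≟ᵃ_ xs ≡ kerBy _≟ᵇ_ ys
  kerBy-relabel = kerAux-relabel []

ker-Nth : ∀ w → ∃ λ l → Unique l × length l ≤ length w × Pointwise (Nth l) (ker w) w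
ker-Nth = kerBy-Nth ℕₚ._≟_

length-ker : ∀ w → length (ker w) ≡ length w
length-ker = length-kerBy ℕₚ._≟_

-- The kernel is itself a renaming of w, and kernels are invariant under renaming.
ker-ker : ∀ w → ker (ker w) ≡ ker w
ker-ker w = let l , u , _ , p = ker-Nth w in kerBy-relabel ℕₚ._≟_ ℕₚ._≟_ (Nth-BiUnique u) p

ker-< : ∀ w → All (_< length w) (ker w)
ker-< w = let l , _ , len , p = ker-Nth w in All.map (λ i< → ℕₚ.<-≤-trans i< len) (bound p)
  where
    bound : ∀ {l is xs} → Pointwise (Nth {ℕ} l) is xs → All (_< length l) is
    bound []       = []
    bound (n ∷ ns) = Nth-< n ∷ bound ns

ker-∈-setPartitions : ∀ {n} w → length w ≡ n → ker w ∈ setPartitions n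
ker-∈-setPartitions w refl = ∈-filter⁺ (λ σ → ≡-dec ℕₚ._≟_ (ker σ) σ) (∈-allWords⁺ (ker w) (length-ker w) (ker-< w)) (ker-ker w)

∈-setPartitions⁻ : ∀ n {σ} → σ ∈ setPartitions n → length σ ≡ n × ker σ ≡ σ
∈-setPartitions⁻ n σ∈ = let w∈ , e = ∈-filter⁻ (λ σ → ≡-dec ℕₚ._≟_ (ker σ) σ) {xs = allWords n n} σ∈ in proj₁ (∈-allWords⁻ n n w∈) , e

Unique-setPartitions : ∀ n → Unique (setPartitions n)
Unique-setPartitions n = Uniqueₚ.filter⁺ (λ σ → ≡-dec ℕₚ._≟_ (ker σ) σ) (Unique-allWords n n)

S-ker : ∀ n {w ν} → length w ≡ n → ν ⊢ n → S ν (ker w) ≡ S ν w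
S-ker n {w} lw p = let l , u , _ , q = ker-Nth w in S-relabel n (Nth-BiUnique u) {ker w} {w} q (trans (length-ker w) lw) p

product-blockSizes : ∀ π → product (map _! (blockSizes π)) ≡ fctᴺ π
product-blockSizes π = trans (cong product (sym (map-∘ (deduplicate ℕₚ._≟_ π))))
  (product-! ℕₚ._≟_ π (DecUniqueₚ.deduplicate-! ℕₚ._≟_ π) (All.tabulate (∈-deduplicate⁺ ℕₚ._≟_)))

-- A block of the meet consists of the positions that carry one and the same pair of letters.
fct-∧ₛ : ∀ τ v → fctᴺ (ker τ ∧ₛ ker v) ≡ fctᴾ (zip τ v)
fct-∧ₛ τ v = trans (fct-kerBy (×-≡-dec ℕₚ._≟_ ℕₚ._≟_) (zip (ker τ) (ker v))) (fct-relabel _ _ bi (zipped pτ pv))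
  where
    lτ = proj₁ (ker-Nth τ)
    lv = proj₁ (ker-Nth v)
    pτ = proj₂ (proj₂ (proj₂ (ker-Nth τ)))
    pv = proj₂ (proj₂ (proj₂ (ker-Nth v)))
    R² : ℕ × ℕ → ℕ × ℕ → Set
    R² p q = Nth lτ (proj₁ p) (proj₁ q) × Nth lv (proj₂ p) (proj₂ q)
    bi : BiUnique R²
    bi = (λ { (r , s) (r′ , s′) → cong₂ _,_ (proj₁ (Nth-BiUnique (proj₁ (proj₂ (ker-Nth τ)))) r r′) (proj₁ (Nth-BiUnique (proj₁ (proj₂ (ker-Nth v)))) s s′) })
       , (λ { (r , s) (r′ , s′) → cong₂ _,_ (proj₂ (Nth-BiUnique (proj₁ (proj₂ (ker-Nth τ)))) r r′) (proj₂ (Nth-BiUnique (proj₁ (proj₂ (ker-Nth v)))) s s′) })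
    zipped : ∀ {x y x′ y′} → Pointwise (Nth lτ) x x′ → Pointwise (Nth lv) y y′ → Pointwise R² (zip x y) (zip x′ y′)
    zipped []       _        = []
    zipped (_ ∷ _)  []       = []
    zipped (r ∷ rs) (s ∷ ss) = (r , s) ∷ zipped rs ss

hSP-length : ∀ σ w {m} → product (map _! (blockSizes (ker w ∧ₛ σ))) ≡ m → length w ≡ length σ → hSP σ w ≡ ℕ→ℚ m
hSP-length σ w eq e with length w ℕₚ.≟ length σ
... | yes _ = cong ℕ→ℚ eq
... | no l≢ = contradiction e l≢

-- Identifies the summands on the left side of the Cauchy identity as coefficients of the functions
-- h_σ that define the form.
hSP-ker : ∀ τ v → length τ ≡ length v → hSP (ker v) τ ≡ ℕ→ℚ (fctᴾ (zip τ v))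
hSP-ker τ v e = hSP-length (ker v) τ (trans (product-blockSizes (ker τ ∧ₛ ker v)) (fct-∧ₛ τ v)) (trans e (sym (length-ker v)))

-- The type of a set partition

sum-occ-∷ : ∀ {L} x w → Unique L → x ∈ L → sum (map (λ b → occ ℕₚ._≟_ b (x ∷ w)) L) ≡ suc (sum (map (λ b → occ ℕₚ._≟_ b w) L))
sum-occ-∷ {l ∷ L} x w (l∉ ∷ u) (here refl) = cong₂ _+_ (occ-yes ℕₚ._≟_ w refl) (unchanged L l∉)
  where
    unchanged : ∀ L → All (l ≢_) L → sum (map (λ b → occ ℕₚ._≟_ b (l ∷ w)) L) ≡ sum (map (λ b → occ ℕₚ._≟_ b w) L)
    unchanged []      []       = refl
    unchanged (b ∷ L) (≢ ∷ ≢s) = cong₂ _+_ (occ-no ℕₚ._≟_ w (≢-sym ≢)) (unchanged L ≢s)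
sum-occ-∷ {l ∷ L} x w (l∉ ∷ u) (there x∈) =
  trans (cong₂ _+_ (occ-no ℕₚ._≟_ w (All.lookup l∉ x∈)) (sum-occ-∷ x w u x∈)) (ℕₚ.+-suc _ _)

sum-occ : ∀ {L} w → Unique L → All (_∈ L) w → sum (map (λ b → occ ℕₚ._≟_ b w) L) ≡ length w
sum-occ {L} []      u []        = zeros L
  where
    zeros : ∀ L → sum (map (λ _ → 0) L) ≡ 0
    zeros []      = refl
    zeros (_ ∷ L) = zeros L
sum-occ {L} (x ∷ w) u (x∈ ∷ ∈s) = trans (sum-occ-∷ x w u x∈) (cong suc (sum-occ w u ∈s))

insertDesc-↭ : ∀ a l → insertDesc a l ↭ a ∷ l
insertDesc-↭ a []      = ↭-refl
insertDesc-↭ a (b ∷ l) with b ≤ᵇ a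
... | true  = ↭-refl
... | false = ↭-trans (prep b (insertDesc-↭ a l)) (swap b a ↭-refl)

sortDesc-↭ : ∀ l → sortDesc l ↭ l
sortDesc-↭ []      = ↭-refl
sortDesc-↭ (a ∷ l) = ↭-trans (insertDesc-↭ a (sortDesc l)) (prep a (sortDesc-↭ l))

insertDesc-Decreasing : ∀ a l → Decreasing l → Decreasing (insertDesc a l)
insertDesc-Decreasing a []      d = [-]
insertDesc-Decreasing a (b ∷ l) d with b ≤ᵇ a in eq
... | true  = ℕₚ.≤ᵇ⇒≤ b a (subst T (sym eq) tt) ∷ d
... | false = below-head l d
  where
    a≤b : a ≤ b
    a≤b = ℕₚ.<⇒≤ (ℕₚ.≰⇒> (λ b≤a → subst T eq (ℕₚ.≤⇒≤ᵇ b≤a)))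
    below-head : ∀ l → Decreasing (b ∷ l) → Decreasing (b ∷ insertDesc a l)
    below-head []      d       = a≤b ∷ [-]
    below-head (c ∷ l) (c≤b ∷ d) with insertDesc-Decreasing a (c ∷ l) d
    ... | d′ with c ≤ᵇ a
    ...   | true  = a≤b ∷ d′
    ...   | false = c≤b ∷ d′

sortDesc-Decreasing : ∀ l → Decreasing (sortDesc l)
sortDesc-Decreasing []      = []
sortDesc-Decreasing (a ∷ l) = insertDesc-Decreasing a (sortDesc l) (sortDesc-Decreasing l)

occ-positive : (_≟_ : DecidableEquality A) {a : A} (w : List A) → a ∈ w → 0 < occ _≟_ a w
occ-positive _≟_ {a} (x ∷ w) a∈ with a ≟ x | a∈
... | yes _ | _         = s≤s z≤n
... | no ≢  | here e    = contradiction e ≢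
... | no _  | there a∈′ = occ-positive _≟_ w a∈′

typeOf-⊢ : ∀ σ → typeOf σ ⊢ length σ
typeOf-⊢ σ = (sortDesc-Decreasing (blockSizes σ) , ↭ₚ.All-resp-↭ (↭-sym (sortDesc-↭ (blockSizes σ)))
    (Allₚ.map⁺ (All.tabulate (λ b∈ → occ-positive ℕₚ._≟_ σ (∈-deduplicate⁻ ℕₚ._≟_ σ b∈)))))
  , trans (sum-↭ (sortDesc-↭ (blockSizes σ))) (sum-occ σ (DecUniqueₚ.deduplicate-! ℕₚ._≟_ σ) (All.tabulate (∈-deduplicate⁺ ℕₚ._≟_)))

-- A word with equal letters adjacent. For the letters of a word in order of decreasing multiplicity
-- it is both a rearrangement of that word and a renaming of `std` of its type.
blocks : (ℕ → ℕ) → List ℕ → Word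
blocks f []      = []
blocks f (b ∷ L) = replicate (f b) b ++ blocks f L

occ-blocks-∉ : ∀ f {L a} → a ∉ L → occ ℕₚ._≟_ a (blocks f L) ≡ 0
occ-blocks-∉ f {[]}    a∉ = refl
occ-blocks-∉ f {b ∷ L} {a} a∉ = trans (occ-++ ℕₚ._≟_ a (replicate (f b) b) (blocks f L))
  (cong₂ _+_ (occ-replicate-≢ ℕₚ._≟_ (f b) (a∉ ∘ here)) (occ-blocks-∉ f (a∉ ∘ there)))

occ-blocks-∈ : ∀ f {L a} → Unique L → a ∈ L → occ ℕₚ._≟_ a (blocks f L) ≡ f a
occ-blocks-∈ f {b ∷ L} (b∉ ∷ u) (here refl) = trans (occ-++ ℕₚ._≟_ b (replicate (f b) b) (blocks f L))
  (trans (cong₂ _+_ (occ-replicate ℕₚ._≟_ b (f b)) (occ-blocks-∉ f (λ b∈ → All.lookup b∉ b∈ refl))) (ℕₚ.+-identityʳ (f b)))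
occ-blocks-∈ f {b ∷ L} {a} (b∉ ∷ u) (there a∈) = trans (occ-++ ℕₚ._≟_ a (replicate (f b) b) (blocks f L))
  (cong₂ _+_ (occ-replicate-≢ ℕₚ._≟_ (f b) (≢-sym (All.lookup b∉ a∈))) (occ-blocks-∈ f u a∈))

blocks-↭ : ∀ {L} w → Unique L → (∀ {a} → a ∈ w → a ∈ L) → blocks (λ b → occ ℕₚ._≟_ b w) L ↭ w
blocks-↭ {L} w u w⊆ = occ-≡⇒↭ ℕₚ._≟_ (blocks f L) w (λ a → case a (a ∈ᴺ? L))
  where
    f : ℕ → ℕ
    f b = occ ℕₚ._≟_ b w
    case : ∀ a → Dec (a ∈ L) → occ ℕₚ._≟_ a (blocks f L) ≡ occ ℕₚ._≟_ a w
    case a (yes a∈) = occ-blocks-∈ f u a∈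
    case a (no a∉)  = trans (occ-blocks-∉ f a∉) (sym (occ-∉ ℕₚ._≟_ w (a∉ ∘ w⊆)))

stdFrom-blocks : ∀ f P L → Pointwise (Nth (P ++ L)) (stdFrom (length P) (map f L)) (blocks f L)
stdFrom-blocks f P []      = []
stdFrom-blocks f P (b ∷ L) = Pointwise.++⁺ (block (f b))
  (subst₂ (λ M c → Pointwise (Nth M) (stdFrom c (map f L)) (blocks f L)) (++-assoc P (b ∷ []) L)
    (trans (length-++ P) (ℕₚ.+-comm (length P) 1)) (stdFrom-blocks f (P ++ b ∷ []) L))
  where
    block : ∀ n → Pointwise (Nth (P ++ b ∷ L)) (replicate n (length P)) (replicate n b)
    block zero    = []
    block (suc n) = Nth-length P ∷ block n

Unique-resp-↭ : ∀ {xs ys : List ℕ} → xs ↭ ys → Unique xs → Unique ys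
Unique-resp-↭ p = ↭ₛₚ.Unique-resp-↭ (setoid ℕ) (↭⇒↭ₛ p)

-- Pass from w to its kernel, rearrange so that equal letters are adjacent and larger blocks come
-- first, then rename the letters to 0, 1, 2, ...; each move preserves the coefficient.
S-typeOf : ∀ n {w ν} → length w ≡ n → ν ⊢ n → S ν w ≡ S ν (std (typeOf (ker w)))
-- The sorting of the block sizes is lifted to a list D′ of the letters themselves, since the
-- renaming has to know which block has which size.
S-typeOf n {w} {ν} lw p = trans (sym (S-ker n {w} lw p)) (from-σ (↭ₚ.↭-map-inv f (↭-sym (sortDesc-↭ (blockSizes σ)))))
  where
    σ = ker w
    D = deduplicate ℕₚ._≟_ σ
    f : ℕ → ℕ
    f b = occ ℕₚ._≟_ b σ
    from-σ : (∃ λ D′ → typeOf σ ≡ map f D′ × D ↭ D′) → S ν σ ≡ S ν (std (typeOf σ))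
    from-σ (D′ , e , q) = begin
      S ν σ                       ≡⟨ S-↭ n {blocks f D′} {σ} lb b↭σ p ⟨
      S ν (blocks f D′)           ≡⟨ S-relabel n (Nth-BiUnique u′) {std (map f D′)} {blocks f D′} pw (trans (Pointwise.Pointwise-length pw) lb) p ⟨
      S ν (std (map f D′))        ≡⟨ cong (S ν ∘ std) e ⟨
      S ν (std (typeOf σ))        ∎
      where
        open ≡-Reasoning
        u′ = Unique-resp-↭ q (DecUniqueₚ.deduplicate-! ℕₚ._≟_ σ)
        b↭σ = blocks-↭ σ u′ (λ a∈ → ↭ₚ.∈-resp-↭ q (∈-deduplicate⁺ ℕₚ._≟_ a∈))
        lb : length (blocks f D′) ≡ n
        lb = trans (↭ₚ.↭-length b↭σ) (trans (length-ker w) lw)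
        pw = stdFrom-blocks f [] D′

kostka-≢ : ∀ ν α → sum α ≢ sum ν → ℕ→ℚ (kostka ν α) ≡ 0ℚ
kostka-≢ ν α ≢ = trans (kostka-fillings ν α) (Σ-zero (allWords (sum ν) k) (λ w w∈ → *𝟙-no (contents k w ≟L reverse α) (𝟙 (T? (isSSYT ν w)))
  (λ e → ≢ (trans (sym (sum-↭ (↭ₚ.↭-reverse α))) (trans (cong sum (sym e))
    (trans (sum-contents k w (proj₂ (∈-allWords⁻ (sum ν) k w∈))) (proj₁ (∈-allWords⁻ (sum ν) k w∈))))))))
  where k = length α

fct-std : ∀ μ → fctᴺ (std μ) ≡ μ !ₚ
fct-std μ = trans (fct-↭ ℕₚ._≟_ (↭-realize (length μ) (std μ) (stdFrom-< 0 μ)))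
  (trans (fct-realize (contents (length μ) (std μ))) (trans (cong (product ∘ map _!) (contents-std μ))
  (product-↭ (↭ₚ.map⁺ _! (↭ₚ.↭-reverse μ)))))

S-std : ∀ ν μ → sum μ ≡ sum ν → S ν (std μ) ≡ ℕ→ℚ (μ !ₚ * kostka ν μ)
S-std ν μ e = begin
  S ν (std μ)
    ≡⟨ S-fillings ν (length μ) (std μ) (trans (length-stdFrom 0 μ) e) (stdFrom-< 0 μ) ⟩
  ℕ→ℚ (fctᴺ (std μ)) *ℚ fillings (length μ) ν (contents (length μ) (std μ))
    ≡⟨ cong₂ (λ m c → ℕ→ℚ m *ℚ fillings (length μ) ν c) (fct-std μ) (contents-std μ) ⟩
  ℕ→ℚ (μ !ₚ) *ℚ fillings (length μ) ν (reverse μ)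
    ≡⟨ cong (ℕ→ℚ (μ !ₚ) *ℚ_) (kostka-fillings ν μ) ⟨
  ℕ→ℚ (μ !ₚ) *ℚ ℕ→ℚ (kostka ν μ)
    ≡⟨ ℕ→ℚ-* (μ !ₚ) (kostka ν μ) ⟨
  ℕ→ℚ (μ !ₚ * kostka ν μ) ∎
  where open ≡-Reasoning

S-kostka : ∀ n {w ν} → length w ≡ n → ν ⊢ n → S ν w ≡ ℕ→ℚ (typeOf (ker w) !ₚ * kostka ν (typeOf (ker w)))
S-kostka n {w} {ν} lw p = trans (S-typeOf n {w} lw p) (S-std ν (typeOf (ker w))
  (trans (proj₂ (typeOf-⊢ (ker w))) (trans (length-ker w) (trans lw (sym (proj₂ p))))))

-- The five statements

/-*-cancel : ∀ a b .{{_ : NonZero b}} → ((ℤ.+ a) / b) *ℚ ℕ→ℚ b ≡ ℕ→ℚ a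
/-*-cancel a (suc b) = ℚₚ.toℚᵘ-injective (begin
  toℚᵘ (((ℤ.+ a) / suc b) *ℚ ℕ→ℚ (suc b))
    ≈⟨ ℚₚ.toℚᵘ-homo-* ((ℤ.+ a) / suc b) (ℕ→ℚ (suc b)) ⟩
  toℚᵘ ((ℤ.+ a) / suc b) ℚᵘ.* toℚᵘ (ℕ→ℚ (suc b))
    ≈⟨ ℚᵘₚ.*-cong (ℚₚ.toℚᵘ-fromℚᵘ (ℚᵘ.mkℚᵘ (ℤ.+ a) b)) (ℕ→ℚ-toℚᵘ (suc b)) ⟩
  ℚᵘ.mkℚᵘ (ℤ.+ a) b ℚᵘ.* ℚᵘ.mkℚᵘ (ℤ.+ suc b) 0
    ≈⟨ ℚᵘ.*≡* (trans (ℤₚ.*-identityʳ ((ℤ.+ a) ℤ.* (ℤ.+ suc b))) (cong (λ m → (ℤ.+ a) ℤ.* (ℤ.+ m)) (sym (ℕₚ.*-identityʳ (suc b))))) ⟩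
  ℚᵘ.mkℚᵘ (ℤ.+ a) 0
    ≈⟨ ℕ→ℚ-toℚᵘ a ⟨
  toℚᵘ (ℕ→ℚ a) ∎)
  where open ℚᵘₚ.≃-Reasoning

Σℚ-filter : ∀ {A : Set} {P : A → Set} (P? : ∀ x → Dec (P x)) (xs : List A) (f : A → ℚ) →
            Σℚ (filter P? xs) f ≡ Σ xs (λ x → 𝟙 (P? x) *ℚ f x)
Σℚ-filter P? xs f = trans (Σℚ≡Σ (filter P? xs) f) (Σ-filter P? xs)

-- At a word w of length n only σ = `ker w` and its type μ survive, so the double sum collapses to
-- one coefficient.
monomial-expansion : ∀ n ν → ν ⊢ n → ∀ w →
  S ν w ≡ Σℚ (filter (λ μ → μ ⊴? ν) (partitionsOf n))
             (λ μ → ℕ→ℚ ((μ !ₚ) * kostka ν μ) *ℚ Σℚ (filter (λ σ → typeOf σ ≟L μ) (setPartitions n)) (λ σ → mSP σ w))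
monomial-expansion n ν p w = trans ([ same-degree , other-degree ]′ (toSum (length w ℕₚ.≟ n)))
  (sym (Σℚ-filter (λ μ → μ ⊴? ν) (partitionsOf n) (λ μ → coefficient μ *ℚ inner μ)))
  where
    open ≡-Reasoning
    μ₀ = typeOf (ker w)
    coefficient : List ℕ → ℚ
    coefficient μ = ℕ→ℚ ((μ !ₚ) * kostka ν μ)
    inner : List ℕ → ℚ
    inner μ = Σℚ (filter (λ σ → typeOf σ ≟L μ) (setPartitions n)) (λ σ → mSP σ w)
    inner-Σ : ∀ μ → inner μ ≡ Σ (setPartitions n) (λ σ → 𝟙 (ker w ≟L σ) *ℚ 𝟙 (typeOf σ ≟L μ))
    inner-Σ μ = trans (Σℚ-filter (λ σ → typeOf σ ≟L μ) (setPartitions n) (λ σ → mSP σ w))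
      (Σ-cong (setPartitions n) (λ σ → ℚₚ.*-comm (𝟙 (typeOf σ ≟L μ)) (𝟙 (ker w ≟L σ))))
    expansion : ℚ
    expansion = Σ (partitionsOf n) (λ μ → 𝟙 (μ ⊴? ν) *ℚ (coefficient μ *ℚ inner μ))
    other-degree : length w ≢ n → S ν w ≡ expansion
    other-degree l≢ = trans (S-length-≢ ν w (λ e → l≢ (trans e (proj₂ p)))) (sym (Σ-zero (partitionsOf n) (λ μ _ →
      𝟙*-zero (μ ⊴? ν) (λ _ → trans (cong (coefficient μ *ℚ_) (trans (inner-Σ μ)
        (Σ-none (ker w ≟L_) {xs = setPartitions n} {f = λ σ → 𝟙 (typeOf σ ≟L μ)}
          (λ { σ σ∈ refl → l≢ (trans (sym (length-ker w)) (proj₁ (∈-setPartitions⁻ n σ∈))) })))) (ℚₚ.*-zeroʳ (coefficient μ))))))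
    same-degree : length w ≡ n → S ν w ≡ expansion
    same-degree lw = sym (begin
      expansion
        ≡⟨ Σ-cong (partitionsOf n) (λ μ → trans (cong (λ x → 𝟙 (μ ⊴? ν) *ℚ (coefficient μ *ℚ x)) (trans (inner-Σ μ)
             (Σ-pick (ker w ≟L_) {f = λ σ → 𝟙 (typeOf σ ≟L μ)} (Unique-setPartitions n) (ker-∈-setPartitions w lw) refl (λ _ _ → sym))))
             (*ℚ-rotate (𝟙 (μ ⊴? ν)) (coefficient μ) (𝟙 (μ₀ ≟L μ)))) ⟩
      Σ (partitionsOf n) (λ μ → 𝟙 (μ₀ ≟L μ) *ℚ (𝟙 (μ ⊴? ν) *ℚ coefficient μ))
        ≡⟨ Σ-pick (μ₀ ≟L_) {f = λ μ → 𝟙 (μ ⊴? ν) *ℚ coefficient μ} (Unique-partitionsOf n)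
             (∈-partitionsOf⁺ n (proj₁ (typeOf-⊢ (ker w)) , μ₀⊢n)) refl (λ _ _ → sym) ⟩
      𝟙 (μ₀ ⊴? ν) *ℚ coefficient μ₀
        -- If the type is not dominated by ν, the sum omits it; by triangularity its coefficient is
        -- then zero as well.
        ≡⟨ [ 𝟙*-yes (μ₀ ⊴? ν) , (λ ¬dom → trans (𝟙*-no (μ₀ ⊴? ν) ¬dom)
             (sym (trans (sym (S-std ν μ₀ (trans μ₀⊢n (sym (proj₂ p))))) (S-std-⋬ ν μ₀ (proj₁ p) ¬dom)))) ]′ (toSum (μ₀ ⊴? ν)) ⟩
      coefficient μ₀
        ≡⟨ S-kostka n {w} {ν} lw p ⟨
      S ν w ∎)
      where
        μ₀⊢n : sum μ₀ ≡ n
        μ₀⊢n = trans (proj₂ (typeOf-⊢ (ker w))) (trans (length-ker w) lw)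

-- When α has sum n, all words of content α have the same coefficient α! K_{ν,α}, and there are
-- n!/α! of them.
commutative-image : ∀ n ν → ν ⊢ n → ∀ α → ρ (S ν) α ≡ ℕ→ℚ (n !) *ℚ schur ν α
commutative-image n ν p α = trans (Σℚ-filter (λ w → T? (hasContent α w)) (allWords (sum α) k) (S ν))
  ([ same-degree , other-degree ]′ (toSum (sum α ℕₚ.≟ n)))
  where
    open ≡-Reasoning
    k = length α
    W = allWords (sum α) k
    other-degree : sum α ≢ n → Σ W (λ w → 𝟙 (T? (hasContent α w)) *ℚ S ν w) ≡ ℕ→ℚ (n !) *ℚ schur ν α
    other-degree s≢ = trans (Σ-zero W (λ w w∈ → 𝟙*-zero (T? (hasContent α w)) (λ _ →
        S-length-≢ ν w (λ e → s≢ (trans (sym (proj₁ (∈-allWords⁻ (sum α) k w∈))) (trans e (proj₂ p)))))))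
      (sym (trans (cong (ℕ→ℚ (n !) *ℚ_) (kostka-≢ ν α (λ e → s≢ (trans e (proj₂ p))))) (ℚₚ.*-zeroʳ (ℕ→ℚ (n !)))))
    same-degree : sum α ≡ n → Σ W (λ w → 𝟙 (T? (hasContent α w)) *ℚ S ν w) ≡ ℕ→ℚ (n !) *ℚ schur ν α
    same-degree sα = begin
      Σ W (λ w → 𝟙 (T? (hasContent α w)) *ℚ S ν w)
        ≡⟨ Σ-cong-∈ W (λ w w∈ → summand w (∈-allWords⁻ (sum α) k w∈)) ⟩
      Σ W (λ w → (ℕ→ℚ (fctᴺ w) *ℚ 𝟙 (contents k w ≟L reverse α)) *ℚ schur ν α)
        ≡⟨ Σ-distribʳ (schur ν α) W ⟩
      Σ W (λ w → ℕ→ℚ (fctᴺ w) *ℚ 𝟙 (contents k w ≟L reverse α)) *ℚ schur ν α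
        ≡⟨ cong (_*ℚ schur ν α) (trans (Σ-multinomial k (sum α) (reverse α) (length-reverse α))
             (*𝟙-yes (sum (reverse α) ℕₚ.≟ sum α) (ℕ→ℚ (sum α !)) (sum-↭ (↭ₚ.↭-reverse α)))) ⟩
      ℕ→ℚ (sum α !) *ℚ schur ν α
        ≡⟨ cong (λ m → ℕ→ℚ (m !) *ℚ schur ν α) sα ⟩
      ℕ→ℚ (n !) *ℚ schur ν α ∎
      where
        summand : ∀ w → length w ≡ sum α × All (_< k) w →
          𝟙 (T? (hasContent α w)) *ℚ S ν w ≡ (ℕ→ℚ (fctᴺ w) *ℚ 𝟙 (contents k w ≟L reverse α)) *ℚ schur ν α
        summand w (lw , w<k) = begin
          𝟙 (T? (hasContent α w)) *ℚ S ν w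
            ≡⟨ cong (_*ℚ S ν w) (𝟙-cong (T? (hasContent α w)) (contents k w ≟L reverse α) (proj₁ ∘ hasContent⁻ α w) (λ e → hasContent⁺ α w e w<k)) ⟩
          𝟙 (contents k w ≟L reverse α) *ℚ S ν w
            ≡⟨ 𝟙*-cong (contents k w ≟L reverse α) (λ e → trans (S-fillings ν k w (trans lw (trans sα (sym (proj₂ p)))) w<k)
                 (cong (ℕ→ℚ (fctᴺ w) *ℚ_) (trans (cong (fillings k ν) e) (sym (kostka-fillings ν α))))) ⟩
          𝟙 (contents k w ≟L reverse α) *ℚ (ℕ→ℚ (fctᴺ w) *ℚ schur ν α)
            ≡⟨ *ℚ-swapˡ (𝟙 (contents k w ≟L reverse α)) (ℕ→ℚ (fctᴺ w)) (schur ν α) ⟩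
          ℕ→ℚ (fctᴺ w) *ℚ (𝟙 (contents k w ≟L reverse α) *ℚ schur ν α)
            ≡⟨ ℚₚ.*-assoc (ℕ→ℚ (fctᴺ w)) (𝟙 (contents k w ≟L reverse α)) (schur ν α) ⟨
          (ℕ→ℚ (fctᴺ w) *ℚ 𝟙 (contents k w ≟L reverse α)) *ℚ schur ν α ∎

-- The factor n! cancels the denominator of the lifting and leaves μ! K_{ν,μ}, the coefficient of
-- S_ν at words of type μ.
lift-schur : ∀ n ν → ν ⊢ n → ∀ w → ρ̃ (scaleC (ℕ→ℚ (n !)) (schur ν)) w ≡ S ν w
lift-schur n ν p w = [ same-degree , other-degree ]′ (toSum (length w ℕₚ.≟ n))
  where
    open ≡-Reasoning
    μ = typeOf (ker w)
    q = _/_ (ℤ.+ (μ !ₚ)) (length w !) {{length w ℕₚ.!≢0}}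
    sμ : sum μ ≡ length w
    sμ = trans (proj₂ (typeOf-⊢ (ker w))) (length-ker w)
    other-degree : length w ≢ n → q *ℚ (ℕ→ℚ (n !) *ℚ schur ν μ) ≡ S ν w
    other-degree l≢ = trans (cong (λ x → q *ℚ (ℕ→ℚ (n !) *ℚ x)) (kostka-≢ ν μ (λ e → l≢ (trans (sym sμ) (trans e (proj₂ p))))))
      (trans (cong (q *ℚ_) (ℚₚ.*-zeroʳ (ℕ→ℚ (n !)))) (trans (ℚₚ.*-zeroʳ q) (sym (S-length-≢ ν w (λ e → l≢ (trans e (proj₂ p)))))))
    same-degree : length w ≡ n → q *ℚ (ℕ→ℚ (n !) *ℚ schur ν μ) ≡ S ν w
    same-degree lw = begin
      q *ℚ (ℕ→ℚ (n !) *ℚ schur ν μ)                ≡⟨ cong (λ m → q *ℚ (ℕ→ℚ (m !) *ℚ schur ν μ)) lw ⟨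
      q *ℚ (ℕ→ℚ (length w !) *ℚ schur ν μ)         ≡⟨ ℚₚ.*-assoc q (ℕ→ℚ (length w !)) (schur ν μ) ⟨
      (q *ℚ ℕ→ℚ (length w !)) *ℚ schur ν μ         ≡⟨ cong (_*ℚ schur ν μ) (/-*-cancel (μ !ₚ) (length w !) {{length w ℕₚ.!≢0}}) ⟩
      ℕ→ℚ (μ !ₚ) *ℚ schur ν μ                      ≡⟨ ℕ→ℚ-* (μ !ₚ) (kostka ν μ) ⟨
      ℕ→ℚ (μ !ₚ * kostka ν μ)                      ≡⟨ S-kostka n {w} {ν} lw p ⟨
      S ν w                                        ∎

-- Linearity of the form in its second argument. The index set of the combination is abstract
-- because the lemma serves twice: for a combination of the S_λ and, read backwards, for a sum of
-- the h_σ.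
Σ-bilinear : ∀ {X L : Set} (P : List X) (Ls : List L) (s : X → ℚ) (t : L → X → ℚ) (c : L → ℚ) (G : X → X → ℚ) →
  Σ Ls (λ l → c l *ℚ Σ P (λ π → Σ P (λ τ → (s π *ℚ t l τ) *ℚ G π τ))) ≡
  Σ P (λ π → s π *ℚ Σ P (λ τ → Σ Ls (λ l → c l *ℚ t l τ) *ℚ G π τ))
Σ-bilinear P Ls s t c G = begin
  Σ Ls (λ l → c l *ℚ Σ P (λ π → Σ P (λ τ → (s π *ℚ t l τ) *ℚ G π τ)))
    ≡⟨ Σ-cong Ls (λ l → trans (sym (Σ-distribˡ (c l) P)) (Σ-cong P (λ π → trans (sym (Σ-distribˡ (c l) P))
         (trans (Σ-cong P (λ τ → regroup (c l) (s π) (t l τ) (G π τ))) (Σ-distribˡ (s π) P))))) ⟩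
  Σ Ls (λ l → Σ P (λ π → s π *ℚ Σ P (λ τ → (c l *ℚ t l τ) *ℚ G π τ)))
    ≡⟨ Σ-swap Ls P ⟩
  Σ P (λ π → Σ Ls (λ l → s π *ℚ Σ P (λ τ → (c l *ℚ t l τ) *ℚ G π τ)))
    ≡⟨ Σ-cong P (λ π → trans (Σ-distribˡ (s π) Ls) (cong (s π *ℚ_) (trans (Σ-swap Ls P) (Σ-cong P (λ τ → Σ-distribʳ (G π τ) Ls))))) ⟩
  Σ P (λ π → s π *ℚ Σ P (λ τ → Σ Ls (λ l → c l *ℚ t l τ) *ℚ G π τ)) ∎
  where
    open ≡-Reasoning
    regroup : ∀ c s t g → c *ℚ ((s *ℚ t) *ℚ g) ≡ s *ℚ ((c *ℚ t) *ℚ g)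
    regroup c s t g = trans (cong (c *ℚ_) (ℚₚ.*-assoc s t g)) (trans (*ℚ-swapˡ c s (t *ℚ g)) (cong (s *ℚ_) (sym (ℚₚ.*-assoc c t g))))

pairing-Σ : ∀ n G f g → pairing n G f g ≡ Σ (setPartitions n) (λ π → Σ (setPartitions n) (λ τ → (f π *ℚ g τ) *ℚ G π τ))
pairing-Σ n G f g = trans (Σℚ≡Σ (setPartitions n) (λ π → Σℚ (setPartitions n) (λ τ → (f π *ℚ g τ) *ℚ G π τ)))
  (Σ-cong (setPartitions n) (λ π → Σℚ≡Σ (setPartitions n) (λ τ → (f π *ℚ g τ) *ℚ G π τ)))

-- Pairing with m_π picks out row π of the Gram matrix, because among the words that encode set
-- partitions only π itself has a nonzero coefficient in m_π.
gram-hSP : ∀ n G → IsStdForm n G → ∀ {π σ} → π ∈ setPartitions n → σ ∈ setPartitions n →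
  Σ (setPartitions n) (λ τ → hSP σ τ *ℚ G π τ) ≡ ℕ→ℚ (n !) *ℚ δ π σ
gram-hSP n G std-form {π} {σ} π∈ σ∈ = begin
  row π
    ≡⟨ Σ-pick (λ π′ → ker π′ ≟L π) {f = row} (Unique-setPartitions n) π∈ (proj₂ (∈-setPartitions⁻ n π∈))
         (λ π′ π′∈ e → trans (sym (proj₂ (∈-setPartitions⁻ n π′∈))) e) ⟨
  Σ (setPartitions n) (λ π′ → 𝟙 (ker π′ ≟L π) *ℚ row π′)
    ≡⟨ Σ-cong (setPartitions n) (λ π′ → trans (sym (Σ-distribˡ (𝟙 (ker π′ ≟L π)) (setPartitions n)))
         (Σ-cong (setPartitions n) (λ τ → sym (ℚₚ.*-assoc (𝟙 (ker π′ ≟L π)) (hSP σ τ) (G π′ τ))))) ⟩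
  Σ (setPartitions n) (λ π′ → Σ (setPartitions n) (λ τ → (mSP π π′ *ℚ hSP σ τ) *ℚ G π′ τ))
    ≡⟨ pairing-Σ n G (mSP π) (hSP σ) ⟨
  pairing n G (mSP π) (hSP σ)
    ≡⟨ std-form π σ π∈ σ∈ ⟩
  ℕ→ℚ (n !) *ℚ δ π σ ∎
  where
    open ≡-Reasoning
    row : List ℕ → ℚ
    row π′ = Σ (setPartitions n) (λ τ → hSP σ τ *ℚ G π′ τ)

-- By the Cauchy identity, Σ_λ ⟨S_ν , S_λ⟩ S_λ(u) = Σ_v ⟨S_ν , h_{ker v}⟩ over the rearrangements v of u.
pairing-expansion : ∀ n ν → ν ⊢ n → ∀ G → IsStdForm n G → ∀ u → length u ≡ n →
  Σ (partitionsOf n) (λ l → S l u *ℚ pairing n G (S ν) (S l)) ≡ ℕ→ℚ (n ! * n !) *ℚ S ν u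
pairing-expansion n ν p G std-form u lu = begin
  Σ ps (λ l → S l u *ℚ pairing n G (S ν) (S l))
    ≡⟨ Σ-cong ps (λ l → cong (S l u *ℚ_) (pairing-Σ n G (S ν) (S l))) ⟩
  Σ ps (λ l → S l u *ℚ Σ Πₙ (λ π → Σ Πₙ (λ τ → (S ν π *ℚ S l τ) *ℚ G π τ)))
    ≡⟨ Σ-bilinear Πₙ ps (S ν) S (λ l → S l u) G ⟩
  Σ Πₙ (λ π → S ν π *ℚ Σ Πₙ (λ τ → Σ ps (λ l → S l u *ℚ S l τ) *ℚ G π τ))
    ≡⟨ Σ-cong Πₙ (λ π → cong (S ν π *ℚ_) (Σ-cong-∈ Πₙ (λ τ τ∈ → cong (_*ℚ G π τ) (kernel τ (proj₁ (∈-setPartitions⁻ n τ∈)))))) ⟩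
  Σ Πₙ (λ π → S ν π *ℚ Σ Πₙ (λ τ → Σ V (λ v → 1ℚ *ℚ hSP (ker v) τ) *ℚ G π τ))
    ≡⟨ Σ-bilinear Πₙ V (S ν) (λ v → hSP (ker v)) (λ _ → 1ℚ) G ⟨
  Σ V (λ v → 1ℚ *ℚ Σ Πₙ (λ π → Σ Πₙ (λ τ → (S ν π *ℚ hSP (ker v) τ) *ℚ G π τ)))
    ≡⟨ Σ-cong-∈ V (λ v v∈ → trans (ℚₚ.*-identityˡ (Σ Πₙ (λ π → Σ Πₙ (λ τ → (S ν π *ℚ hSP (ker v) τ) *ℚ G π τ)))) (evaluate v (∈-perms⇒↭ u v∈))) ⟩
  Σ V (λ _ → S ν u *ℚ ℕ→ℚ (n !))
    ≡⟨ trans (Σ-cong V (λ _ → sym (ℚₚ.*-identityʳ (S ν u *ℚ ℕ→ℚ (n !))))) (Σ-distribˡ (S ν u *ℚ ℕ→ℚ (n !)) V) ⟩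
  (S ν u *ℚ ℕ→ℚ (n !)) *ℚ Σ V (λ _ → 1ℚ)
    ≡⟨ cong ((S ν u *ℚ ℕ→ℚ (n !)) *ℚ_) (trans (Σ-perms-1 u) (cong (λ m → ℕ→ℚ (m !)) lu)) ⟩
  (S ν u *ℚ ℕ→ℚ (n !)) *ℚ ℕ→ℚ (n !)
    ≡⟨ trans (ℚₚ.*-assoc (S ν u) (ℕ→ℚ (n !)) (ℕ→ℚ (n !))) (ℚₚ.*-comm (S ν u) (ℕ→ℚ (n !) *ℚ ℕ→ℚ (n !))) ⟩
  (ℕ→ℚ (n !) *ℚ ℕ→ℚ (n !)) *ℚ S ν u
    ≡⟨ cong (_*ℚ S ν u) (ℕ→ℚ-* (n !) (n !)) ⟨
  ℕ→ℚ (n ! * n !) *ℚ S ν u ∎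
  where
    open ≡-Reasoning
    Πₙ = setPartitions n
    ps = partitionsOf n
    V = perms u
    kernel : ∀ τ → length τ ≡ n → Σ ps (λ l → S l u *ℚ S l τ) ≡ Σ V (λ v → 1ℚ *ℚ hSP (ker v) τ)
    kernel τ lτ = trans (sym (cauchy n u τ lu lτ)) (Σ-cong-∈ V (λ v v∈ → sym (trans (ℚₚ.*-identityˡ (hSP (ker v) τ))
      (hSP-ker τ v (trans lτ (trans (sym lu) (sym (↭ₚ.↭-length (∈-perms⇒↭ u v∈)))))))))
    -- ⟨S_ν , h_σ⟩ is n! times the coefficient of m_σ in S_ν. For σ = `ker v` that coefficient is
    -- S_ν(v), which equals S_ν(u).
    evaluate : ∀ v → v ↭ u → Σ Πₙ (λ π → Σ Πₙ (λ τ → (S ν π *ℚ hSP (ker v) τ) *ℚ G π τ)) ≡ S ν u *ℚ ℕ→ℚ (n !)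
    evaluate v v↭u = begin
      Σ Πₙ (λ π → Σ Πₙ (λ τ → (S ν π *ℚ hSP (ker v) τ) *ℚ G π τ))
        ≡⟨ Σ-cong-∈ Πₙ (λ π π∈ → trans (Σ-cong Πₙ (λ τ → ℚₚ.*-assoc (S ν π) (hSP (ker v) τ) (G π τ)))
             (trans (Σ-distribˡ (S ν π) Πₙ) (trans (cong (S ν π *ℚ_) (gram-hSP n G std-form π∈ kv∈)) (*ℚ-rotate (S ν π) (ℕ→ℚ (n !)) (𝟙 (π ≟L ker v)))))) ⟩
      Σ Πₙ (λ π → 𝟙 (π ≟L ker v) *ℚ (S ν π *ℚ ℕ→ℚ (n !)))
        ≡⟨ Σ-pick (_≟L ker v) {f = λ π → S ν π *ℚ ℕ→ℚ (n !)} (Unique-setPartitions n) kv∈ refl (λ _ _ e → e) ⟩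
      S ν (ker v) *ℚ ℕ→ℚ (n !)
        ≡⟨ cong (_*ℚ ℕ→ℚ (n !)) (trans (S-ker n {v} {ν} lv p) (S-↭ n {v} {u} {ν} lv v↭u p)) ⟩
      S ν u *ℚ ℕ→ℚ (n !) ∎
      where
        lv : length v ≡ n
        lv = trans (↭ₚ.↭-length v↭u) lu
        kv∈ = ker-∈-setPartitions v lv

-- For fixed ν the differences between ⟨S_ν , S_l⟩ and its expected value are, by
-- `pairing-expansion`, the coefficients of a linear relation among the S_l.
orthogonality : ∀ n ν μ → ν ⊢ n → μ ⊢ n → ∀ G → IsStdForm n G → pairing n G (S ν) (S μ) ≡ ℕ→ℚ (n ! * n !) *ℚ δ ν μ
orthogonality n ν μ p q G std-form = difference-zero (pairing n G (S ν) (S μ)) (N *ℚ δ ν μ)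
  (S-independent-on n (λ l → pairing n G (S ν) (S l) -ℚ N *ℚ δ ν l) relation q)
  where
    open ≡-Reasoning
    N = ℕ→ℚ (n ! * n !)
    ps = partitionsOf n
    relation : ∀ u → length u ≡ n → Σ ps (λ l → (pairing n G (S ν) (S l) -ℚ N *ℚ δ ν l) *ℚ S l u) ≡ 0ℚ
    relation u lu = begin
      Σ ps (λ l → (pairing n G (S ν) (S l) -ℚ N *ℚ δ ν l) *ℚ S l u)
        ≡⟨ Σ-cong ps (λ l → expand (pairing n G (S ν) (S l)) N (𝟙 (ν ≟L l)) (S l u)) ⟩
      Σ ps (λ l → S l u *ℚ pairing n G (S ν) (S l) +ℚ -ℚ N *ℚ (𝟙 (ν ≟L l) *ℚ S l u))
        ≡⟨ trans (Σ-+ ps) (cong₂ _+ℚ_ (pairing-expansion n ν p G std-form u lu)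
             (trans (Σ-distribˡ (-ℚ N) ps) (cong (-ℚ N *ℚ_) (Σ-pick (ν ≟L_) {f = λ l → S l u} (Unique-partitionsOf n) (∈-partitionsOf⁺ n p) refl (λ _ _ → sym))))) ⟩
      N *ℚ S ν u +ℚ -ℚ N *ℚ S ν u
        ≡⟨ cong (N *ℚ S ν u +ℚ_) (ℚₚ.neg-distribˡ-* N (S ν u)) ⟨
      N *ℚ S ν u +ℚ -ℚ (N *ℚ S ν u)
        ≡⟨ ℚₚ.+-inverseʳ (N *ℚ S ν u) ⟩
      0ℚ ∎
      where
        expand : ∀ a m d s → (a -ℚ m *ℚ d) *ℚ s ≡ s *ℚ a +ℚ -ℚ m *ℚ (d *ℚ s)
        expand a m d s = trans (ℚₚ.*-distribʳ-+ s a (-ℚ (m *ℚ d))) (cong₂ _+ℚ_ (ℚₚ.*-comm a s)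
          (trans (cong (_*ℚ s) (ℚₚ.neg-distribˡ-* m d)) (ℚₚ.*-assoc (-ℚ m) d s)))

theorem6p2 : (∀ (n : ℕ) (ν : List ℕ) → ν ⊢ n → ∀ (w : Word) →
    S ν w ≡ Σℚ (filter (λ μ → μ ⊴? ν) (partitionsOf n))
    (λ μ → ℕ→ℚ ((μ !ₚ) * kostka ν μ)
    *ℚ Σℚ (filter (λ σ → typeOf σ ≟L μ) (setPartitions n))
    (λ σ → mSP σ w)))
    × (∀ (cs : List (List ℕ × ℚ)) → All (λ c → IsPartition (proj₁ c)) cs →
    Unique (map proj₁ cs) →
    (∀ (w : Word) → Σℚ cs (λ c → proj₂ c *ℚ S (proj₁ c) w) ≡ 0ℚ) →
    All (λ c → proj₂ c ≡ 0ℚ) cs)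
    × (∀ (n : ℕ) (ν : List ℕ) → ν ⊢ n → ∀ (α : List ℕ) →
    ρ (S ν) α ≡ ℕ→ℚ (n !) *ℚ schur ν α)
    × (∀ (n : ℕ) (ν : List ℕ) → ν ⊢ n → ∀ (w : Word) →
    ρ̃ (scaleC (ℕ→ℚ (n !)) (schur ν)) w ≡ S ν w)
    × (∀ (n : ℕ) (ν μ : List ℕ) → ν ⊢ n → μ ⊢ n →
    ∀ (G : List ℕ → List ℕ → ℚ) → IsStdForm n G →
    pairing n G (S ν) (S μ) ≡ ℕ→ℚ (n ! * n !) *ℚ δ ν μ)
theorem6p2 = monomial-expansion
  , (λ cs parts uniq h → S-independent cs parts uniq (λ w → trans (sym (Σℚ≡Σ cs (λ c → proj₂ c *ℚ S (proj₁ c) w))) (h w)))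
  , commutative-image , lift-schur , orthogonality
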